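{- Let $q \ge 2$ be a prime and $n \ge 1$. Let $S \subset \mathbb{F}_q^n \times \mathbb{F}_q^n$ be a set containing no three points of the form $$(x,y),\ (x,y+d),\ (x+d,y')$$ with $x,y,y' \in \mathbb{F}_q^n$ and $d \in \mathbb{F}_q^n \setminus \{0\}$. Then $$|S| \le 3\, q^{(2-c_q)n},$$ where $c_q$ is the positive constant depending only on $q$ defined by $$q^{1-c_q} = \inf_{0<x<1} x^{ -(q-1)/3}\,(1+x+\dots+x^{q-1}).$$ -}

module Defs where

open import Data.Nat.Base as ℕ using (ℕ; zero; suc; NonZero)
open import Data.Nat.DivMod using (_mod_)
open import Data.Integer.Base using (+_; -[1+_])
open import Data.Rational.Base as ℚ using (ℚ; 0ℚ; 1ℚ; ↥_; ↧ₙ_; _/_; +-*-rawSemiring)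
open import Algebra.Definitions.RawSemiring +-*-rawSemiring using () renaming (_^_ to _^ℚ_)
open import Data.Fin.Base using (Fin; toℕ)
open import Data.Vec.Base using (Vec; zipWith; replicate)
open import Data.List.Base using (List)
open import Data.List.Membership.Propositional using (_∈_)
open import Data.Product.Base using (_×_; _,_; ∃; ∃₂)
open import Data.Sum.Base using (_⊎_)
open import Relation.Nullary using (¬_)
open import Relation.Binary.PropositionalEquality using (_≢_)

-- For q prime, 𝔽 q is the field ℤ/q; only its additive group is needed here.
𝔽 : ℕ → Set
𝔽 = Fin

𝔽^ : ℕ → ℕ → Set
𝔽^ q n = Vec (𝔽 q) n

module _ {q : ℕ} .{{_ : NonZero q}} where

  _+𝔽_ : 𝔽 q → 𝔽 q → 𝔽 q
  a +𝔽 b = (toℕ a ℕ.+ toℕ b) mod q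

  infixl 6 _⊕_
  _⊕_ : ∀ {n} → 𝔽^ q n → 𝔽^ q n → 𝔽^ q n
  _⊕_ = zipWith _+𝔽_

  𝟎 : ∀ {n} → 𝔽^ q n
  𝟎 {n} = replicate n (0 mod q)

  -- A finite set is a list; duplicate-freeness is imposed where it is counted.
  CornerFree : ∀ {n} → List (𝔽^ q n × 𝔽^ q n) → Set
  CornerFree S = ∀ x y y′ d → d ≢ 𝟎 →
    ¬ ((x , y) ∈ S × (x , y ⊕ d) ∈ S × (x ⊕ d , y′) ∈ S)

-- Real arithmetic.  A Cut is a set L of rational lower bounds and a set U of
-- rational upper bounds, and ℝ consists of the Dedekind cuts among them.  The
-- operations are those of interval arithmetic: they are given on all pairs of
-- sets, and on (the cuts of) elements of ℝ in the domain of the operation they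
-- yield the cut of the usual real result.
record Cut : Set₁ where
  field
    L U : ℚ → Set

open Cut public

record ℝ : Set₁ where
  field
    cut         : Cut
    L-inhabited : ∃ λ r → L cut r
    U-inhabited : ∃ λ r → U cut r
    L-lower     : ∀ {r s} → r ℚ.< s → L cut s → L cut r
    U-upper     : ∀ {r s} → r ℚ.< s → U cut r → U cut s
    L-open      : ∀ {r} → L cut r → ∃ λ s → r ℚ.< s × L cut s
    U-open      : ∀ {s} → U cut s → ∃ λ r → r ℚ.< s × U cut r
    disjoint    : ∀ {r} → ¬ (L cut r × U cut r)
    located     : ∀ {r s} → r ℚ.< s → L cut r ⊎ U cut s

open ℝ public using (cut)

infix 4 _<_ _≤_
_<_ : Cut → Cut → Set
x < y = ∃ λ r → U x r × L y r

_≤_ : Cut → Cut → Set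
x ≤ y = ¬ (y < x)

fromℚ : ℚ → Cut
fromℚ p = record { L = λ r → r ℚ.< p ; U = λ r → p ℚ.< r }

fromℕ : ℕ → Cut
fromℕ m = fromℚ (+ m / 1)

infix  8 -_
infixl 6 _+_ _-_
infixl 7 _*_
infixr 9 _^_ _^ⁿ_

_+_ : Cut → Cut → Cut
x + y = record
  { L = λ r → ∃₂ λ a b → L x a × L y b × r ℚ.< a ℚ.+ b
  ; U = λ r → ∃₂ λ a b → U x a × U y b × a ℚ.+ b ℚ.< r
  }

-_ : Cut → Cut
- x = record { L = λ r → U x (ℚ.- r) ; U = λ r → L x (ℚ.- r) }

_-_ : Cut → Cut → Cut
x - y = x + - y

-- Box x y holds the a, b, c, d with a < x < b and c < y < d.
record Box (x y : Cut) : Set where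
  field
    a b c d : ℚ
    a<x : L x a
    x<b : U x b
    c<y : L y c
    y<d : U y d

-- On a box, x y lies between the least and the greatest corner value.
_*_ : Cut → Cut → Cut
x * y = record
  { L = λ r → ∃ λ (B : Box x y) → let open Box B in
      r ℚ.< a ℚ.* c × r ℚ.< a ℚ.* d × r ℚ.< b ℚ.* c × r ℚ.< b ℚ.* d
  ; U = λ r → ∃ λ (B : Box x y) → let open Box B in
      a ℚ.* c ℚ.< r × a ℚ.* d ℚ.< r × b ℚ.* c ℚ.< r × b ℚ.* d ℚ.< r
  }

_^ⁿ_ : Cut → ℕ → Cut
x ^ⁿ zero  = fromℕ 1
x ^ⁿ suc k = x * x ^ⁿ k

-- For rationals a, u > 0: a ^ e < u and u < a ^ e, where e = m / k, by raising
-- to the k-th power: a ^ m < u ^ k and u ^ k < a ^ m.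
Pow<_ : ℚ → ℚ → ℚ → Set
(Pow< u) a e with ↥ e
... | + m      = a ^ℚ m ℚ.< u ^ℚ ↧ₙ e
... | -[1+ m ] = 1ℚ ℚ.< u ^ℚ ↧ₙ e ℚ.* a ^ℚ suc m

_<Pow : ℚ → ℚ → ℚ → Set
(u <Pow) a e with ↥ e
... | + m      = u ^ℚ ↧ₙ e ℚ.< a ^ℚ m
... | -[1+ m ] = u ^ℚ ↧ₙ e ℚ.* a ^ℚ suc m ℚ.< 1ℚ

-- x ^ y for real y and x > 0 (both L and U are empty if x ≤ 0).  On a box in
-- the region x > 0, x ^ y is monotone in each variable separately, so again it
-- lies between the least and the greatest corner value.
_^_ : Cut → Cut → Cut
x ^ y = record
  { L = λ r → ∃ λ (B : Box x y) → let open Box B in 0ℚ ℚ.< a ×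
      ∃ λ u → 0ℚ ℚ.< u × r ℚ.≤ u ×
      (u <Pow) a c × (u <Pow) a d × (u <Pow) b c × (u <Pow) b d
  ; U = λ r → ∃ λ (B : Box x y) → let open Box B in 0ℚ ℚ.< a × 0ℚ ℚ.< r ×
      (Pow< r) a c × (Pow< r) a d × (Pow< r) b c × (Pow< r) b d
  }

-- 1 + x + … + x ^ (m - 1)
geom : Cut → ℕ → Cut
geom x zero    = fromℕ 0
geom x (suc m) = geom x m + x ^ⁿ m

-- y = inf { f x ∣ x ∈ ℝ , D x }
IsInfimum : Cut → (D : ℝ → Set) → (f : ℝ → Cut) → Set₁
IsInfimum y D f =
  (∀ x → D x → y ≤ f x) ×
  (∀ (z : ℝ) → (∀ x → D x → cut z ≤ f x) → cut z ≤ y)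

InUnitInterval : ℝ → Set
InUnitInterval x = fromℕ 0 < cut x × cut x < fromℕ 1

-- x ^ (-(q-1)/3) (1 + x + … + x ^ (q-1))
objective : ℕ → ℝ → Cut
objective q x = cut x ^ (- fromℚ (+ (q ℕ.∸ 1) / 3)) * geom (cut x) q

module Submission where

-- Fix q prime and m = q - 1, and let M be the number of exponents in [0, m]^n of
-- weight at most n m / 3.  By Vandermonde the indicator function of
-- x - y + y′ = z is, modulo q, a sum of products f(y′) g(x - y) h(z) of binomial
-- monomials of total weight n m, so each term has a factor of weight ≤ n m / 3.
-- Let h on X = { x ∣ the fibre A_x = { y ∣ (x , y) ∈ S } is nonempty } be
-- orthogonal to the M light monomials and nonzero at all but M points of X.
-- Summed against h, the indicator restricted to A_x becomes h(x) times the
-- identity matrix, of rank at most 2 M, so |A_x| ≤ 2 M where h(x) ≠ 0 and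
-- trivially |A_x| ≤ q^n elsewhere; hence |S| ≤ 3 M q^n.  Moreover
-- M x^(n m / 3) ≤ (1 + x + … + x^m)^n for 0 < x < 1.
--
-- On the analytic side, the cube Φ(x) = (1 + … + x^m)³ x^(-m) of the objective
-- is rational for rational x, so comparing it with a rational power of q³ is
-- decidable, and since Φ varies slowly along a geometric grid, so is locating
-- its infimum: this makes c a Dedekind cut.

open import Algebra.Bundles using (CommutativeSemiring)
open import Level using (0ℓ)

-- All congruences are divisibilities between natural numbers: residues enter through their
-- representatives, with `q ∸ toℕ b` for -b and `m ∸ toℕ c` for -1 - c. This is why binomial
-- coefficients replace powers: C(s, q - 1) detects s ≡ -1 modulo q, as 1 - (s + 1)^(q - 1) would,
-- and Vandermonde expands it over a sum without signs. Rank is handled by duality, through vectors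
-- that annihilate given functionals and have few zero coordinates. This is used twice, for h and
-- then on each fibre. A term light in z is killed by h, so only the terms light in y′ or in x - y
-- count towards the rank, hence 2 M and not 3 M. Corner-freeness suffices because z need only lie
-- in X: if z = x + d with d ≠ 0, any point of S over z completes a corner. Constructively, an
-- infimum does not come with a located cut, so the analytic part needs a search with an explicit
-- modulus. Rational points suffice for it: an upper bound in interval arithmetic holds on a whole
-- box, in particular at a rational corner.

-- Finite sums over lists, generic so as to serve both ℕ and ℚ.

module ListSum (R : CommutativeSemiring 0ℓ 0ℓ) where
  open import Data.List.Base using (List; []; _∷_; _++_; map; cartesianProductWith)
  open CommutativeSemiring R
  open import Relation.Binary.Reasoning.Setoid setoid
  open import Algebra.Properties.CommutativeSemigroup +-commutativeSemigroup using (interchange)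

  private variable
    A B C : Set

  ∑ : List A → (A → Carrier) → Carrier
  ∑ []       f = 0#
  ∑ (x ∷ xs) f = f x + ∑ xs f

  ∑-cong : ∀ (xs : List A) {f g} → (∀ x → f x ≈ g x) → ∑ xs f ≈ ∑ xs g
  ∑-cong []       f≈g = refl
  ∑-cong (x ∷ xs) f≈g = +-cong (f≈g x) (∑-cong xs f≈g)

  ∑-zero : ∀ (xs : List A) → ∑ xs (λ _ → 0#) ≈ 0#
  ∑-zero []       = refl
  ∑-zero (x ∷ xs) = trans (+-identityˡ _) (∑-zero xs)

  ∑-+ : ∀ (xs : List A) f g → ∑ xs (λ x → f x + g x) ≈ ∑ xs f + ∑ xs g
  ∑-+ []       f g = sym (+-identityˡ 0#)
  ∑-+ (x ∷ xs) f g = trans (+-congˡ (∑-+ xs f g)) (interchange _ _ _ _)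

  ∑-*ˡ : ∀ c (xs : List A) f → ∑ xs (λ x → c * f x) ≈ c * ∑ xs f
  ∑-*ˡ c []       f = sym (zeroʳ c)
  ∑-*ˡ c (x ∷ xs) f = trans (+-congˡ (∑-*ˡ c xs f)) (sym (distribˡ c _ _))

  ∑-*ʳ : ∀ c (xs : List A) f → ∑ xs (λ x → f x * c) ≈ ∑ xs f * c
  ∑-*ʳ c xs f = begin
    ∑ xs (λ x → f x * c) ≈⟨ ∑-cong xs (λ x → *-comm (f x) c) ⟩
    ∑ xs (λ x → c * f x) ≈⟨ ∑-*ˡ c xs f ⟩
    c * ∑ xs f           ≈⟨ *-comm c _ ⟩
    ∑ xs f * c           ∎

  ∑-swap : ∀ (xs : List A) (ys : List B) (f : A → B → Carrier) →
    ∑ xs (λ x → ∑ ys (f x)) ≈ ∑ ys (λ y → ∑ xs (λ x → f x y))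
  ∑-swap []       ys f = sym (∑-zero ys)
  ∑-swap (x ∷ xs) ys f = trans (+-congˡ (∑-swap xs ys f)) (sym (∑-+ ys (f x) _))

  ∑-++ : ∀ (xs ys : List A) f → ∑ (xs ++ ys) f ≈ ∑ xs f + ∑ ys f
  ∑-++ []       ys f = sym (+-identityˡ _)
  ∑-++ (x ∷ xs) ys f = trans (+-congˡ (∑-++ xs ys f)) (sym (+-assoc _ _ _))

  ∑-map : ∀ (h : A → B) xs (f : B → Carrier) → ∑ (map h xs) f ≈ ∑ xs (λ x → f (h x))
  ∑-map h []       f = refl
  ∑-map h (x ∷ xs) f = +-congˡ (∑-map h xs f)

  ∑-product : ∀ (h : A → B → C) xs ys (f : C → Carrier) →
    ∑ (cartesianProductWith h xs ys) f ≈ ∑ xs (λ x → ∑ ys (λ y → f (h x y)))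
  ∑-product h []       ys f = refl
  ∑-product h (x ∷ xs) ys f =
    trans (∑-++ (map (h x) ys) _ f) (+-cong (∑-map (h x) ys f) (∑-product h xs ys f))

  ∑-*-∑ : ∀ (xs : List A) (ys : List B) f g →
    ∑ xs (λ x → ∑ ys (λ y → f x * g y)) ≈ ∑ xs f * ∑ ys g
  ∑-*-∑ xs ys f g = begin
    ∑ xs (λ x → ∑ ys (λ y → f x * g y)) ≈⟨ ∑-cong xs (λ x → ∑-*ˡ (f x) ys g) ⟩
    ∑ xs (λ x → f x * ∑ ys g)           ≈⟨ ∑-*ʳ (∑ ys g) xs f ⟩
    ∑ xs f * ∑ ys g                     ∎

-- Linear algebra modulo a prime.

module LinearAlgebra where
  open import Data.Nat.Base
  open import Data.Nat.Properties
  open import Data.Nat.Divisibility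
  open import Data.Nat.Primality
  open import Data.Nat.Coprimality using (coprime-Bézout; Coprime) 
  open import Data.Nat.GCD using (module Bézout)
  open import Data.Nat.Tactic.RingSolver using (solve-∀)
  open import Data.Bool.Base using (if_then_else_)
  open import Data.List.Base using (List; []; _∷_; length; map)
  open import Data.List.Properties using (length-map)
  open import Data.List.Membership.Propositional using (_∈_; _∉_)
  open import Data.List.Relation.Unary.Any using (here; there; any?)
  open import Data.List.Relation.Unary.All.Properties using (¬Any⇒All¬)
  open import Data.List.Relation.Unary.All as All using (All; []; _∷_)
  open import Data.List.Relation.Unary.All.Properties using (map⁻)
  open import Data.List.Relation.Unary.AllPairs using (_∷_)
  open import Data.List.Relation.Unary.Unique.Propositional using (Unique)
  open import Data.List.Relation.Unary.Unique.Propositional.Properties using (Unique[x∷xs]⇒x∉xs)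
  open import Data.Product.Base using (_×_; _,_; ∃; proj₁; proj₂)
  open import Data.Sum.Base using (inj₁; inj₂)
  open import Data.Empty using (⊥-elim)
  open import Relation.Nullary using (Dec; yes; no; does; ¬_; ¬?)
  open import Relation.Binary.Definitions using (DecidableEquality)
  open import Relation.Binary.PropositionalEquality
  open ListSum +-*-commutativeSemiring public

  private variable
    A : Set

  𝟙 : ∀ {P : Set} → Dec P → ℕ
  𝟙 d = if does d then 1 else 0

  𝟙-yes : ∀ {P : Set} (d : Dec P) → P → 𝟙 d ≡ 1
  𝟙-yes (yes _) _ = refl
  𝟙-yes (no ¬p) p = ⊥-elim (¬p p)

  𝟙-no : ∀ {P : Set} (d : Dec P) → ¬ P → 𝟙 d ≡ 0
  𝟙-no (yes p) ¬p = ⊥-elim (¬p p)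
  𝟙-no (no _)  _  = refl

  ∑-mono : ∀ (xs : List A) {f g} → (∀ {x} → x ∈ xs → f x ≤ g x) → ∑ xs f ≤ ∑ xs g
  ∑-mono []       f≤g = z≤n
  ∑-mono (x ∷ xs) f≤g = +-mono-≤ (f≤g (here refl)) (∑-mono xs (λ p → f≤g (there p)))

  ∑-const : ∀ (xs : List A) c → ∑ xs (λ _ → c) ≡ length xs * c
  ∑-const []       c = refl
  ∑-const (x ∷ xs) c = cong (c +_) (∑-const xs c)

  ∈⇒≤∑ : ∀ {xs : List A} {x} f → x ∈ xs → f x ≤ ∑ xs f
  ∈⇒≤∑ f (here refl) = m≤m+n _ _
  ∈⇒≤∑ {xs = y ∷ _} f (there p)   = ≤-trans (∈⇒≤∑ f p) (m≤n+m _ (f y))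

  ∣-∑ : ∀ {d} (xs : List A) {f} → (∀ {x} → x ∈ xs → d ∣ f x) → d ∣ ∑ xs f
  ∣-∑ []       d∣f = _ ∣0
  ∣-∑ (x ∷ xs) d∣f = ∣m∣n⇒∣m+n (d∣f (here refl)) (∣-∑ xs (λ p → d∣f (there p)))

  -- The remaining terms cancel modulo d. This reads off the single term of a sum that need not
  -- vanish.
  ∣∑⇒∣ : ∀ {d} {xs : List A} {x} f → Unique xs → x ∈ xs →
    (∀ {y} → y ∈ xs → y ≢ x → d ∣ f y) → d ∣ ∑ xs f → d ∣ f x
  ∣∑⇒∣ f (x∉ ∷ u) (here refl) others d∣∑ =
    ∣m+n∣n⇒∣m d∣∑ (∣-∑ _ (λ p → others (there p) (λ eq → All.lookup x∉ p (sym eq))))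
    where
    ∣m+n∣n⇒∣m : ∀ {d m n} → d ∣ m + n → d ∣ n → d ∣ m
    ∣m+n∣n⇒∣m {d} {m} {n} p q = ∣m+n∣m⇒∣n (subst (d ∣_) (+-comm m n) p) q
  ∣∑⇒∣ f (x∉ ∷ u) (there p) others d∣∑ =
    ∣∑⇒∣ f u p (λ q → others (there q))
      (∣m+n∣m⇒∣n d∣∑ (others (here refl) (All.lookup x∉ p)))

  module _ (_≟_ : DecidableEquality A) where

    δ : A → A → ℕ
    δ x y = 𝟙 (x ≟ y)

    ∑-δ-∉ : ∀ xs {x₀} (f : A → ℕ) → x₀ ∉ xs → ∑ xs (λ x → f x * δ x x₀) ≡ 0
    ∑-δ-∉ []       f x∉ = refl
    ∑-δ-∉ (x ∷ xs) f x∉ = cong₂ _+_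
      (trans (cong (f x *_) (𝟙-no (x ≟ _) (λ eq → x∉ (here (sym eq))))) (*-zeroʳ (f x)))
      (∑-δ-∉ xs f (λ p → x∉ (there p)))

    ∑-δ : ∀ {xs x₀} (f : A → ℕ) → Unique xs → x₀ ∈ xs → ∑ xs (λ x → f x * δ x x₀) ≡ f x₀
    ∑-δ {x₀ ∷ xs} f u (here refl) = trans
      (cong₂ _+_ (trans (cong (f x₀ *_) (𝟙-yes (x₀ ≟ x₀) refl)) (*-identityʳ (f x₀)))
                 (∑-δ-∉ xs f (Unique[x∷xs]⇒x∉xs u)))
      (+-identityʳ (f x₀))
    ∑-δ {x ∷ xs} {x₀} f (x∉ ∷ u) (there p) = cong₂ _+_
      (trans (cong (f x *_) (𝟙-no (x ≟ x₀) (All.lookup x∉ p))) (*-zeroʳ (f x)))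
      (∑-δ f u p)

    ∑-δ≤1 : ∀ {xs} x₀ → Unique xs → ∑ xs (λ x → δ x x₀) ≤ 1
    ∑-δ≤1 {xs} x₀ u with any? (x₀ ≟_) xs
    ... | yes p = ≤-reflexive (trans (∑-cong xs (λ x → sym (*-identityˡ (δ x x₀)))) (∑-δ (λ _ → 1) u p))
    ... | no ¬p = ≤-trans (≤-reflexive (trans (∑-cong xs (λ x → sym (*-identityˡ (δ x x₀)))) (∑-δ-∉ xs (λ _ → 1) ¬p))) z≤n

    -- Double counting of the pairs x ∈ `xs`, y ∈ `ys` with x = y: every x occurs in at least one of
    -- them, every y in at most one.
    Unique-⊆⇒length≤ : ∀ {xs ys} → Unique xs → (∀ {x} → x ∈ xs → x ∈ ys) → length xs ≤ length ys
    Unique-⊆⇒length≤ {xs} {ys} u xs⊆ys = begin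
      length xs                            ≡⟨ *-identityʳ _ ⟨
      length xs * 1                        ≡⟨ ∑-const xs 1 ⟨
      ∑ xs (λ _ → 1)                       ≤⟨ ∑-mono xs occurs ⟩
      ∑ xs (λ x → ∑ ys (δ x))              ≡⟨ ∑-swap xs ys δ ⟩
      ∑ ys (λ y → ∑ xs (λ x → δ x y))      ≤⟨ ∑-mono ys (λ {y} _ → ∑-δ≤1 y u) ⟩
      ∑ ys (λ _ → 1)                       ≡⟨ ∑-const ys 1 ⟩
      length ys * 1                        ≡⟨ *-identityʳ _ ⟩
      length ys                            ∎
      where
      open ≤-Reasoning
      occurs : ∀ {x} → x ∈ xs → 1 ≤ ∑ ys (δ x)
      occurs {x} p = ≤-trans (≤-reflexive (sym (𝟙-yes (x ≟ x) refl))) (∈⇒≤∑ (δ x) (xs⊆ys p))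

  prime⇒∤1 : ∀ {p} → Prime p → ¬ p ∣ 1
  prime⇒∤1 p-prime p∣1 = ¬prime[1] (subst Prime (∣1⇒≡1 p∣1) p-prime)

  -- With a negated inverse, elimination cancels by adding and so stays within ℕ.
  prime⇒negInverse : ∀ {p a} → Prime p → ¬ p ∣ a → ∃ λ w → p ∣ 1 + w * a
  prime⇒negInverse {p} {a} p-prime p∤a with coprime-Bézout coprime
    where
    coprime : Coprime p a
    coprime (d∣p , d∣a) with prime⇒irreducible p-prime d∣p
    ... | inj₁ d≡1 = d≡1
    ... | inj₂ refl = ⊥-elim (p∤a d∣a)
  ... | Bézout.+- x y eq = y , divides x eq
  ... | Bézout.-+ x y eq with p | p-prime
  ...   | zero  | p-prime = ⊥-elim (¬prime[0] p-prime)
  -- Here Bézout gives 1 + x p = y a, so y is the inverse itself and y (p - 1) its negative.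
  ...   | suc m | _       = y * m , divides (1 + x * m) (trans (rearrange y m a)
            (trans (cong (λ t → 1 + t * m) (sym eq)) (expand x m)))
    where
    rearrange : ∀ y m a → 1 + y * m * a ≡ 1 + y * a * m
    rearrange = solve-∀
    expand : ∀ x m → 1 + (1 + x * (1 + m)) * m ≡ (1 + x * m) * (1 + m)
    expand = solve-∀

  module Annihilator {p} (p-prime : Prime p) (_≟_ : DecidableEquality A) where

    Annihilates : (A → ℕ) → List A → (A → ℕ) → Set
    Annihilates v xs g = p ∣ ∑ xs (λ x → v x * g x)

    zeros : (A → ℕ) → List A → ℕ
    zeros v xs = ∑ xs (λ x → 𝟙 (p ∣? v x))

    -- Gaussian elimination: one pivot x₀ is spent on each functional, and v
    -- starts out as 1 everywhere, so at most k coordinates vanish.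
    annihilator : ∀ {xs} → Unique xs → ∀ k (gs : List (A → ℕ)) → length gs ≡ k →
      ∃ λ v → All (Annihilates v xs) gs × zeros v xs ≤ k
    annihilator {xs} u zero [] _ = (λ _ → 1) , [] , ≤-reflexive
      (trans (∑-cong xs (λ _ → 𝟙-no (p ∣? 1) (prime⇒∤1 p-prime))) (∑-zero xs))
    annihilator {xs} u (suc k) (g₀ ∷ gs) |gs|≡k with any? (λ x → ¬? (p ∣? g₀ x)) xs
    -- `g₀` vanishes modulo p on all of `xs`, so every v annihilates it.
    ... | no ¬∃ = let v , kills , zeros≤ = annihilator u k gs (suc-injective |gs|≡k) in
      v , ∣-∑ xs (λ {x} x∈ → ∣n⇒∣m*n (v x) (p∣g₀ x∈)) ∷ kills , m≤n⇒m≤1+n zeros≤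
      where
      p∣g₀ : ∀ {x} → x ∈ xs → p ∣ g₀ x
      p∣g₀ {x} x∈ with p ∣? g₀ x
      ... | yes d = d
      ... | no ¬d = ⊥-elim (All.lookup (¬Any⇒All¬ xs ¬∃) x∈ ¬d)
    ... | yes ∃x = pivot (find ∃x)
      where
      open import Data.List.Membership.Propositional using (find)
      pivot : (∃ λ x₀ → x₀ ∈ xs × ¬ p ∣ g₀ x₀) →
        ∃ λ v → All (Annihilates v xs) (g₀ ∷ gs) × zeros v xs ≤ suc k
      pivot (x₀ , x₀∈ , p∤) = v , kills₀ ∷ All.map (λ {g} → kills g) (map⁻ (proj₁ (proj₂ rec)))
                            , zeros≤
        where
        w = proj₁ (prime⇒negInverse p-prime p∤)
        p∣1+w = proj₂ (prime⇒negInverse p-prime p∤)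
        -- `reduce g` vanishes modulo p at the pivot. With v as chosen below, Σ v g and Σ v′ (reduce
        -- g) are the same number.
        reduce : (A → ℕ) → A → ℕ
        reduce g x = g x + w * g x₀ * g₀ x
        rec = annihilator u k (map reduce gs) (trans (length-map reduce gs) (suc-injective |gs|≡k))
        v′ = proj₁ rec
        -- Correcting v′ at x₀ by t = T w turns Σ v g₀ into T (1 + w g₀(x₀)), a multiple of p. Only
        -- the coordinate x₀ changes, so at most one zero is added.
        T t : ℕ
        T = ∑ xs (λ x → v′ x * g₀ x)
        t = T * w
        v : A → ℕ
        v x = v′ x + t * δ _≟_ x x₀
        ∑v : ∀ g → ∑ xs (λ x → v x * g x) ≡ ∑ xs (λ x → v′ x * g x) + t * g x₀
        ∑v g = trans (∑-cong xs (λ x → expand (v′ x) t (δ _≟_ x x₀) (g x)))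
          (trans (∑-+ xs _ _) (cong (∑ xs (λ x → v′ x * g x) +_)
            (∑-δ _≟_ (λ x → t * g x) u x₀∈)))
          where
          expand : ∀ a t d g → (a + t * d) * g ≡ a * g + t * g * d
          expand = solve-∀
        kills₀ : Annihilates v xs g₀
        kills₀ = subst (p ∣_) (trans (factor T w (g₀ x₀)) (sym (∑v g₀))) (∣n⇒∣m*n T p∣1+w)
          where
          factor : ∀ T w a → T * (1 + w * a) ≡ T + T * w * a
          factor = solve-∀
        kills : ∀ g → Annihilates v′ xs (reduce g) → Annihilates v xs g
        kills g = subst (p ∣_) (trans
          (trans (∑-cong xs (λ x → expand (v′ x) (g x) (w * g x₀) (g₀ x)))
            (trans (∑-+ xs _ _) (cong (∑ xs (λ x → v′ x * g x) +_)
              (trans (∑-*ˡ (w * g x₀) xs _) (rearrange w (g x₀) T)))))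
          (sym (∑v g)))
          where
          expand : ∀ a g c h → a * (g + c * h) ≡ a * g + c * (a * h)
          expand = solve-∀
          rearrange : ∀ w a T → w * a * T ≡ T * w * a
          rearrange = solve-∀
        zero-of : ∀ x → 𝟙 (p ∣? v x) ≤ δ _≟_ x x₀ + 𝟙 (p ∣? v′ x)
        zero-of x with x ≟ x₀
        ... | yes _ = ≤-trans (𝟙≤1 (p ∣? _)) (m≤m+n 1 _)
          where
          𝟙≤1 : ∀ {P : Set} (d : Dec P) → 𝟙 d ≤ 1
          𝟙≤1 (yes _) = ≤-refl
          𝟙≤1 (no _)  = z≤n
        ... | no _ = ≤-reflexive (cong (λ e → 𝟙 (p ∣? e))
                       (trans (cong (v′ x +_) (*-zeroʳ t)) (+-identityʳ _)))
        zeros≤ : zeros v xs ≤ suc k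
        zeros≤ = begin
          zeros v xs                                      ≤⟨ ∑-mono xs (λ {x} _ → zero-of x) ⟩
          ∑ xs (λ x → δ _≟_ x x₀ + 𝟙 (p ∣? v′ x))         ≡⟨ ∑-+ xs _ _ ⟩
          ∑ xs (λ x → δ _≟_ x x₀) + zeros v′ xs           ≤⟨ +-mono-≤ (∑-δ≤1 _≟_ x₀ u) (proj₂ (proj₂ rec)) ⟩
          suc k                                           ∎
          where open ≤-Reasoning

-- Binomial coefficients modulo a prime, and Vandermonde's identity for vectors.

module Binomials where
  open import Data.Nat.Base
  open import Data.Nat.Properties
  open import Data.Nat.Divisibility
  open import Data.Nat.Primality
  open import Data.Nat.Combinatorics using (_C_; nCk+nC[k+1]≡[n+1]C[k+1]; nCn≡1; nC1≡n)
  open import Data.Nat.Tactic.RingSolver using (solve-∀)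
  open import Data.List.Base using (List; []; _∷_; [_]; map; cartesianProductWith)
  open import Data.List.Membership.Propositional using (_∈_)
  open import Data.List.Membership.Propositional.Properties using (∈-map⁺; ∈-map⁻; ∈-cartesianProductWith⁺; ∈-cartesianProductWith⁻)
  open import Data.List.Relation.Unary.Any using (here; there)
  open import Data.Vec.Base as Vec using (Vec; []; _∷_; zipWith; replicate; sum)
  open import Data.Product.Base using (_×_; _,_)
  open import Data.Sum.Base using (inj₁; inj₂)
  open import Data.Empty using (⊥-elim)
  open import Relation.Nullary using (¬_)
  open import Relation.Binary.PropositionalEquality hiding ([_])
  open LinearAlgebra

  private variable
    n : ℕ

  splits : ℕ → List (ℕ × ℕ)
  splits zero    = [ 0 , 0 ]
  splits (suc k) = (0 , suc k) ∷ map (λ (i , j) → suc i , j) (splits k)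

  ∈-splits⁻ : ∀ k {i j} → (i , j) ∈ splits k → i + j ≡ k
  ∈-splits⁻ zero    (here refl) = refl
  ∈-splits⁻ (suc k) (here refl) = refl
  ∈-splits⁻ (suc k) (there p) with ∈-map⁻ _ p
  ... | _ , q , refl = cong suc (∈-splits⁻ k q)

  ∈-splits⁺ : ∀ i j → (i , j) ∈ splits (i + j)
  ∈-splits⁺ zero    zero    = here refl
  ∈-splits⁺ zero    (suc j) = here refl
  ∈-splits⁺ (suc i) j       = there (∈-map⁺ _ (∈-splits⁺ i j))

  infixl 6 _⊞_
  _⊞_ : Vec ℕ n → Vec ℕ n → Vec ℕ n
  _⊞_ = zipWith _+_

  cons₂ : ℕ × ℕ → Vec ℕ n × Vec ℕ n → Vec ℕ (suc n) × Vec ℕ (suc n)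
  cons₂ (i , j) (I , J) = i ∷ I , j ∷ J

  splitsⁿ : Vec ℕ n → List (Vec ℕ n × Vec ℕ n)
  splitsⁿ []      = [ [] , [] ]
  splitsⁿ (k ∷ K) = cartesianProductWith cons₂ (splits k) (splitsⁿ K)

  ∈-splitsⁿ⁻ : ∀ (K : Vec ℕ n) {I J} → (I , J) ∈ splitsⁿ K → I ⊞ J ≡ K
  ∈-splitsⁿ⁻ []      (here refl) = refl
  ∈-splitsⁿ⁻ (k ∷ K) p with ∈-cartesianProductWith⁻ cons₂ (splits k) (splitsⁿ K) p
  ... | _ , _ , q , r , refl = cong₂ _∷_ (∈-splits⁻ k q) (∈-splitsⁿ⁻ K r)

  ∈-splitsⁿ⁺ : ∀ (I J : Vec ℕ n) → (I , J) ∈ splitsⁿ (I ⊞ J)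
  ∈-splitsⁿ⁺ []      []      = here refl
  ∈-splitsⁿ⁺ (i ∷ I) (j ∷ J) =
    ∈-cartesianProductWith⁺ cons₂ (∈-splits⁺ i j) (∈-splitsⁿ⁺ I J)

  ⊞-comm : ∀ (I J : Vec ℕ n) → I ⊞ J ≡ J ⊞ I
  ⊞-comm []      []      = refl
  ⊞-comm (i ∷ I) (j ∷ J) = cong₂ _∷_ (+-comm i j) (⊞-comm I J)

  ⊞-assoc : ∀ (I J K : Vec ℕ n) → (I ⊞ J) ⊞ K ≡ I ⊞ (J ⊞ K)
  ⊞-assoc []      []      []      = refl
  ⊞-assoc (i ∷ I) (j ∷ J) (k ∷ K) = cong₂ _∷_ (+-assoc i j k) (⊞-assoc I J K)

  sum-⊞ : ∀ (I J : Vec ℕ n) → sum (I ⊞ J) ≡ sum I + sum J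
  sum-⊞ []      []      = refl
  sum-⊞ (i ∷ I) (j ∷ J) = trans (cong (i + j +_) (sum-⊞ I J)) (rearrange i j (sum I) (sum J))
    where
    rearrange : ∀ i j s t → i + j + (s + t) ≡ i + s + (j + t)
    rearrange = solve-∀

  sum-replicate : ∀ n m → sum (replicate n m) ≡ n * m
  sum-replicate zero    m = refl
  sum-replicate (suc n) m = cong (m +_) (sum-replicate n m)

  C-vandermonde : ∀ a b k → (a + b) C k ≡ ∑ (splits k) (λ (i , j) → (a C i) * (b C j))
  C-vandermonde a       b zero    = refl
  C-vandermonde zero    b (suc k) = sym (trans
    (cong₂ _+_ (*-identityˡ (b C suc k)) (trans (∑-map _ (splits k) _) (∑-zero (splits k))))
    (+-identityʳ _))
  C-vandermonde (suc a) b (suc k) = begin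
    suc (a + b) C suc k                       ≡⟨ nCk+nC[k+1]≡[n+1]C[k+1] (a + b) k ⟨
    (a + b) C k + (a + b) C suc k             ≡⟨ cong₂ _+_ (C-vandermonde a b k) (C-vandermonde a b (suc k)) ⟩
    ∑ (splits k) low + ((a C 0) * (b C suc k) + ∑ (map _ (splits k)) (λ (i , j) → (a C i) * (b C j)))
                                              ≡⟨ cong (λ s → ∑ (splits k) low + (1 * (b C suc k) + s)) (∑-map _ (splits k) _) ⟩
    ∑ (splits k) low + (1 * (b C suc k) + ∑ (splits k) high)
                                              ≡⟨ rearrange (∑ (splits k) low) (1 * (b C suc k)) (∑ (splits k) high) ⟩
    1 * (b C suc k) + (∑ (splits k) low + ∑ (splits k) high)
                                              ≡⟨ cong (1 * (b C suc k) +_) (∑-+ (splits k) low high) ⟨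
    1 * (b C suc k) + ∑ (splits k) (λ x → low x + high x)
                                              ≡⟨ cong (1 * (b C suc k) +_) (∑-cong (splits k) pascal) ⟩
    1 * (b C suc k) + ∑ (splits k) (λ (i , j) → (suc a C suc i) * (b C j))
                                              ≡⟨ cong (1 * (b C suc k) +_) (∑-map _ (splits k) _) ⟨
    ∑ (splits (suc k)) (λ (i , j) → (suc a C i) * (b C j)) ∎
    where
    open ≡-Reasoning
    low high : ℕ × ℕ → ℕ
    low (i , j) = (a C i) * (b C j)
    high (i , j) = (a C suc i) * (b C j)
    rearrange : ∀ x y z → x + (y + z) ≡ y + (x + z)
    rearrange = solve-∀
    pascal : ∀ ((i , j) : ℕ × ℕ) → (a C i) * (b C j) + (a C suc i) * (b C j) ≡ (suc a C suc i) * (b C j)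
    pascal (i , j) = trans (sym (*-distribʳ-+ (b C j) (a C i) (a C suc i)))
                           (cong (_* (b C j)) (nCk+nC[k+1]≡[n+1]C[k+1] a i))

  -- Brings the prime into a product, so that Euclid's lemma yields divisibility of binomial
  -- coefficients without factorials.
  C-absorption : ∀ n k → suc k * ((suc n C suc k)) ≡ suc n * (n C k)
  C-absorption zero    zero    = refl
  C-absorption zero    (suc k) = *-zeroʳ k
  C-absorption (suc n) zero    = trans (*-identityˡ _) (trans (nC1≡n (suc (suc n))) (sym (*-identityʳ _)))
  C-absorption (suc n) (suc k) = begin
    (2 + k) * ((2 + n) C (2 + k))               ≡⟨ cong ((2 + k) *_) (nCk+nC[k+1]≡[n+1]C[k+1] (suc n) (suc k)) ⟨
    (2 + k) * (x + suc n C (2 + k))             ≡⟨ rearrange k x (suc n C (2 + k)) ⟩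
    suc k * x + x + (2 + k) * (suc n C (2 + k)) ≡⟨ cong₂ (λ s t → s + x + t) (C-absorption n k) (C-absorption n (suc k)) ⟩
    suc n * (n C k) + x + suc n * (n C suc k)       ≡⟨ rearrange′ n (n C k) x (n C suc k) ⟩
    x + suc n * (n C k + (n C suc k))             ≡⟨ cong (λ s → x + suc n * s) (nCk+nC[k+1]≡[n+1]C[k+1] n k) ⟩
    (2 + n) * x                                 ∎
    where
    open ≡-Reasoning
    x = (suc n C suc k)
    rearrange : ∀ k x y → (2 + k) * (x + y) ≡ (1 + k) * x + x + (2 + k) * y
    rearrange = solve-∀
    rearrange′ : ∀ n a x b → (1 + n) * a + x + (1 + n) * b ≡ x + (1 + n) * (a + b)
    rearrange′ = solve-∀

  -- The analogue of the monomial with exponent vector K: as a polynomial in A its degree is the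
  -- weight `sum K`.
  binom : Vec ℕ n → Vec ℕ n → ℕ
  binom []      []      = 1
  binom (a ∷ A) (k ∷ K) = (a C k) * binom A K

  binom-vandermonde : ∀ (A B K : Vec ℕ n) →
    binom (A ⊞ B) K ≡ ∑ (splitsⁿ K) (λ (I , J) → binom A I * binom B J)
  binom-vandermonde []      []      []      = refl
  binom-vandermonde (a ∷ A) (b ∷ B) (k ∷ K) = begin
    ((a + b) C k) * binom (A ⊞ B) K
      ≡⟨ cong₂ _*_ (C-vandermonde a b k) (binom-vandermonde A B K) ⟩
    ∑ (splits k) (λ (i , j) → (a C i) * (b C j)) * ∑ (splitsⁿ K) (λ (I , J) → binom A I * binom B J)
      ≡⟨ ∑-*-∑ (splits k) (splitsⁿ K) _ _ ⟨
    ∑ (splits k) (λ (i , j) → ∑ (splitsⁿ K) (λ (I , J) →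
      (a C i) * (b C j) * (binom A I * binom B J)))
      ≡⟨ ∑-cong (splits k) (λ (i , j) → ∑-cong (splitsⁿ K) (λ (I , J) →
           interchange (a C i) (b C j) (binom A I) (binom B J))) ⟩
    ∑ (splits k) (λ (i , j) → ∑ (splitsⁿ K) (λ (I , J) →
      (a C i) * binom A I * ((b C j) * binom B J)))
      ≡⟨ ∑-product cons₂ (splits k) (splitsⁿ K) _ ⟨
    ∑ (splitsⁿ (k ∷ K)) (λ (I , J) → binom (a ∷ A) I * binom (b ∷ B) J) ∎
    where
    open ≡-Reasoning
    interchange : ∀ x y z t → x * y * (z * t) ≡ x * z * (y * t)
    interchange = solve-∀

  module _ {q} (q-prime : Prime (suc q)) where

    -- By absorption the prime divides (s + 1) C(s, q), but not s + 1. So C(s, q) detects s ≡ -1.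
    ∤suc⇒∣C : ∀ s → ¬ suc q ∣ suc s → suc q ∣ (s C q)
    ∤suc⇒∣C s ∤ with euclidsLemma (suc s) (s C q) q-prime
      (divides ((suc s C suc q)) (trans (sym (C-absorption s q)) (*-comm (suc q) _)))
    ... | inj₁ d = ⊥-elim (∤ d)
    ... | inj₂ d = d

    ∣primeC : ∀ {i} → suc i < suc q → suc q ∣ (suc q C suc i)
    ∣primeC {i} i<q with euclidsLemma (suc i) ((suc q C suc i)) q-prime
      (divides (q C i) (trans (C-absorption q i) (*-comm (suc q) _)))
    ... | inj₁ d = ⊥-elim (<⇒≱ i<q (∣⇒≤ d))
    ... | inj₂ d = d

    -- By Vandermonde, C(p + q, q) = Σ C(p, i) C(q, q - i) ≡ 1 mod p for p = suc q.
    ∤C : ¬ suc q ∣ (suc q + q) C q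
    ∤C d = prime⇒∤1 q-prime (subst (suc q ∣_) (nCn≡1 q) (top q ≤-refl
      (subst (suc q ∣_) (C-vandermonde (suc q) q q) d)))
      where
      -- Every term with i ≥ 1 contains C(p, i) with 0 < i < p, so only the term i = 0 survives.
      top : ∀ k → k ≤ q → suc q ∣ ∑ (splits k) (λ (i , j) → (suc q C i) * (q C j)) → suc q ∣ (q C k)
      top zero    _   d = subst (suc q ∣_) refl d
      top (suc k) k≤q d = subst (suc q ∣_) (*-identityˡ _) (∣m+n∣m⇒∣n
        (subst (suc q ∣_) (+-comm (1 * (q C suc k)) _) d)
        (subst (suc q ∣_) (sym (∑-map _ (splits k) _)) (∣-∑ (splits k) λ {(i , j)} p →
          ∣m⇒∣m*n (q C j) (∣primeC (s≤s (≤-trans (s≤s (≤-trans (m≤m+n i j)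
            (≤-reflexive (∈-splits⁻ k p)))) k≤q))))))

-- The combinatorial bound for corner-free sets.

module Counting where
  open import Data.Nat.Base
  open import Data.Nat.Properties
  open import Data.Nat.DivMod
  open import Data.Nat.Divisibility
  open import Data.Nat.Primality
  open import Data.Nat.Combinatorics using (_C_)
  open import Data.Nat.Tactic.RingSolver using (solve-∀)
  open import Data.Fin.Base as Fin using (Fin; toℕ)
  open import Data.Fin.Properties as Fin using (toℕ-injective; toℕ-fromℕ<; toℕ<n)
  open import Data.List.Base as List using (List; []; _∷_; [_]; _++_; length; map; filter; cartesianProductWith; allFin; concatMap)
  open import Data.List.Properties using (length-map; length-++; length-filter; length-tabulate)
  open import Data.List.Membership.Propositional using (_∈_; find; lose)
  open import Data.List.Membership.Propositional.Properties
    using (∈-map⁺; ∈-filter⁺; ∈-filter⁻; ∈-allFin; ∈-cartesianProductWith⁺; ∈-concatMap⁺)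
  open import Data.List.Relation.Unary.Any using (here; any?)
  open import Data.List.Relation.Unary.All as All using (All; []; _∷_)
  open import Data.List.Relation.Unary.All.Properties using (map⁻; ++⁻ˡ; ++⁻ʳ)
  open import Data.List.Relation.Unary.AllPairs using ([]; _∷_)
  open import Data.List.Relation.Unary.Unique.Propositional using (Unique)
  import Data.List.Relation.Unary.Unique.Propositional.Properties as Unique
  open import Data.Vec.Base as Vec using (Vec; []; _∷_; zipWith; replicate; sum)
  open import Data.Vec.Properties using (∷-injective; ≡-dec)
  import Data.Product.Properties as Product
  open import Data.Product.Base using (_×_; _,_; proj₁; proj₂)
  open import Data.Sum.Base using (_⊎_; inj₁; inj₂)
  open import Data.Empty using (⊥-elim)
  open import Relation.Nullary using (¬_; Dec; yes; no)
  open import Relation.Binary.Definitions using (DecidableEquality)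
  open import Relation.Binary.PropositionalEquality hiding ([_])
  open import Defs using (𝔽; 𝔽^; _+𝔽_; _⊕_; 𝟎; CornerFree)
  open LinearAlgebra
  open Binomials

  length≡∑1 : ∀ {A : Set} (xs : List A) → length xs ≡ ∑ xs (λ _ → 1)
  length≡∑1 xs = sym (trans (∑-const xs 1) (*-identityʳ _))

  module _ (m : ℕ) where

    Low : ∀ {n} → Vec ℕ n × Vec ℕ n → Set
    Low {n} (I , _) = 3 * Vec.sum I ≤ n * m

    -- A light exponent is listed together with its complement, the exponent left for y′ and z when
    -- the light factor is the one in x - y.
    lows : ∀ n → List (Vec ℕ n × Vec ℕ n)
    lows n = filter (λ (I , _) → 3 * Vec.sum I ≤? n * m) (splitsⁿ (replicate n m))

    ∈-lows : ∀ {n} (I J : Vec ℕ n) → I ⊞ J ≡ replicate n m → Low (I , J) → (I , J) ∈ lows n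
    ∈-lows I J eq low = ∈-filter⁺ _ (subst (λ K → (I , J) ∈ splitsⁿ K) eq (∈-splitsⁿ⁺ I J)) low

    -- Pigeonhole on three weights whose sum is n m.
    third-low : ∀ {n} (I J K : Vec ℕ n) → J ⊞ (I ⊞ K) ≡ replicate n m →
      ¬ 3 * Vec.sum J ≤ n * m → 3 * Vec.sum I ≤ n * m ⊎ 3 * Vec.sum K ≤ n * m
    third-low {n} I J K eq high with 3 * Vec.sum I ≤? n * m | 3 * Vec.sum K ≤? n * m
    ... | yes low | _       = inj₁ low
    ... | no _    | yes low = inj₂ low
    ... | no hi   | no hk   = ⊥-elim (<-irrefl total
          (+-mono-< (≰⇒> high) (+-mono-< (≰⇒> hi) (≰⇒> hk))))
      where
      rearrange : ∀ a b c → 3 * a + (3 * b + 3 * c) ≡ 3 * (a + (b + c))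
      rearrange = solve-∀
      thrice : ∀ t → t + (t + t) ≡ 3 * t
      thrice = solve-∀
      total : n * m + (n * m + n * m) ≡ 3 * Vec.sum J + (3 * Vec.sum I + 3 * Vec.sum K)
      total = begin
        n * m + (n * m + n * m)            ≡⟨ thrice (n * m) ⟩
        3 * (n * m)                        ≡⟨ cong (3 *_) (sum-replicate n m) ⟨
        3 * Vec.sum (replicate n m)        ≡⟨ cong (λ K → 3 * Vec.sum K) eq ⟨
        3 * Vec.sum (J ⊞ (I ⊞ K))          ≡⟨ cong (3 *_) (trans (sum-⊞ J _) (cong (Vec.sum J +_) (sum-⊞ I K))) ⟩
        3 * (Vec.sum J + (Vec.sum I + Vec.sum K)) ≡⟨ rearrange (Vec.sum J) (Vec.sum I) (Vec.sum K) ⟨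
        3 * Vec.sum J + (3 * Vec.sum I + 3 * Vec.sum K) ∎
        where open ≡-Reasoning

  module SkewCorners {m} (q-prime : Prime (suc m)) where

    q : ℕ
    q = suc m

    difference : 𝔽 q → 𝔽 q → 𝔽 q
    difference b b′ = (toℕ b′ + (q ∸ toℕ b)) mod q

    toℕ≤m : ∀ (a : 𝔽 q) → toℕ a ≤ m
    toℕ≤m a = s≤s⁻¹ (toℕ<n a)

    toℕ-mod : ∀ s → toℕ (s mod q) ≡ s % q
    toℕ-mod s = toℕ-fromℕ< _

    -- The divisibility says a - b + b′ + (-1 - c) ≡ -1, that is, a + (b′ - b) ≡ c. An extra summand
    -- q keeps the rearrangement within ℕ.
    +-difference : ∀ (a b b′ c : 𝔽 q) →
      q ∣ suc (toℕ a + (q ∸ toℕ b) + (toℕ b′ + (m ∸ toℕ c))) → a +𝔽 difference b b′ ≡ c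
    +-difference a b b′ c q∣ = toℕ-injective (begin
      toℕ (a +𝔽 difference b b′)                     ≡⟨ toℕ-mod (toℕ a + toℕ (difference b b′)) ⟩
      (toℕ a + toℕ (difference b b′)) % q            ≡⟨ cong (λ t → (toℕ a + t) % q) (toℕ-mod (toℕ b′ + (q ∸ toℕ b))) ⟩
      (toℕ a + (toℕ b′ + (q ∸ toℕ b)) % q) % q       ≡⟨ %-distribˡ-+ (toℕ a) _ q ⟩
      (toℕ a % q + (toℕ b′ + (q ∸ toℕ b)) % q % q) % q ≡⟨ cong (λ t → (toℕ a % q + t) % q) (m%n%n≡m%n (toℕ b′ + (q ∸ toℕ b)) q) ⟩
      (toℕ a % q + (toℕ b′ + (q ∸ toℕ b)) % q) % q   ≡⟨ %-distribˡ-+ (toℕ a) _ q ⟨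
      X % q                                          ≡⟨ [m+n]%n≡m%n X q ⟨
      (X + q) % q                                    ≡⟨ cong (_% q) X+q ⟩
      (suc (toℕ a + (q ∸ toℕ b) + (toℕ b′ + (m ∸ toℕ c))) + toℕ c) % q
                                                     ≡⟨ %-remove-+ˡ (toℕ c) q∣ ⟩
      toℕ c % q                                      ≡⟨ m<n⇒m%n≡m (toℕ<n c) ⟩
      toℕ c                                          ∎)
      where
      open ≡-Reasoning
      X = toℕ a + (toℕ b′ + (q ∸ toℕ b))
      rearrange : ∀ a b b′ c d → a + (b′ + b) + (1 + (c + d)) ≡ 1 + (a + b + (b′ + c)) + d
      rearrange = solve-∀
      X+q : X + q ≡ suc (toℕ a + (q ∸ toℕ b) + (toℕ b′ + (m ∸ toℕ c))) + toℕ c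
      X+q = trans (cong (λ t → X + suc t) (sym (m∸n+n≡m (toℕ≤m c))))
                  (rearrange (toℕ a) (q ∸ toℕ b) (toℕ b′) (m ∸ toℕ c) (toℕ c))

    -- On the diagonal the argument of the binomial coefficient is the number q + m itself and not
    -- merely congruent to it, which is the case that `∤C` covers.
    diagonal : ∀ (a b : 𝔽 q) → toℕ a + (q ∸ toℕ b) + (toℕ b + (m ∸ toℕ a)) ≡ q + m
    diagonal a b = trans (rearrange (toℕ a) (q ∸ toℕ b) (toℕ b) (m ∸ toℕ a))
      (cong₂ _+_ (m∸n+n≡m (<⇒≤ (toℕ<n b))) (m∸n+n≡m (toℕ≤m a)))
      where
      rearrange : ∀ a b b′ c → a + b + (b′ + c) ≡ (b + b′) + (c + a)
      rearrange = solve-∀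

    +𝔽-identityʳ : ∀ (a : 𝔽 q) → a +𝔽 (0 mod q) ≡ a
    +𝔽-identityʳ a = toℕ-injective (trans (toℕ-mod (toℕ a + 0))
      (trans (cong (_% q) (+-identityʳ (toℕ a))) (m<n⇒m%n≡m (toℕ<n a))))

    ⊕-identityʳ : ∀ {n} (x : 𝔽^ q n) → x ⊕ 𝟎 ≡ x
    ⊕-identityʳ []      = refl
    ⊕-identityʳ (a ∷ x) = cong₂ _∷_ (+𝔽-identityʳ a) (⊕-identityʳ x)

    differences : ∀ {n} → 𝔽^ q n → 𝔽^ q n → 𝔽^ q n
    differences = zipWith difference

    ⊕-differences : ∀ {n} (y y′ : 𝔽^ q n) → y ⊕ differences y y′ ≡ y′
    ⊕-differences []      []        = refl
    ⊕-differences (b ∷ y) (b′ ∷ y′) = cong₂ _∷_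
      -- The sum is q + m = 2 q - 1, so its successor has quotient 2.
      (+-difference b b b′ b′ (divides 2 (trans (cong suc (trans (shuffle (toℕ b) (q ∸ toℕ b) (toℕ b′) (m ∸ toℕ b′))
         (cong₂ _+_ (m∸n+n≡m (<⇒≤ (toℕ<n b))) (m∸n+n≡m (toℕ≤m b′))))) (double m))))
      (⊕-differences y y′)
      where
      shuffle : ∀ a b b′ c → a + b + (b′ + c) ≡ (b + a) + (c + b′)
      shuffle = solve-∀
      double : ∀ m → 1 + ((1 + m) + m) ≡ 2 * (1 + m)
      double = solve-∀

    ⟨_⊖_⟩ : ∀ {n} → 𝔽^ q n → 𝔽^ q n → Vec ℕ n
    ⟨ x ⊖ y ⟩ = zipWith (λ a b → toℕ a + (q ∸ toℕ b)) x y

    ⟨_⟩ ⟨-1∸_⟩ : ∀ {n} → 𝔽^ q n → Vec ℕ n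
    ⟨ y ⟩    = Vec.map toℕ y
    ⟨-1∸ z ⟩ = Vec.map (λ c → m ∸ toℕ c) z

    -- Modulo q this vanishes unless x - y + y′ - 1 - z is -1 in every coordinate.
    T : ∀ {n} → 𝔽^ q n → 𝔽^ q n → 𝔽^ q n → 𝔽^ q n → ℕ
    T {n} x y y′ z = binom (⟨ x ⊖ y ⟩ ⊞ (⟨ y′ ⟩ ⊞ ⟨-1∸ z ⟩)) (replicate n m)

    q∤T⇒ : ∀ {n} (x y y′ z : 𝔽^ q n) → ¬ q ∣ T x y y′ z → x ⊕ differences y y′ ≡ z
    q∤T⇒ []      []      []        []      _  = refl
    q∤T⇒ (a ∷ x) (b ∷ y) (b′ ∷ y′) (c ∷ z) ∤T = cong₂ _∷_
      (+-difference a b b′ c q∣) (q∤T⇒ x y y′ z (λ d → ∤T (∣n⇒∣m*n (s C m) d)))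
      where
      s = toℕ a + (q ∸ toℕ b) + (toℕ b′ + (m ∸ toℕ c))
      q∣ : q ∣ suc s
      q∣ with q ∣? suc s
      ... | yes d = d
      ... | no ¬d = ⊥-elim (∤T (∣m⇒∣m*n _ (∤suc⇒∣C q-prime s ¬d)))

    q∤T-diagonal : ∀ {n} (x y : 𝔽^ q n) → ¬ q ∣ T x y y x
    q∤T-diagonal []      []      d = prime⇒∤1 q-prime d
    q∤T-diagonal (a ∷ x) (b ∷ y) d with euclidsLemma _ _ q-prime d
    ... | inj₂ d′ = q∤T-diagonal x y d′
    ... | inj₁ d′ = ∤C q-prime (subst (λ s → q ∣ s C m) (diagonal a b) d′)

    points : ∀ n → List (𝔽^ q n)
    points zero    = [ [] ]
    points (suc n) = cartesianProductWith _∷_ (allFin q) (points n)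

    ∈-points : ∀ {n} (x : 𝔽^ q n) → x ∈ points n
    ∈-points []      = here refl
    ∈-points (a ∷ x) = ∈-cartesianProductWith⁺ _∷_ (∈-allFin a) (∈-points x)

    points-unique : ∀ n → Unique (points n)
    points-unique zero    = [] ∷ []
    points-unique (suc n) = Unique.cartesianProductWith⁺ _∷_ ∷-injective (Unique.allFin⁺ q) (points-unique n)

    length-points : ∀ n → length (points n) ≡ q ^ n
    length-points zero    = refl
    length-points (suc n) = begin
      length (points (suc n))                   ≡⟨ length≡∑1 (points (suc n)) ⟩
      ∑ (points (suc n)) (λ _ → 1)              ≡⟨ ∑-product _∷_ (allFin q) (points n) (λ _ → 1) ⟩
      ∑ (allFin q) (λ _ → ∑ (points n) (λ _ → 1)) ≡⟨ ∑-const (allFin q) _ ⟩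
      length (allFin q) * ∑ (points n) (λ _ → 1) ≡⟨ cong₂ _*_ (length-tabulate {n = q} (λ i → i)) (trans (sym (length≡∑1 (points n))) (length-points n)) ⟩
      q * q ^ n                                 ∎
      where open ≡-Reasoning

    module _ {n : ℕ} where

      _≟ⱽ_ : DecidableEquality (𝔽^ q n)
      _≟ⱽ_ = ≡-dec Fin._≟_

      open Annihilator q-prime _≟ⱽ_

      -- Modulo q, the matrix `row y y′` = Σ_z h(z) T(x, y, y′, z) is diagonal on `ys` with nonzero
      -- diagonal entries. A v annihilating the 2 M functions `f` and `e` of y′ annihilates all its
      -- rows, since the terms light in z are already killed by h. So v vanishes modulo q on all of
      -- `ys`, yet it has at most 2 M zeros.
      degree-bound : ∀ {xs ys} (h : 𝔽^ q n → ℕ) → Unique xs → Unique ys →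
        All (Annihilates h xs) (map (λ (I , _) z → binom ⟨-1∸ z ⟩ I) (lows m n)) →
        ∀ {x} → x ∈ xs → ¬ q ∣ h x →
        (∀ {y y′ z} → y ∈ ys → y′ ∈ ys → z ∈ xs → ¬ q ∣ T x y y′ z → y ≡ y′ × z ≡ x) →
        length ys ≤ 2 * length (lows m n)
      degree-bound {xs} {ys} h uxs uys h-low {x} x∈ q∤hx off = begin
        length ys                     ≡⟨ length≡∑1 ys ⟩
        ∑ ys (λ _ → 1)                ≤⟨ ∑-mono ys (λ {y} y∈ → ≤-reflexive (sym (𝟙-yes (q ∣? v y) (q∣v y∈)))) ⟩
        zeros v ys                    ≤⟨ proj₂ (proj₂ ann) ⟩
        length gs                     ≡⟨ length-++ (map f (lows m n)) ⟩
        length (map f (lows m n)) + length (map e (lows m n)) ≡⟨ cong₂ _+_ (length-map f (lows m n)) (length-map e (lows m n)) ⟩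
        length (lows m n) + length (lows m n) ≡⟨ twice (length (lows m n)) ⟨
        2 * length (lows m n)         ∎
        where
        open ≤-Reasoning
        twice : ∀ t → 2 * t ≡ t + t
        twice = solve-∀
        -- `f` takes care of the terms light in y′. `e` takes care of those light in x - y: there y′
        -- enters only through the sum over z with the complementary exponent.
        f e : Vec ℕ n × Vec ℕ n → 𝔽^ q n → ℕ
        f (I , _) y′ = binom ⟨ y′ ⟩ I
        e (_ , L) y′ = ∑ xs (λ z → h z * binom (⟨ y′ ⟩ ⊞ ⟨-1∸ z ⟩) L)
        gs = map f (lows m n) ++ map e (lows m n)
        ann = annihilator uys (length gs) gs refl
        v = proj₁ ann
        v-f : ∀ {I J} → (I , J) ∈ lows m n → Annihilates v ys (f (I , J))
        v-f p = All.lookup (map⁻ (++⁻ˡ (map f (lows m n)) (proj₁ (proj₂ ann)))) p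
        v-e : ∀ {J L} → (J , L) ∈ lows m n → Annihilates v ys (e (J , L))
        v-e p = All.lookup (map⁻ (++⁻ʳ (map f (lows m n)) (proj₁ (proj₂ ann)))) p

        -- A second use of Vandermonde separates y′ from z, leaving products in which one factor can
        -- be killed.
        ∑v∑h : ∀ L → ∑ ys (λ y′ → v y′ * e (L , L) y′) ≡
          ∑ (splitsⁿ L) (λ (I , K) → ∑ ys (λ y′ → v y′ * binom ⟨ y′ ⟩ I) * ∑ xs (λ z → h z * binom ⟨-1∸ z ⟩ K))
        ∑v∑h L = begin-equality
          ∑ ys (λ y′ → v y′ * ∑ xs (λ z → h z * binom (⟨ y′ ⟩ ⊞ ⟨-1∸ z ⟩) L))
            ≡⟨ ∑-cong ys (λ y′ → sym (∑-*ˡ (v y′) xs _)) ⟩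
          ∑ ys (λ y′ → ∑ xs (λ z → v y′ * (h z * binom (⟨ y′ ⟩ ⊞ ⟨-1∸ z ⟩) L)))
            ≡⟨ ∑-cong ys (λ y′ → ∑-cong xs (λ z → trans
                 (cong (λ b → v y′ * (h z * b)) (binom-vandermonde ⟨ y′ ⟩ ⟨-1∸ z ⟩ L))
                 (trans (sym (*-assoc (v y′) (h z) _)) (trans (sym (∑-*ˡ (v y′ * h z) (splitsⁿ L) _))
                   (∑-cong (splitsⁿ L) (λ (I , K) → interchange (v y′) (h z) (binom ⟨ y′ ⟩ I) (binom ⟨-1∸ z ⟩ K))))))) ⟩
          ∑ ys (λ y′ → ∑ xs (λ z → ∑ (splitsⁿ L) (λ (I , K) →
            v y′ * binom ⟨ y′ ⟩ I * (h z * binom ⟨-1∸ z ⟩ K))))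
            ≡⟨ ∑-cong ys (λ y′ → ∑-swap xs (splitsⁿ L) _) ⟩
          ∑ ys (λ y′ → ∑ (splitsⁿ L) (λ (I , K) → ∑ xs (λ z →
            v y′ * binom ⟨ y′ ⟩ I * (h z * binom ⟨-1∸ z ⟩ K))))
            ≡⟨ ∑-swap ys (splitsⁿ L) _ ⟩
          ∑ (splitsⁿ L) (λ (I , K) → ∑ ys (λ y′ → ∑ xs (λ z →
            v y′ * binom ⟨ y′ ⟩ I * (h z * binom ⟨-1∸ z ⟩ K))))
            ≡⟨ ∑-cong (splitsⁿ L) (λ _ → ∑-*-∑ ys xs _ _) ⟩
          ∑ (splitsⁿ L) (λ (I , K) → ∑ ys (λ y′ → v y′ * binom ⟨ y′ ⟩ I) * ∑ xs (λ z → h z * binom ⟨-1∸ z ⟩ K)) ∎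
          where
          interchange : ∀ a b c d → a * b * (c * d) ≡ a * c * (b * d)
          interchange = solve-∀

        -- Three cases for the light factor: in x - y, v annihilates `e`; in y′, v annihilates `f`;
        -- in z, h annihilates the monomial.
        q∣∑ve : ∀ {J L} → (J , L) ∈ splitsⁿ (replicate n m) → q ∣ ∑ ys (λ y′ → v y′ * e (J , L) y′)
        q∣∑ve {J} {L} p with 3 * Vec.sum J ≤? n * m
        ... | yes low = v-e {J} {L} (∈-filter⁺ _ p low)
        ... | no high = subst (q ∣_) (sym (∑v∑h L)) (∣-∑ (splitsⁿ L) λ {(I , K)} r →
          divides-factor I K (∈-splitsⁿ⁻ L r))
          where
          J⊞L = ∈-splitsⁿ⁻ (replicate n m) p
          divides-factor : ∀ I K → I ⊞ K ≡ L →
            q ∣ ∑ ys (λ y′ → v y′ * binom ⟨ y′ ⟩ I) * ∑ xs (λ z → h z * binom ⟨-1∸ z ⟩ K)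
          divides-factor I K I⊞K with third-low m I J K (trans (cong (J ⊞_) I⊞K) J⊞L) high
          ... | inj₁ low = ∣m⇒∣m*n (∑ xs (λ z → h z * binom ⟨-1∸ z ⟩ K)) (v-f {I} {K ⊞ J} (∈-lows m I (K ⊞ J) (trans
                  (trans (sym (⊞-assoc I K J)) (trans (cong (_⊞ J) I⊞K) (⊞-comm L J))) J⊞L) low))
          ... | inj₂ low = ∣n⇒∣m*n (∑ ys (λ y′ → v y′ * binom ⟨ y′ ⟩ I)) (All.lookup (map⁻ h-low) (∈-lows m K (I ⊞ J) (trans
                  (trans (sym (⊞-assoc K I J)) (trans (cong (_⊞ J) (trans (⊞-comm K I) I⊞K)) (⊞-comm L J))) J⊞L) low))

        row : 𝔽^ q n → 𝔽^ q n → ℕ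
        row y y′ = ∑ xs (λ z → h z * T x y y′ z)

        row-expand : ∀ y y′ → row y y′ ≡ ∑ (splitsⁿ (replicate n m)) (λ p → binom ⟨ x ⊖ y ⟩ (proj₁ p) * e p y′)
        row-expand y y′ = begin-equality
          ∑ xs (λ z → h z * T x y y′ z)
            ≡⟨ ∑-cong xs (λ z → trans (cong (h z *_) (binom-vandermonde ⟨ x ⊖ y ⟩ (⟨ y′ ⟩ ⊞ ⟨-1∸ z ⟩) _))
                 (trans (sym (∑-*ˡ (h z) box _)) (∑-cong box (λ (J , L) → swap (h z) (binom ⟨ x ⊖ y ⟩ J) _)))) ⟩
          ∑ xs (λ z → ∑ box (λ (J , L) → binom ⟨ x ⊖ y ⟩ J * (h z * binom (⟨ y′ ⟩ ⊞ ⟨-1∸ z ⟩) L)))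
            ≡⟨ ∑-swap xs box _ ⟩
          ∑ box (λ (J , L) → ∑ xs (λ z → binom ⟨ x ⊖ y ⟩ J * (h z * binom (⟨ y′ ⟩ ⊞ ⟨-1∸ z ⟩) L)))
            ≡⟨ ∑-cong box (λ (J , L) → ∑-*ˡ (binom ⟨ x ⊖ y ⟩ J) xs _) ⟩
          ∑ box (λ p → binom ⟨ x ⊖ y ⟩ (proj₁ p) * e p y′) ∎
          where
          box = splitsⁿ (replicate n m)
          swap : ∀ a b c → a * (b * c) ≡ b * (a * c)
          swap = solve-∀

        q∣∑v-row : ∀ y → q ∣ ∑ ys (λ y′ → v y′ * row y y′)
        q∣∑v-row y = subst (q ∣_) (sym (begin-equality
          ∑ ys (λ y′ → v y′ * row y y′)
            ≡⟨ ∑-cong ys (λ y′ → trans (cong (v y′ *_) (row-expand y y′))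
                 (trans (sym (∑-*ˡ (v y′) box _)) (∑-cong box (λ p → swap (v y′) (binom ⟨ x ⊖ y ⟩ (proj₁ p)) (e p y′))))) ⟩
          ∑ ys (λ y′ → ∑ box (λ p → binom ⟨ x ⊖ y ⟩ (proj₁ p) * (v y′ * e p y′)))
            ≡⟨ ∑-swap ys box _ ⟩
          ∑ box (λ p → ∑ ys (λ y′ → binom ⟨ x ⊖ y ⟩ (proj₁ p) * (v y′ * e p y′)))
            ≡⟨ ∑-cong box (λ p → ∑-*ˡ (binom ⟨ x ⊖ y ⟩ (proj₁ p)) ys _) ⟩
          ∑ box (λ p → binom ⟨ x ⊖ y ⟩ (proj₁ p) * ∑ ys (λ y′ → v y′ * e p y′)) ∎))
          (∣-∑ box (λ {p} p∈ → ∣n⇒∣m*n (binom ⟨ x ⊖ y ⟩ (proj₁ p)) (q∣∑ve p∈)))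
          where
          box = splitsⁿ (replicate n m)
          swap : ∀ a b c → a * (b * c) ≡ b * (a * c)
          swap = solve-∀

        q∣T : ∀ {y y′ z} → y ∈ ys → y′ ∈ ys → z ∈ xs → ¬ (y ≡ y′ × z ≡ x) → q ∣ T x y y′ z
        q∣T {y} {y′} {z} y∈ y′∈ z∈ ≢ with q ∣? T x y y′ z
        ... | yes d = d
        ... | no ¬d = ⊥-elim (≢ (off y∈ y′∈ z∈ ¬d))

        -- In Σ v(y′) row(y, y′) only y′ = y survives, and in row(y, y) only z = x. What remains is
        -- v(y) h(x) T(x, y, y, x), whose last two factors are nonzero modulo q.
        q∣v : ∀ {y} → y ∈ ys → q ∣ v y
        q∣v {y} y∈ with euclidsLemma (v y) (row y y) q-prime
          (∣∑⇒∣ (λ y′ → v y′ * row y y′) uys y∈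
            (λ {y′} y′∈ y′≢y → ∣n⇒∣m*n (v y′) (∣-∑ xs (λ {z} z∈ →
              ∣n⇒∣m*n (h z) (q∣T y∈ y′∈ z∈ (λ (eq , _) → y′≢y (sym eq))))))
            (q∣∑v-row y))
        ... | inj₁ d = d
        ... | inj₂ d with euclidsLemma (h x) (T x y y x) q-prime
              (∣∑⇒∣ (λ z → h z * T x y y z) uxs x∈
                (λ {z} z∈ z≢x → ∣n⇒∣m*n (h z) (q∣T y∈ y∈ z∈ (λ (_ , eq) → z≢x eq))) d)
        ...   | inj₁ d′ = ⊥-elim (q∤hx d′)
        ...   | inj₂ d′ = ⊥-elim (q∤T-diagonal x y d′)

      module _ (S : List (𝔽^ q n × 𝔽^ q n)) where

        inFibre? : ∀ x y → Dec ((x , y) ∈ S)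
        inFibre? x y = any? (Product.≡-dec _≟ⱽ_ _≟ⱽ_ (x , y)) S

        fibre : 𝔽^ q n → List (𝔽^ q n)
        fibre x = filter (inFibre? x) (points n)

        support : List (𝔽^ q n)
        support = filter (λ x → any? (inFibre? x) (points n)) (points n)

        length≤∑-fibres : Unique S → length S ≤ ∑ support (λ x → length (fibre x))
        length≤∑-fibres uS = ≤-trans
          (Unique-⊆⇒length≤ (Product.≡-dec _≟ⱽ_ _≟ⱽ_) uS covers)
          (≤-reflexive (length-concatMap support))
          where
          row = λ x → map (x ,_) (fibre x)
          covers : ∀ {p} → p ∈ S → p ∈ concatMap row support
          covers {x , y} p∈ = ∈-concatMap⁺ row (lose
            (∈-filter⁺ (λ x → any? (inFibre? x) (points n)) (∈-points x) (lose (∈-points y) p∈))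
            (∈-map⁺ (x ,_) (∈-filter⁺ (inFibre? x) (∈-points y) p∈)))
          length-concatMap : ∀ xs → length (concatMap row xs) ≡ ∑ xs (λ x → length (fibre x))
          length-concatMap []       = refl
          length-concatMap (x ∷ xs) = trans (length-++ (row x))
            (cong₂ _+_ (length-map (x ,_) (fibre x)) (length-concatMap xs))

        cornerFree-bound : Unique S → CornerFree S → length S ≤ 3 * (q ^ n * length (lows m n))
        cornerFree-bound uS free = begin
          length S                                        ≤⟨ length≤∑-fibres uS ⟩
          ∑ support (λ x → length (fibre x))              ≤⟨ ∑-mono support bound ⟩
          ∑ support (λ x → 2 * M + q ^ n * 𝟙 (q ∣? h x))  ≡⟨ ∑-+ support _ _ ⟩
          ∑ support (λ _ → 2 * M) + ∑ support (λ x → q ^ n * 𝟙 (q ∣? h x))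
                                                          ≡⟨ cong₂ _+_ (∑-const support (2 * M)) (∑-*ˡ (q ^ n) support _) ⟩
          length support * (2 * M) + q ^ n * zeros h support
                                                          ≤⟨ +-mono-≤ (*-monoˡ-≤ (2 * M) (length-sub (λ x → any? (inFibre? x) (points n))))
                                                              (*-monoʳ-≤ (q ^ n) (proj₂ (proj₂ ann))) ⟩
          q ^ n * (2 * M) + q ^ n * M                     ≡⟨ collect (q ^ n) M ⟩
          3 * (q ^ n * M)                                 ∎
          where
          open ≤-Reasoning
          M = length (lows m n)
          collect : ∀ a b → a * (2 * b) + a * b ≡ 3 * (a * b)
          collect = solve-∀
          length-sub : ∀ {P : 𝔽^ q n → Set} (P? : ∀ x → Dec (P x)) → length (filter P? (points n)) ≤ q ^ n
          length-sub P? = ≤-trans (length-filter P? (points n)) (≤-reflexive (length-points n))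
          ann = annihilator (Unique.filter⁺ (λ x → any? (inFibre? x) (points n)) (points-unique n)) M
            (map (λ (I , _) z → binom ⟨-1∸ z ⟩ I) (lows m n)) (length-map _ (lows m n))
          h = proj₁ ann
          -- With d = y′ - y, nonvanishing of T forces z = x + d. If d ≠ 0, any y″ in the nonempty
          -- fibre over z completes the corner (x, y), (x, y + d), (x + d, y″).
          off : ∀ x {y y′ z} → y ∈ fibre x → y′ ∈ fibre x → z ∈ support → ¬ q ∣ T x y y′ z → y ≡ y′ × z ≡ x
          off x {y} {y′} {z} y∈ y′∈ z∈ ∤T with differences y y′ ≟ⱽ 𝟎
          ... | yes d≡𝟎 =
                trans (sym (trans (cong (y ⊕_) d≡𝟎) (⊕-identityʳ y))) (⊕-differences y y′) ,
                trans (sym (q∤T⇒ x y y′ z ∤T)) (trans (cong (x ⊕_) d≡𝟎) (⊕-identityʳ x))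
          ... | no d≢𝟎 with find (proj₂ (∈-filter⁻ (λ x → any? (inFibre? x) (points n)) {xs = points n} z∈))
          ...   | y″ , _ , zy″∈ = ⊥-elim (free x y y″ (differences y y′) d≢𝟎
                  ( proj₂ (∈-filter⁻ (inFibre? x) {xs = points n} y∈)
                  , subst (λ t → (x , t) ∈ S) (sym (⊕-differences y y′)) (proj₂ (∈-filter⁻ (inFibre? x) {xs = points n} y′∈))
                  , subst (λ t → (t , y″) ∈ S) (sym (q∤T⇒ x y y′ z ∤T)) zy″∈ ))
          bound : ∀ {x} → x ∈ support → length (fibre x) ≤ 2 * M + q ^ n * 𝟙 (q ∣? h x)
          bound {x} x∈ with q ∣? h x
          ... | yes d = ≤-trans (length-sub (inFibre? x)) (≤-trans
                  (≤-reflexive (trans (sym (*-identityʳ (q ^ n))) (cong (q ^ n *_) (sym (𝟙-yes (q ∣? h x) d)))))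
                  (m≤n+m _ (2 * M)))
          ... | no ¬d = ≤-trans
                  (degree-bound h (Unique.filter⁺ (λ x → any? (inFibre? x) (points n)) (points-unique n))
                     (Unique.filter⁺ (inFibre? x) (points-unique n)) (proj₁ (proj₂ ann)) x∈ ¬d (off x))
                  (m≤m+n (2 * M) _)

-- Ordered-field arithmetic in ℚ and estimates for powers.

module OrderedField where
  open import Data.Nat.Base as ℕ using (ℕ; zero; suc)
  import Data.Nat.Properties as ℕ
  open import Data.Integer.Base as ℤ using (+_; -[1+_])
  import Data.Integer.Properties as ℤ
  open import Data.Rational.Base
  open import Data.Rational.Properties
  open import Data.Rational.Unnormalised.Base as ℚᵘ using (mkℚᵘ; *≡*)
  import Data.Rational.Unnormalised.Properties as ℚᵘ
  open import Data.Product.Base using (_×_; _,_; ∃; proj₁; proj₂)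
  open import Data.Empty using (⊥-elim)
  open import Relation.Nullary using (yes; no)
  open import Relation.Nullary.Decidable.Core using (dec⇒maybe)
  open import Relation.Binary.PropositionalEquality
  open import Level using (0ℓ)
  open import Algebra.Bundles using (CommutativeRing)
  open import Algebra.Definitions.RawSemiring +-*-rawSemiring public using (_^_)
  open import Algebra.Properties.CommutativeSemiring.Exp (CommutativeRing.commutativeSemiring +-*-commutativeRing) public
    using (^-homo-*; ^-assocʳ; ^-distrib-*)
  open import Tactic.RingSolver using (solve-∀)
  open import Tactic.RingSolver.Core.AlmostCommutativeRing using (AlmostCommutativeRing; fromCommutativeRing)

  ℚ-ring : AlmostCommutativeRing 0ℓ 0ℓ
  ℚ-ring = fromCommutativeRing +-*-commutativeRing (λ x → dec⇒maybe (0ℚ ≟ x))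

  private variable
    a b c d : ℚ

  0<1 : 0ℚ < 1ℚ
  0<1 = positive⁻¹ 1ℚ

  *-monoˡ-≤ : 0ℚ ≤ c → a ≤ b → c * a ≤ c * b
  *-monoˡ-≤ {c} 0≤c = *-monoˡ-≤-nonNeg c {{nonNegative 0≤c}}

  *-monoʳ-≤ : 0ℚ ≤ c → a ≤ b → a * c ≤ b * c
  *-monoʳ-≤ {c} 0≤c = *-monoʳ-≤-nonNeg c {{nonNegative 0≤c}}

  *-monoˡ-< : 0ℚ < c → a < b → c * a < c * b
  *-monoˡ-< {c} 0<c = *-monoʳ-<-pos c {{positive 0<c}}

  *-monoʳ-< : 0ℚ < c → a < b → a * c < b * c
  *-monoʳ-< {c} 0<c = *-monoˡ-<-pos c {{positive 0<c}}

  *-cancelʳ-< : 0ℚ ≤ c → a * c < b * c → a < b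
  *-cancelʳ-< {c} 0≤c = *-cancelʳ-<-nonNeg c {{nonNegative 0≤c}}

  *-cancelˡ-< : 0ℚ ≤ c → c * a < c * b → a < b
  *-cancelˡ-< {c} 0≤c = *-cancelˡ-<-nonNeg c {{nonNegative 0≤c}}

  *-cancelˡ-≤ : 0ℚ < c → c * a ≤ c * b → a ≤ b
  *-cancelˡ-≤ {c} 0<c = *-cancelˡ-≤-pos c {{positive 0<c}}

  *-nonNeg : 0ℚ ≤ a → 0ℚ ≤ b → 0ℚ ≤ a * b
  *-nonNeg {a} {b} 0≤a 0≤b = subst (_≤ a * b) (*-zeroʳ a) (*-monoˡ-≤ 0≤a 0≤b)

  *-pos : 0ℚ < a → 0ℚ < b → 0ℚ < a * b
  *-pos {a} {b} 0<a 0<b = subst (_< a * b) (*-zeroʳ a) (*-monoˡ-< 0<a 0<b)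

  +-pos : 0ℚ < a → 0ℚ < b → 0ℚ < a + b
  +-pos {a} {b} 0<a 0<b = subst (_< a + b) (+-identityˡ 0ℚ) (+-mono-< 0<a 0<b)

  +-nonNeg : 0ℚ ≤ a → 0ℚ ≤ b → 0ℚ ≤ a + b
  +-nonNeg {a} {b} 0≤a 0≤b = subst (_≤ a + b) (+-identityˡ 0ℚ) (+-mono-≤ 0≤a 0≤b)

  *-mono-≤ : 0ℚ ≤ a → 0ℚ ≤ c → a ≤ b → c ≤ d → a * c ≤ b * d
  *-mono-≤ 0≤a 0≤c a≤b c≤d =
    ≤-trans (*-monoʳ-≤ 0≤c a≤b) (*-monoˡ-≤ (≤-trans 0≤a a≤b) c≤d)

  *-mono-< : 0ℚ ≤ a → 0ℚ ≤ c → a < b → c < d → a * c < b * d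
  *-mono-< 0≤a 0≤c a<b c<d =
    ≤-<-trans (*-monoʳ-≤ 0≤c (<⇒≤ a<b)) (*-monoˡ-< (≤-<-trans 0≤a a<b) c<d)

  <⇒0<- : a < b → 0ℚ < b - a
  <⇒0<- {a} {b} a<b = subst (_< b - a) (+-inverseʳ a) (+-monoˡ-< (- a) a<b)

  0<-⇒< : 0ℚ < b - a → a < b
  0<-⇒< {b} {a} p = subst₂ _<_ (+-identityˡ a) (cancel a b) (+-monoˡ-< a p)
    where
    cancel : ∀ a b → b - a + a ≡ b
    cancel = solve-∀ ℚ-ring

  0≤-⇒≤ : 0ℚ ≤ b - a → a ≤ b
  0≤-⇒≤ {b} {a} p = subst₂ _≤_ (+-identityˡ a) (cancel a b) (+-monoˡ-≤ a p)
    where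
    cancel : ∀ a b → b - a + a ≡ b
    cancel = solve-∀ ℚ-ring

  ≤⇒0≤- : a ≤ b → 0ℚ ≤ b - a
  ≤⇒0≤- {a} {b} a≤b = subst (_≤ b - a) (+-inverseʳ a) (+-monoˡ-≤ (- a) a≤b)

  inverse : 0ℚ < a → ∃ λ b → 0ℚ < b × a * b ≡ 1ℚ
  inverse {a} 0<a = 1/ a , positive⁻¹ (1/ a) {{1/pos⇒pos a}} , *-inverseʳ a
    where
    instance
      _ = positive 0<a
      _ = pos⇒nonZero a

  1<inverse : 0ℚ < a → a < 1ℚ → a * b ≡ 1ℚ → 1ℚ < b
  1<inverse {a} 0<a a<1 ab≡1 = *-cancelˡ-< (<⇒≤ 0<a) (subst₂ _<_ (sym (*-identityʳ a)) (sym ab≡1) a<1)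

  ^-nonNeg : 0ℚ ≤ a → ∀ k → 0ℚ ≤ a ^ k
  ^-nonNeg 0≤a zero    = <⇒≤ 0<1
  ^-nonNeg 0≤a (suc k) = *-nonNeg 0≤a (^-nonNeg 0≤a k)

  ^-pos : 0ℚ < a → ∀ k → 0ℚ < a ^ k
  ^-pos 0<a zero    = 0<1
  ^-pos 0<a (suc k) = *-pos 0<a (^-pos 0<a k)

  ^-monoˡ-≤ : ∀ k → 0ℚ ≤ a → a ≤ b → a ^ k ≤ b ^ k
  ^-monoˡ-≤ zero    0≤a a≤b = ≤-refl
  ^-monoˡ-≤ (suc k) 0≤a a≤b = *-mono-≤ 0≤a (^-nonNeg 0≤a k) a≤b (^-monoˡ-≤ k 0≤a a≤b)

  ^-monoˡ-< : ∀ {k} → 1 ℕ.≤ k → 0ℚ ≤ a → a < b → a ^ k < b ^ k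
  ^-monoˡ-< {k = suc k} _ 0≤a a<b = ≤-<-trans
    (*-monoˡ-≤ 0≤a (^-monoˡ-≤ k 0≤a (<⇒≤ a<b)))
    (*-monoʳ-< (^-pos (≤-<-trans 0≤a a<b) k) a<b)

  ^-cancel-< : ∀ k → 0ℚ ≤ b → a ^ k < b ^ k → a < b
  ^-cancel-< {b} {a} k 0≤b a^k<b^k with a <? b
  ... | yes a<b = a<b
  ... | no a≮b = ⊥-elim (<-irrefl refl (<-≤-trans a^k<b^k (^-monoˡ-≤ k 0≤b (≮⇒≥ a≮b))))

  1^ : ∀ k → 1ℚ ^ k ≡ 1ℚ
  1^ zero    = refl
  1^ (suc k) = trans (*-identityˡ _) (1^ k)

  1≤^ : 1ℚ ≤ a → ∀ k → 1ℚ ≤ a ^ k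
  1≤^ {a} 1≤a k = subst (_≤ a ^ k) (1^ k) (^-monoˡ-≤ k (<⇒≤ 0<1) 1≤a)

  ^≤1 : 0ℚ ≤ a → a ≤ 1ℚ → ∀ k → a ^ k ≤ 1ℚ
  ^≤1 {a} 0≤a a≤1 k = subst (a ^ k ≤_) (1^ k) (^-monoˡ-≤ k 0≤a a≤1)

  ^-monoʳ-≤ : 1ℚ ≤ a → ∀ {m n} → m ℕ.≤ n → a ^ m ≤ a ^ n
  ^-monoʳ-≤ 1≤a {n = n} ℕ.z≤n = 1≤^ 1≤a n
  ^-monoʳ-≤ 1≤a (ℕ.s≤s m≤n) = *-monoˡ-≤ (≤-trans (<⇒≤ 0<1) 1≤a) (^-monoʳ-≤ 1≤a m≤n)

  ^-antimonoʳ-≤ : 0ℚ ≤ a → a ≤ 1ℚ → ∀ {m n} → m ℕ.≤ n → a ^ n ≤ a ^ m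
  ^-antimonoʳ-≤ 0≤a a≤1 {n = n} ℕ.z≤n = ^≤1 0≤a a≤1 n
  ^-antimonoʳ-≤ 0≤a a≤1 (ℕ.s≤s m≤n) = *-monoˡ-≤ 0≤a (^-antimonoʳ-≤ 0≤a a≤1 m≤n)

  ^-comm : ∀ a m n → (a ^ m) ^ n ≡ (a ^ n) ^ m
  ^-comm a m n = trans (^-assocʳ a m n) (trans (cong (a ^_) (ℕ.*-comm m n)) (sym (^-assocʳ a n m)))

  ^-inverse : ∀ k → a * b ≡ 1ℚ → a ^ k * b ^ k ≡ 1ℚ
  ^-inverse {a} {b} k ab≡1 = trans (sym (^-distrib-* a b k)) (trans (cong (_^ k) ab≡1) (1^ k))

  ι : ℕ → ℚ
  ι k = + k / 1

  toℚᵘ-ι : ∀ k → toℚᵘ (ι k) ℚᵘ.≃ mkℚᵘ (+ k) 0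
  toℚᵘ-ι k = toℚᵘ-fromℚᵘ (mkℚᵘ (+ k) 0)

  ι-+ : ∀ m n → ι (m ℕ.+ n) ≡ ι m + ι n
  ι-+ m n = toℚᵘ-injective (ℚᵘ.≃-trans (toℚᵘ-ι (m ℕ.+ n)) (ℚᵘ.≃-sym (ℚᵘ.≃-trans
    (toℚᵘ-homo-+ (ι m) (ι n)) (ℚᵘ.≃-trans (ℚᵘ.+-cong (toℚᵘ-ι m) (toℚᵘ-ι n))
    (*≡* (cong (ℤ._* + 1) (cong₂ ℤ._+_ (ℤ.*-identityʳ (+ m)) (ℤ.*-identityʳ (+ n)))))))))

  ι-* : ∀ m n → ι (m ℕ.* n) ≡ ι m * ι n
  ι-* m n = toℚᵘ-injective (ℚᵘ.≃-trans (toℚᵘ-ι (m ℕ.* n)) (ℚᵘ.≃-sym (ℚᵘ.≃-trans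
    (toℚᵘ-homo-* (ι m) (ι n)) (ℚᵘ.≃-trans (ℚᵘ.*-cong (toℚᵘ-ι m) (toℚᵘ-ι n))
    (*≡* (cong (ℤ._* + 1) (sym (ℤ.pos-* m n))))))))

  ι-^ : ∀ m n → ι (m ℕ.^ n) ≡ ι m ^ n
  ι-^ m zero    = refl
  ι-^ m (suc n) = trans (ι-* m (m ℕ.^ n)) (cong (ι m *_) (ι-^ m n))

  0≤ι : ∀ k → 0ℚ ≤ ι k
  0≤ι zero    = ≤-refl
  0≤ι (suc k) = subst (0ℚ ≤_) (sym (ι-+ 1 k)) (subst (_≤ 1ℚ + ι k) (+-identityˡ 0ℚ) (+-mono-≤ (<⇒≤ 0<1) (0≤ι k)))

  ι-mono-≤ : ∀ {m n} → m ℕ.≤ n → ι m ≤ ι n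
  ι-mono-≤ {m} {n} m≤n = subst₂ _≤_ (+-identityʳ (ι m))
    (trans (sym (ι-+ m (n ℕ.∸ m))) (cong ι (ℕ.m+[n∸m]≡n m≤n)))
    (+-monoʳ-≤ (ι m) (0≤ι (n ℕ.∸ m)))

  0<ι : ∀ {k} → 1 ℕ.≤ k → 0ℚ < ι k
  0<ι 1≤k = <-≤-trans 0<1 (ι-mono-≤ 1≤k)

  ι-mono-< : ∀ {m n} → m ℕ.< n → ι m < ι n
  ι-mono-< {m} {n} m<n = <-≤-trans
    (subst₂ _<_ (+-identityˡ (ι m)) (sym (ι-+ 1 m)) (+-monoˡ-< (ι m) 0<1)) (ι-mono-≤ m<n)

  ι-cancel-≤ : ∀ {m n} → ι m ≤ ι n → m ℕ.≤ n
  ι-cancel-≤ {m} {n} ιm≤ιn with m ℕ.≤? n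
  ... | yes m≤n = m≤n
  ... | no m≰n = ⊥-elim (<-irrefl refl (<-≤-trans (ι-mono-< (ℕ.≰⇒> m≰n)) ιm≤ιn))

  ι-cancel-< : ∀ {m n} → ι m < ι n → m ℕ.< n
  ι-cancel-< {m} {n} ιm<ιn with m ℕ.<? n
  ... | yes m<n = m<n
  ... | no m≮n = ⊥-elim (<-irrefl refl (<-≤-trans ιm<ιn (ι-mono-≤ (ℕ.≮⇒≥ m≮n))))

  *-denominator : ∀ p → p * ι (↧ₙ p) ≡ ↥ p / 1
  *-denominator p@(mkℚ n d-1 _) = toℚᵘ-injective (ℚᵘ.≃-trans (toℚᵘ-homo-* p (ι (suc d-1)))
    (ℚᵘ.≃-trans (ℚᵘ.*-congˡ {toℚᵘ p} (toℚᵘ-ι (suc d-1)))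
    (ℚᵘ.≃-trans (*≡* (trans (ℤ.*-identityʳ (n ℤ.* + suc d-1)) (cong (λ k → n ℤ.* + suc k) (sym (ℕ.*-identityʳ d-1)))))
    (ℚᵘ.≃-sym (toℚᵘ-fromℚᵘ (mkℚᵘ n 0))))))

  archimedean : 0ℚ < b → ∃ λ j → a < ι j * b
  archimedean {b} {a} 0<b with inverse 0<b
  ... | w , 0<w , bw≡1 = suc j , subst₂ _<_ (trans (*-assoc a w b) (trans (cong (a *_) (trans (*-comm w b) bw≡1)) (*-identityʳ a))) refl
        (*-monoʳ-< 0<b (≤-<-trans (bound (a * w)) (ι-mono-< (ℕ.n<1+n j))))
    where
    numerator⁺ : ℚ → ℕ
    numerator⁺ (mkℚ (+ n) _ _)    = n
    numerator⁺ (mkℚ -[1+ _ ] _ _) = 0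
    j = numerator⁺ (a * w)
    bound : ∀ p → p ≤ ι (numerator⁺ p)
    bound p@(mkℚ (+ n) d-1 _) = subst₂ _≤_ (*-identityʳ p) (*-denominator p)
      (*-monoˡ-≤ (nonNegative⁻¹ p) (ι-mono-≤ {1} {suc d-1} (ℕ.s≤s ℕ.z≤n)))
    bound p@(mkℚ -[1+ _ ] _ _) = <⇒≤ (negative⁻¹ p)

  -- Bernoulli's inequality 1 + j d / a ≤ (1 + d / a)^j, cleared of denominators.
  ^-growth : 0ℚ ≤ a → 0ℚ ≤ d → ∀ j → a ^ j * (a + ι j * d) ≤ a * (a + d) ^ j
  ^-growth {a} {d} 0≤a 0≤d zero = ≤-reflexive (base a d)
    where
    base : ∀ a d → 1ℚ * (a + 0ℚ * d) ≡ a * 1ℚ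
    base = solve-∀ ℚ-ring
  ^-growth {a} {d} 0≤a 0≤d (suc j) = begin
    a * a ^ j * (a + ι (suc j) * d)                    ≡⟨ cong (λ t → a * a ^ j * (a + t * d)) (ι-+ 1 j) ⟩
    a * a ^ j * (a + (1ℚ + ι j) * d)                   ≡⟨ +-identityʳ _ ⟨
    a * a ^ j * (a + (1ℚ + ι j) * d) + 0ℚ              ≤⟨ +-monoʳ-≤ (a * a ^ j * (a + (1ℚ + ι j) * d)) (*-nonNeg (^-nonNeg 0≤a j) (*-nonNeg (0≤ι j) (*-nonNeg 0≤d 0≤d))) ⟩
    a * a ^ j * (a + (1ℚ + ι j) * d) + a ^ j * (ι j * (d * d)) ≡⟨ expand a (a ^ j) (ι j) d ⟩
    (a + d) * (a ^ j * (a + ι j * d))                  ≤⟨ *-monoˡ-≤ 0≤a+d (^-growth 0≤a 0≤d j) ⟩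
    (a + d) * (a * (a + d) ^ j)                        ≡⟨ swap (a + d) a ((a + d) ^ j) ⟩
    a * ((a + d) * (a + d) ^ j)                        ∎
    where
    open ≤-Reasoning
    0≤a+d : 0ℚ ≤ a + d
    0≤a+d = +-nonNeg 0≤a 0≤d
    expand : ∀ a p j d → a * p * (a + (1ℚ + j) * d) + p * (j * (d * d)) ≡ (a + d) * (p * (a + j * d))
    expand = solve-∀ ℚ-ring
    swap : ∀ x y z → x * (y * z) ≡ y * (x * z)
    swap = solve-∀ ℚ-ring

  -- The powers of b / a exceed any constant. A strict inequality between positive numbers can thus
  -- absorb a fixed factor once it is raised to a high power.
  ^-archimedean : 0ℚ < a → a < b → 0ℚ < d → ∃ λ j → 1 ℕ.≤ j × a ^ j * c < b ^ j * d
  ^-archimedean {a} {b} {d} {c} 0<a a<b 0<d = suc j₀ , ℕ.s≤s ℕ.z≤n , step j₀ ac<j₀dδ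
    where
    δ = b - a
    0<δ = <⇒0<- a<b
    a+δ : ∀ a b → a + (b - a) ≡ b
    a+δ = solve-∀ ℚ-ring
    swap : ∀ x y z → x * (y * z) ≡ y * (x * z)
    swap = solve-∀ ℚ-ring
    swap′ : ∀ x y z → x * (y * z) ≡ y * (z * x)
    swap′ = solve-∀ ℚ-ring
    rearrange : ∀ a d j δ → d * (a + (1ℚ + j) * δ) ≡ j * (d * δ) + d * (a + δ)
    rearrange = solve-∀ ℚ-ring
    arch : ∃ λ j → a * c < ι j * (d * δ)
    arch = archimedean (*-pos 0<d 0<δ)
    j₀ = proj₁ arch
    ac<j₀dδ = proj₂ arch
    step : ∀ j₀ → a * c < ι j₀ * (d * δ) → a ^ suc j₀ * c < b ^ suc j₀ * d
    step j₀ ac< = *-cancelˡ-< (<⇒≤ 0<a) (begin-strict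
      a * (a ^ j * c)                 ≡⟨ swap a (a ^ j) c ⟩
      a ^ j * (a * c)                 <⟨ *-monoˡ-< (^-pos 0<a j) ac<′ ⟩
      a ^ j * (d * (a + ι j * δ))     ≡⟨ swap (a ^ j) d (a + ι j * δ) ⟩
      d * (a ^ j * (a + ι j * δ))     ≤⟨ *-monoˡ-≤ (<⇒≤ 0<d) (^-growth (<⇒≤ 0<a) (<⇒≤ 0<δ) j) ⟩
      d * (a * (a + δ) ^ j)           ≡⟨ cong (λ t → d * (a * t ^ j)) (a+δ a b) ⟩
      d * (a * b ^ j)                 ≡⟨ swap′ d a (b ^ j) ⟩
      a * (b ^ j * d)                 ∎)
      where
      open ≤-Reasoning
      j = suc j₀
      ac<′ : a * c < d * (a + ι j * δ)
      ac<′ = begin-strict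
        a * c                                   <⟨ ac< ⟩
        ι j₀ * (d * δ)                          ≡⟨ +-identityʳ _ ⟨
        ι j₀ * (d * δ) + 0ℚ                     ≤⟨ +-monoʳ-≤ (ι j₀ * (d * δ)) (<⇒≤ (*-pos 0<d (+-pos 0<a 0<δ))) ⟩
        ι j₀ * (d * δ) + d * (a + δ)            ≡⟨ rearrange a d (ι j₀) δ ⟨
        d * (a + (1ℚ + ι j₀) * δ)               ≡⟨ cong (λ t → d * (a + t * δ)) (ι-+ 1 j₀) ⟨
        d * (a + ι j * δ)                       ∎

  -- A factor 0 < t < 1 so close to 1 that k copies of it do not disturb a < b.
  record Shrink (a b : ℚ) (k : ℕ) : Set where
    field
      t t⁻¹  : ℚ
      0<t    : 0ℚ < t
      t<1    : t < 1ℚ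
      tt⁻¹≡1 : t * t⁻¹ ≡ 1ℚ
      a<t^k*b : a < t ^ k * b

    1<t⁻¹ : 1ℚ < t⁻¹
    1<t⁻¹ = 1<inverse 0<t t<1 tt⁻¹≡1

  bernoulli : 0ℚ ≤ c → c ≤ 1ℚ → ∀ k → 1ℚ - ι k * c ≤ (1ℚ - c) ^ k
  bernoulli {c} 0≤c c≤1 zero = ≤-reflexive (base c)
    where
    base : ∀ c → 1ℚ - 0ℚ * c ≡ 1ℚ
    base = solve-∀ ℚ-ring
  bernoulli {c} 0≤c c≤1 (suc k) = begin
    1ℚ - ι (suc k) * c                      ≡⟨ cong (λ t → 1ℚ - t * c) (ι-+ 1 k) ⟩
    1ℚ - (1ℚ + ι k) * c                     ≡⟨ +-identityʳ _ ⟨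
    1ℚ - (1ℚ + ι k) * c + 0ℚ                ≤⟨ +-monoʳ-≤ (1ℚ - (1ℚ + ι k) * c) (*-nonNeg (0≤ι k) (*-nonNeg 0≤c 0≤c)) ⟩
    1ℚ - (1ℚ + ι k) * c + ι k * (c * c)     ≡⟨ expand (ι k) c ⟩
    (1ℚ - c) * (1ℚ - ι k * c)               ≤⟨ *-monoˡ-≤ (≤⇒0≤- c≤1) (bernoulli 0≤c c≤1 k) ⟩
    (1ℚ - c) * (1ℚ - c) ^ k                 ∎
    where
    open ≤-Reasoning
    expand : ∀ k c → 1ℚ - (1ℚ + k) * c + k * (c * c) ≡ (1ℚ - c) * (1ℚ - k * c)
    expand = solve-∀ ℚ-ring

  shrink : a < b → 0ℚ < b → ∀ k → Shrink a b k
  shrink {a} {b} a<b 0<b k = step (proj₁ arch) (proj₂ arch) (proj₁ inv) (proj₁ (proj₂ inv)) (proj₂ (proj₂ inv))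
    where
    arch : ∃ λ j → ι k * b < ι j * (b - a)
    arch = archimedean (<⇒0<- a<b)
    -- ε = 1 / (j₀ + 2) where k b < j₀ (b - a), so that k ε b < b - a and Bernoulli's inequality
    -- applies to (1 - ε)^k. The summand 2 ensures ε < 1 even for j₀ = 0.
    inv : ∃ λ ε → 0ℚ < ε × ι (2 ℕ.+ proj₁ arch) * ε ≡ 1ℚ
    inv = inverse (0<ι {2 ℕ.+ proj₁ arch} (ℕ.s≤s ℕ.z≤n))
    step : ∀ j₀ → ι k * b < ι j₀ * (b - a) → ∀ ε → 0ℚ < ε → ι (2 ℕ.+ j₀) * ε ≡ 1ℚ → Shrink a b k
    step j₀ kb<j₀[b-a] ε 0<ε jε≡1 = record
      { t = 1ℚ - ε ; t⁻¹ = proj₁ t-inverse ; 0<t = 0<t ; t<1 = t<1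
      ; tt⁻¹≡1 = proj₂ (proj₂ t-inverse) ; a<t^k*b = a<t^k*b }
      where
      open ≤-Reasoning
      j = 2 ℕ.+ j₀
      ε<1 : ε < 1ℚ
      ε<1 = subst₂ _<_ (*-identityˡ ε) jε≡1 (*-monoʳ-< 0<ε (ι-mono-< {1} {j} (ℕ.s≤s (ℕ.s≤s ℕ.z≤n))))
      0<t : 0ℚ < 1ℚ - ε
      0<t = <⇒0<- ε<1
      t-inverse = inverse 0<t
      t<1 : 1ℚ - ε < 1ℚ
      t<1 = 0<-⇒< (subst (0ℚ <_) (1-[1-ε] ε) 0<ε)
        where
        1-[1-ε] : ∀ ε → ε ≡ 1ℚ - (1ℚ - ε)
        1-[1-ε] = solve-∀ ℚ-ring
      kεb<b-a : ι k * ε * b < b - a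
      kεb<b-a = begin-strict
        ι k * ε * b              ≡⟨ swap (ι k) ε b ⟩
        ι k * b * ε              <⟨ *-monoʳ-< 0<ε kb<j₀[b-a] ⟩
        ι j₀ * (b - a) * ε       <⟨ *-monoʳ-< 0<ε (*-monoʳ-< (<⇒0<- a<b) (ι-mono-< {j₀} {j} (ℕ.m≤n⇒m≤1+n ℕ.≤-refl))) ⟩
        ι j * (b - a) * ε        ≡⟨ swap (ι j) (b - a) ε ⟩
        ι j * ε * (b - a)        ≡⟨ cong (_* (b - a)) jε≡1 ⟩
        1ℚ * (b - a)             ≡⟨ *-identityˡ (b - a) ⟩
        b - a                    ∎
        where
        swap : ∀ x y z → x * y * z ≡ x * z * y
        swap = solve-∀ ℚ-ring
      a<t^k*b : a < (1ℚ - ε) ^ k * b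
      a<t^k*b = begin-strict
        a                        ≡⟨ b-[b-a] a b ⟩
        b - (b - a)              <⟨ +-monoʳ-< b (neg-antimono-< kεb<b-a) ⟩
        b - ι k * ε * b          ≡⟨ factor b (ι k * ε) ⟩
        (1ℚ - ι k * ε) * b       ≤⟨ *-monoʳ-≤ (<⇒≤ 0<b) (bernoulli (<⇒≤ 0<ε) (<⇒≤ ε<1) k) ⟩
        (1ℚ - ε) ^ k * b         ∎
        where
        b-[b-a] : ∀ a b → a ≡ b - (b - a)
        b-[b-a] = solve-∀ ℚ-ring
        factor : ∀ b c → b - c * b ≡ (1ℚ - c) * b
        factor = solve-∀ ℚ-ring

-- Rational powers, compared through natural exponents.

module RationalPowers where
  open import Data.Nat.Base as ℕ using (ℕ; suc)
  import Data.Nat.Properties as ℕ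
  open import Data.Integer.Base using (+_; -[1+_])
  open import Data.Rational.Base
  open import Data.Rational.Properties
  open import Data.Product.Base using (_×_; _,_; ∃)
  open import Relation.Binary.PropositionalEquality
  open import Tactic.RingSolver using (solve-∀)
  open import Defs using (Pow<_; _<Pow)
  open OrderedField

  private variable
    a b e f u v : ℚ
    s t k s′ t′ k′ : ℕ

  -- e = (s - t) / k, and below u < a ^ e resp. a ^ e < u for such an e.
  record IsFraction (e : ℚ) (s t k : ℕ) : Set where
    constructor fraction
    field
      1≤k : 1 ℕ.≤ k
      e*k+t≡s : e * ι k + ι t ≡ ι s

  _<_^[_-_/_] : ℚ → ℚ → ℕ → ℕ → ℕ → Set
  u < a ^[ s - t / k ] = u ^ k * a ^ t < a ^ s

  _^[_-_/_]<_ : ℚ → ℕ → ℕ → ℕ → ℚ → Set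
  a ^[ s - t / k ]< u = a ^ s < u ^ k * a ^ t

  fraction-mono : IsFraction e s t k → IsFraction f s′ t′ k′ → e ≤ f →
    s ℕ.* k′ ℕ.+ t′ ℕ.* k ℕ.≤ s′ ℕ.* k ℕ.+ t ℕ.* k′
  fraction-mono {e} {s} {t} {k} {f} {s′} {t′} {k′} (fraction _ eq) (fraction _ eq′) e≤f =
    ι-cancel-≤ (begin
      ι (s ℕ.* k′ ℕ.+ t′ ℕ.* k)                        ≡⟨ push s k′ t′ k ⟩
      ι s * ι k′ + ι t′ * ι k                          ≡⟨ cong (λ x → x * ι k′ + ι t′ * ι k) eq ⟨
      (e * ι k + ι t) * ι k′ + ι t′ * ι k              ≡⟨ expand e (ι k) (ι t) (ι k′) (ι t′) ⟩
      e * (ι k * ι k′) + (ι t * ι k′ + ι t′ * ι k)     ≤⟨ +-monoˡ-≤ (ι t * ι k′ + ι t′ * ι k) (*-monoʳ-≤ (*-nonNeg (0≤ι k) (0≤ι k′)) e≤f) ⟩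
      f * (ι k * ι k′) + (ι t * ι k′ + ι t′ * ι k)     ≡⟨ collect f (ι k) (ι t) (ι k′) (ι t′) ⟩
      (f * ι k′ + ι t′) * ι k + ι t * ι k′             ≡⟨ cong (λ x → x * ι k + ι t * ι k′) eq′ ⟩
      ι s′ * ι k + ι t * ι k′                          ≡⟨ push s′ k t k′ ⟨
      ι (s′ ℕ.* k ℕ.+ t ℕ.* k′)                        ∎)
    where
    open ≤-Reasoning
    push : ∀ a b c d → ι (a ℕ.* b ℕ.+ c ℕ.* d) ≡ ι a * ι b + ι c * ι d
    push a b c d = trans (ι-+ (a ℕ.* b) (c ℕ.* d)) (cong₂ _+_ (ι-* a b) (ι-* c d))
    expand : ∀ e k t k′ t′ → (e * k + t) * k′ + t′ * k ≡ e * (k * k′) + (t * k′ + t′ * k)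
    expand = solve-∀ ℚ-ring
    collect : ∀ f k t k′ t′ → f * (k * k′) + (t * k′ + t′ * k) ≡ (f * k′ + t′) * k + t * k′
    collect = solve-∀ ℚ-ring

  fraction-≡ : IsFraction e s t k → IsFraction e s′ t′ k′ →
    s ℕ.* k′ ℕ.+ t′ ℕ.* k ≡ s′ ℕ.* k ℕ.+ t ℕ.* k′
  fraction-≡ p q = ℕ.≤-antisym (fraction-mono p q ≤-refl) (fraction-mono q p ≤-refl)

  module _ (u a : ℚ) (s t k s′ t′ k′ : ℕ) where

    cross : (u ^ k′ * a ^ t′) ^ k * a ^ (t ℕ.* k′) ≡ (u ^ k * a ^ t) ^ k′ * a ^ (t′ ℕ.* k)
    cross = begin
      (u ^ k′ * a ^ t′) ^ k * a ^ (t ℕ.* k′)         ≡⟨ cong₂ _*_ (^-distrib-* (u ^ k′) (a ^ t′) k) (sym (^-assocʳ a t k′)) ⟩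
      (u ^ k′) ^ k * (a ^ t′) ^ k * (a ^ t) ^ k′     ≡⟨ swap ((u ^ k′) ^ k) ((a ^ t′) ^ k) ((a ^ t) ^ k′) ⟩
      (u ^ k′) ^ k * (a ^ t) ^ k′ * (a ^ t′) ^ k     ≡⟨ cong₂ (λ x y → x * (a ^ t) ^ k′ * y) (^-comm u k′ k) (^-assocʳ a t′ k) ⟩
      (u ^ k) ^ k′ * (a ^ t) ^ k′ * a ^ (t′ ℕ.* k)   ≡⟨ cong (_* a ^ (t′ ℕ.* k)) (^-distrib-* (u ^ k) (a ^ t) k′) ⟨
      (u ^ k * a ^ t) ^ k′ * a ^ (t′ ℕ.* k)          ∎
      where
      open ≡-Reasoning
      swap : ∀ x y z → x * y * z ≡ x * z * y
      swap = solve-∀ ℚ-ring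

  ^-product : ∀ a s k t → (a ^ s) ^ k * a ^ t ≡ a ^ (s ℕ.* k ℕ.+ t)
  ^-product a s k t = trans (cong (_* a ^ t) (^-assocʳ a s k)) (sym (^-homo-* a (s ℕ.* k) t))

  -- Both sides are brought to the common denominator k k′. The comparison of powers of a is left as
  -- a hypothesis, so that one argument serves a change of fraction, where they are equal, and a
  -- change of exponent, where they are ordered.
  <^-transfer : 0ℚ ≤ u → 0ℚ < a → ∀ s t k s′ t′ k′ → 1 ℕ.≤ k′ →
    a ^ (s ℕ.* k′ ℕ.+ t′ ℕ.* k) ≤ a ^ (s′ ℕ.* k ℕ.+ t ℕ.* k′) →
    u < a ^[ s - t / k ] → u < a ^[ s′ - t′ / k′ ]
  <^-transfer {u} {a} 0≤u 0<a s t k s′ t′ k′ 1≤k′ ord u< =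
    ^-cancel-< k (^-nonNeg 0≤a s′) (*-cancelʳ-< (^-nonNeg 0≤a (t ℕ.* k′)) (begin-strict
      (u ^ k′ * a ^ t′) ^ k * a ^ (t ℕ.* k′)   ≡⟨ cross u a s t k s′ t′ k′ ⟩
      (u ^ k * a ^ t) ^ k′ * a ^ (t′ ℕ.* k)    <⟨ *-monoʳ-< (^-pos 0<a (t′ ℕ.* k)) (^-monoˡ-< 1≤k′ (*-nonNeg (^-nonNeg 0≤u k) (^-nonNeg 0≤a t)) u<) ⟩
      (a ^ s) ^ k′ * a ^ (t′ ℕ.* k)            ≡⟨ ^-product a s k′ (t′ ℕ.* k) ⟩
      a ^ (s ℕ.* k′ ℕ.+ t′ ℕ.* k)              ≤⟨ ord ⟩
      a ^ (s′ ℕ.* k ℕ.+ t ℕ.* k′)              ≡⟨ ^-product a s′ k (t ℕ.* k′) ⟨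
      (a ^ s′) ^ k * a ^ (t ℕ.* k′)            ∎))
    where
    open ≤-Reasoning
    0≤a = <⇒≤ 0<a

  ^<-transfer : 0ℚ ≤ u → 0ℚ < a → ∀ s t k s′ t′ k′ → 1 ℕ.≤ k′ →
    a ^ (s′ ℕ.* k ℕ.+ t ℕ.* k′) ≤ a ^ (s ℕ.* k′ ℕ.+ t′ ℕ.* k) →
    a ^[ s - t / k ]< u → a ^[ s′ - t′ / k′ ]< u
  ^<-transfer {u} {a} 0≤u 0<a s t k s′ t′ k′ 1≤k′ ord <u =
    ^-cancel-< k (*-nonNeg (^-nonNeg 0≤u k′) (^-nonNeg 0≤a t′)) (*-cancelʳ-< (^-nonNeg 0≤a (t ℕ.* k′)) (begin-strict
      (a ^ s′) ^ k * a ^ (t ℕ.* k′)            ≡⟨ ^-product a s′ k (t ℕ.* k′) ⟩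
      a ^ (s′ ℕ.* k ℕ.+ t ℕ.* k′)              ≤⟨ ord ⟩
      a ^ (s ℕ.* k′ ℕ.+ t′ ℕ.* k)              ≡⟨ ^-product a s k′ (t′ ℕ.* k) ⟨
      (a ^ s) ^ k′ * a ^ (t′ ℕ.* k)            <⟨ *-monoʳ-< (^-pos 0<a (t′ ℕ.* k)) (^-monoˡ-< 1≤k′ (^-nonNeg 0≤a s) <u) ⟩
      (u ^ k * a ^ t) ^ k′ * a ^ (t′ ℕ.* k)    ≡⟨ cross u a s t k s′ t′ k′ ⟨
      (u ^ k′ * a ^ t′) ^ k * a ^ (t ℕ.* k′)   ∎))
    where
    open ≤-Reasoning
    0≤a = <⇒≤ 0<a

  -- Absorbs the case distinction on the sign of e in `_<Pow` and `Pow<_`: either way the comparison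
  -- is one with exponent (num - off) / den.
  record Canonical (e : ℚ) : Set where
    field
      num off den : ℕ
      isFraction : IsFraction e num off den
      <Pow⇒ : ∀ {u a} → (u <Pow) a e → u < a ^[ num - off / den ]
      ⇒<Pow : ∀ {u a} → u < a ^[ num - off / den ] → (u <Pow) a e
      Pow<⇒ : ∀ {u a} → (Pow< u) a e → a ^[ num - off / den ]< u
      ⇒Pow< : ∀ {u a} → a ^[ num - off / den ]< u → (Pow< u) a e
    open IsFraction isFraction public

  canonical : ∀ e → Canonical e
  canonical p@(mkℚ (+ m) d-1 _) = record
    { num = m ; off = 0 ; den = suc d-1
    ; isFraction = fraction (ℕ.s≤s ℕ.z≤n) (trans (+-identityʳ _) (*-denominator p))
    ; <Pow⇒ = λ {u} {a} → subst (_< a ^ m) (sym (*-identityʳ _))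
    ; ⇒<Pow = λ {u} {a} → subst (_< a ^ m) (*-identityʳ _)
    ; Pow<⇒ = λ {u} {a} → subst (a ^ m <_) (sym (*-identityʳ _))
    ; ⇒Pow< = λ {u} {a} → subst (a ^ m <_) (*-identityʳ _)
    }
  canonical p@(mkℚ -[1+ m ] d-1 _) = record
    { num = 0 ; off = suc m ; den = suc d-1
    ; isFraction = fraction (ℕ.s≤s ℕ.z≤n)
        (trans (cong (_+ ι (suc m)) (*-denominator p)) (+-inverseˡ (ι (suc m))))
    ; <Pow⇒ = λ h → h ; ⇒<Pow = λ h → h ; Pow<⇒ = λ h → h ; ⇒Pow< = λ h → h
    }

  <Pow⇒<^ : 0ℚ ≤ u → 0ℚ < a → IsFraction e s t k → (u <Pow) a e → u < a ^[ s - t / k ]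
  <Pow⇒<^ {u} {a} {e} {s} {t} {k} 0≤u 0<a fr p = <^-transfer 0≤u 0<a C.num C.off C.den s t k (IsFraction.1≤k fr)
    (≤-reflexive (cong (a ^_) (fraction-≡ C.isFraction fr))) (C.<Pow⇒ p)
    where module C = Canonical (canonical e)

  <^⇒<Pow : 0ℚ ≤ u → 0ℚ < a → IsFraction e s t k → u < a ^[ s - t / k ] → (u <Pow) a e
  <^⇒<Pow {u} {a} {e} {s} {t} {k} 0≤u 0<a fr p = C.⇒<Pow (<^-transfer 0≤u 0<a s t k C.num C.off C.den C.1≤k
    (≤-reflexive (cong (a ^_) (fraction-≡ fr C.isFraction))) p)
    where module C = Canonical (canonical e)

  Pow<⇒^< : 0ℚ ≤ u → 0ℚ < a → IsFraction e s t k → (Pow< u) a e → a ^[ s - t / k ]< u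
  Pow<⇒^< {u} {a} {e} {s} {t} {k} 0≤u 0<a fr p = ^<-transfer 0≤u 0<a C.num C.off C.den s t k (IsFraction.1≤k fr)
    (≤-reflexive (cong (a ^_) (sym (fraction-≡ C.isFraction fr)))) (C.Pow<⇒ p)
    where module C = Canonical (canonical e)

  ^<⇒Pow< : 0ℚ ≤ u → 0ℚ < a → IsFraction e s t k → a ^[ s - t / k ]< u → (Pow< u) a e
  ^<⇒Pow< {u} {a} {e} {s} {t} {k} 0≤u 0<a fr p = C.⇒Pow< (^<-transfer 0≤u 0<a s t k C.num C.off C.den C.1≤k
    (≤-reflexive (cong (a ^_) (sym (fraction-≡ fr C.isFraction)))) p)
    where module C = Canonical (canonical e)

  <Pow-monoʳ : 0ℚ ≤ u → 1ℚ ≤ a → e ≤ f → (u <Pow) a e → (u <Pow) a f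
  <Pow-monoʳ {u} {a} {e} {f} 0≤u 1≤a e≤f p = F.⇒<Pow
    (<^-transfer 0≤u (<-≤-trans 0<1 1≤a) E.num E.off E.den F.num F.off F.den F.1≤k
      (^-monoʳ-≤ 1≤a (fraction-mono E.isFraction F.isFraction e≤f)) (E.<Pow⇒ p))
    where
    module E = Canonical (canonical e)
    module F = Canonical (canonical f)

  Pow<-antimonoʳ : 0ℚ ≤ u → 0ℚ < a → a ≤ 1ℚ → e ≤ f → (Pow< u) a e → (Pow< u) a f
  Pow<-antimonoʳ {u} {a} {e} {f} 0≤u 0<a a≤1 e≤f p = F.⇒Pow<
    (^<-transfer 0≤u 0<a E.num E.off E.den F.num F.off F.den F.1≤k
      (^-antimonoʳ-≤ (<⇒≤ 0<a) a≤1 (fraction-mono E.isFraction F.isFraction e≤f)) (E.Pow<⇒ p))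
    where
    module E = Canonical (canonical e)
    module F = Canonical (canonical f)

  <Pow-antimonoˡ : 0ℚ ≤ u → 0ℚ < a → u ≤ v → (v <Pow) a e → (u <Pow) a e
  <Pow-antimonoˡ {u} {a} {v} {e} 0≤u 0<a u≤v p = E.⇒<Pow (≤-<-trans
    (*-monoʳ-≤ (^-nonNeg (<⇒≤ 0<a) E.off) (^-monoˡ-≤ E.den 0≤u u≤v)) (E.<Pow⇒ p))
    where module E = Canonical (canonical e)

  <Pow<⇒< : 0ℚ < a → 0ℚ ≤ v → (u <Pow) a e → (Pow< v) a e → u < v
  <Pow<⇒< {a} {v} {u} {e} 0<a 0≤v p q = ^-cancel-< E.den 0≤v
    (*-cancelʳ-< (^-nonNeg (<⇒≤ 0<a) E.off) (<-trans (E.<Pow⇒ p) (E.Pow<⇒ q)))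
    where module E = Canonical (canonical e)

  ^-raise : ∀ u a k t j → (u ^ k * a ^ t) ^ j ≡ (u ^ j) ^ k * (a ^ j) ^ t
  ^-raise u a k t j = trans (^-distrib-* (u ^ k) (a ^ t) j) (cong₂ _*_ (^-comm u k j) (^-comm a t j))

  <Pow-raise : ∀ j → 1 ℕ.≤ j → 0ℚ ≤ u → 0ℚ < a → (u <Pow) a e → ((u ^ j) <Pow) (a ^ j) e
  <Pow-raise {u} {a} {e} j 1≤j 0≤u 0<a p = E.⇒<Pow (subst₂ _<_ (^-raise u a E.den E.off j) (^-comm a E.num j)
    (^-monoˡ-< 1≤j (*-nonNeg (^-nonNeg 0≤u E.den) (^-nonNeg (<⇒≤ 0<a) E.off)) (E.<Pow⇒ p)))
    where module E = Canonical (canonical e)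

  Pow<-raise : ∀ j → 1 ℕ.≤ j → 0ℚ < a → (Pow< u) a e → (Pow< (u ^ j)) (a ^ j) e
  Pow<-raise {a} {u} {e} j 1≤j 0<a p = E.⇒Pow< (subst₂ _<_ (^-comm a E.num j) (^-raise u a E.den E.off j)
    (^-monoˡ-< 1≤j (^-nonNeg (<⇒≤ 0<a) E.num) (E.Pow<⇒ p)))
    where module E = Canonical (canonical e)

  -- Power functions are monotone in a direction set by the sign of e, so bounds at both ends cover
  -- both signs.
  <Pow-between : ∀ {x} e → 0ℚ < a → 0ℚ ≤ u → a ≤ x → x ≤ b → (u <Pow) a e → (u <Pow) b e → (u <Pow) x e
  <Pow-between (mkℚ (+ m) _ _) 0<a 0≤u a≤x x≤b p q = <-≤-trans p (^-monoˡ-≤ m (<⇒≤ 0<a) a≤x)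
  <Pow-between (mkℚ -[1+ m ] d-1 _) 0<a 0≤u a≤x x≤b p q = ≤-<-trans
    (*-monoˡ-≤ (^-nonNeg 0≤u (suc d-1)) (^-monoˡ-≤ (suc m) (≤-trans (<⇒≤ 0<a) a≤x) x≤b)) q

  Pow<-between : ∀ {x} e → 0ℚ < a → 0ℚ ≤ u → a ≤ x → x ≤ b → (Pow< u) a e → (Pow< u) b e → (Pow< u) x e
  Pow<-between (mkℚ (+ m) _ _) 0<a 0≤u a≤x x≤b p q = ≤-<-trans (^-monoˡ-≤ m (≤-trans (<⇒≤ 0<a) a≤x) x≤b) q
  Pow<-between (mkℚ -[1+ m ] d-1 _) 0<a 0≤u a≤x x≤b p q = <-≤-trans p
    (*-monoˡ-≤ (^-nonNeg 0≤u (suc d-1)) (^-monoˡ-≤ (suc m) (<⇒≤ 0<a) a≤x))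

  -- e′ = e - 1 / (k j)
  fraction-pred : ∀ j → 1 ℕ.≤ j → IsFraction e s t k →
    ∃ λ e′ → e′ < e × IsFraction e′ (s ℕ.* j) (t ℕ.* j ℕ.+ 1) (k ℕ.* j)
  fraction-pred {e} {s} {t} {k} j 1≤j (fraction 1≤k eq) = from (inverse (0<ι 1≤kj))
    where
    1≤kj : 1 ℕ.≤ k ℕ.* j
    1≤kj = ℕ.*-mono-≤ 1≤k 1≤j
    from : (∃ λ δ → 0ℚ < δ × ι (k ℕ.* j) * δ ≡ 1ℚ) →
      ∃ λ e′ → e′ < e × IsFraction e′ (s ℕ.* j) (t ℕ.* j ℕ.+ 1) (k ℕ.* j)
    from (δ , 0<δ , kjδ≡1) = e - δ
      , subst (e - δ <_) (+-identityʳ e) (+-monoʳ-< e (neg-antimono-< 0<δ))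
      , fraction 1≤kj (begin
        (e - δ) * ι (k ℕ.* j) + ι (t ℕ.* j ℕ.+ 1)
          ≡⟨ cong₂ (λ x y → (e - δ) * x + y) (ι-* k j) (trans (ι-+ (t ℕ.* j) 1) (cong (_+ 1ℚ) (ι-* t j))) ⟩
        (e - δ) * (ι k * ι j) + (ι t * ι j + 1ℚ)
          ≡⟨ expand e δ (ι k) (ι j) (ι t) ⟩
        (e * ι k + ι t) * ι j + (1ℚ - ι k * ι j * δ)
          ≡⟨ cong₂ (λ x y → x * ι j + (1ℚ - y)) eq (trans (cong (_* δ) (sym (ι-* k j))) kjδ≡1) ⟩
        ι s * ι j + (1ℚ - 1ℚ)
          ≡⟨ +-identityʳ _ ⟩
        ι s * ι j
          ≡⟨ ι-* s j ⟨
        ι (s ℕ.* j) ∎)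
      where
      open ≡-Reasoning
      expand : ∀ e δ k j t → (e - δ) * (k * j) + (t * j + 1ℚ) ≡ (e * k + t) * j + (1ℚ - k * j * δ)
      expand = solve-∀ ℚ-ring

  ^-scale : ∀ u a k t j → u ^ (k ℕ.* j) * a ^ (t ℕ.* j ℕ.+ 1) ≡ (u ^ k * a ^ t) ^ j * a
  ^-scale u a k t j = begin
    u ^ (k ℕ.* j) * a ^ (t ℕ.* j ℕ.+ 1)        ≡⟨ cong₂ _*_ (sym (^-assocʳ u k j)) (^-homo-* a (t ℕ.* j) 1) ⟩
    (u ^ k) ^ j * (a ^ (t ℕ.* j) * (a * 1ℚ))   ≡⟨ cong₂ (λ x y → (u ^ k) ^ j * (x * y)) (sym (^-assocʳ a t j)) (*-identityʳ a) ⟩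
    (u ^ k) ^ j * ((a ^ t) ^ j * a)            ≡⟨ *-assoc ((u ^ k) ^ j) ((a ^ t) ^ j) a ⟨
    (u ^ k) ^ j * (a ^ t) ^ j * a              ≡⟨ cong (_* a) (^-distrib-* (u ^ k) (a ^ t) j) ⟨
    (u ^ k * a ^ t) ^ j * a                    ∎
    where open ≡-Reasoning

  -- Raised to a high power j, the strict inequality u^k a^t < a^s leaves room for one more factor a
  -- on the left, which lowers the exponent by 1 / (k j).
  <Pow-open : 0ℚ < u → 0ℚ < a → (u <Pow) a e → ∃ λ e′ → e′ < e × (u <Pow) a e′
  <Pow-open {u} {a} {e} 0<u 0<a p = from
    (^-archimedean {d = 1ℚ} {c = a} (*-pos (^-pos 0<u E.den) (^-pos 0<a E.off)) (E.<Pow⇒ p) 0<1)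
    where
    module E = Canonical (canonical e)
    from : (∃ λ j → 1 ℕ.≤ j × (u ^ E.den * a ^ E.off) ^ j * a < (a ^ E.num) ^ j * 1ℚ) →
      ∃ λ e′ → e′ < e × (u <Pow) a e′
    from (j , 1≤j , arch) = from′ (fraction-pred j 1≤j E.isFraction)
      where
      from′ : (∃ λ e′ → e′ < e × IsFraction e′ (E.num ℕ.* j) (E.off ℕ.* j ℕ.+ 1) (E.den ℕ.* j)) →
        ∃ λ e′ → e′ < e × (u <Pow) a e′
      from′ (e′ , e′<e , fr) = e′ , e′<e , <^⇒<Pow (<⇒≤ 0<u) 0<a fr
        (subst₂ _<_ (sym (^-scale u a E.den E.off j)) (trans (*-identityʳ _) (^-assocʳ a E.num j)) arch)

  Pow<-open : 0ℚ ≤ u → 0ℚ < a → (Pow< u) a e → ∃ λ e′ → e′ < e × (Pow< u) a e′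
  Pow<-open {u} {a} {e} 0≤u 0<a p = from
    (^-archimedean {d = a} {c = 1ℚ} (^-pos 0<a E.num) (E.Pow<⇒ p) 0<a)
    where
    module E = Canonical (canonical e)
    from : (∃ λ j → 1 ℕ.≤ j × (a ^ E.num) ^ j * 1ℚ < (u ^ E.den * a ^ E.off) ^ j * a) →
      ∃ λ e′ → e′ < e × (Pow< u) a e′
    from (j , 1≤j , arch) = from′ (fraction-pred j 1≤j E.isFraction)
      where
      from′ : (∃ λ e′ → e′ < e × IsFraction e′ (E.num ℕ.* j) (E.off ℕ.* j ℕ.+ 1) (E.den ℕ.* j)) →
        ∃ λ e′ → e′ < e × (Pow< u) a e′
      from′ (e′ , e′<e , fr) = e′ , e′<e , ^<⇒Pow< 0≤u 0<a fr
        (subst₂ _<_ (trans (*-identityʳ _) (^-assocʳ a E.num j)) (sym (^-scale u a E.den E.off j)) arch)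

  -- The subtrahend t is shared as well as the denominator, so that comparing e with f is comparing
  -- s with s′.
  commonFraction : ∀ e f → ∃ λ s → ∃ λ s′ → ∃ λ t → ∃ λ k → IsFraction e s t k × IsFraction f s′ t k
  commonFraction e f =
    E.num ℕ.* F.den ℕ.+ F.off ℕ.* E.den , F.num ℕ.* E.den ℕ.+ E.off ℕ.* F.den , E.off ℕ.* F.den ℕ.+ F.off ℕ.* E.den , E.den ℕ.* F.den ,
    extend E.num E.off E.den F.den (F.off ℕ.* E.den) F.1≤k E.isFraction ,
    subst₂ (λ t k → IsFraction f (F.num ℕ.* E.den ℕ.+ E.off ℕ.* F.den) t k)
      (ℕ.+-comm (F.off ℕ.* E.den) (E.off ℕ.* F.den)) (ℕ.*-comm F.den E.den)
      (extend F.num F.off F.den E.den (E.off ℕ.* F.den) E.1≤k F.isFraction)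
    where
    module E = Canonical (canonical e)
    module F = Canonical (canonical f)
    extend : ∀ {e} s t k l r → 1 ℕ.≤ l → IsFraction e s t k →
      IsFraction e (s ℕ.* l ℕ.+ r) (t ℕ.* l ℕ.+ r) (k ℕ.* l)
    extend {e} s t k l r 1≤l (fraction 1≤k eq) = fraction (ℕ.*-mono-≤ 1≤k 1≤l) (begin
      e * ι (k ℕ.* l) + ι (t ℕ.* l ℕ.+ r)       ≡⟨ cong₂ (λ x y → e * x + y) (ι-* k l) (trans (ι-+ (t ℕ.* l) r) (cong (_+ ι r) (ι-* t l))) ⟩
      e * (ι k * ι l) + (ι t * ι l + ι r)       ≡⟨ collect e (ι k) (ι l) (ι t) (ι r) ⟩
      (e * ι k + ι t) * ι l + ι r               ≡⟨ cong (λ x → x * ι l + ι r) eq ⟩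
      ι s * ι l + ι r                           ≡⟨ trans (ι-+ (s ℕ.* l) r) (cong (_+ ι r) (ι-* s l)) ⟨
      ι (s ℕ.* l ℕ.+ r)                         ∎)
      where
      open ≡-Reasoning
      collect : ∀ e k l t r → e * (k * l) + (t * l + r) ≡ (e * k + t) * l + r
      collect = solve-∀ ℚ-ring

  commonFraction-< : IsFraction e s t k → IsFraction f s′ t k → e < f → s ℕ.< s′
  commonFraction-< {e} {s} {t} {k} {f} {s′} (fraction 1≤k eq) (fraction _ eq′) e<f =
    ι-cancel-< (subst₂ _<_ eq eq′ (+-monoˡ-< (ι t) (*-monoʳ-< (0<ι 1≤k) e<f)))

-- The constant c as a Dedekind cut.

module Exponent where
  open import Data.Nat.Base as ℕ using (ℕ; zero; suc)
  open import Data.Rational.Base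
  open import Data.Rational.Properties
  open import Data.Product.Base using (_×_; _,_; ∃)
  open import Data.Sum.Base as Sum using (_⊎_; inj₁; inj₂)
  open import Relation.Nullary using (¬_; Dec; yes; no)
  open import Relation.Binary.PropositionalEquality
  open import Tactic.RingSolver using (solve-∀)
  open import Defs using (_<Pow; ℝ; Cut)
  open OrderedField
  open RationalPowers

  private variable
    u v : ℚ

  geomℚ : ℚ → ℕ → ℚ
  geomℚ u zero    = 0ℚ
  geomℚ u (suc k) = geomℚ u k + u ^ k

  geomℚ-suc : ∀ u k → geomℚ u (suc k) ≡ 1ℚ + u * geomℚ u k
  geomℚ-suc u zero    = base u
    where
    base : ∀ u → 0ℚ + 1ℚ ≡ 1ℚ + u * 0ℚ
    base = solve-∀ ℚ-ring
  geomℚ-suc u (suc k) = trans (cong (_+ u ^ suc k) (geomℚ-suc u k)) (collect u (geomℚ u k) (u ^ k))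
    where
    collect : ∀ u g p → 1ℚ + u * g + u * p ≡ 1ℚ + u * (g + p)
    collect = solve-∀ ℚ-ring

  geomℚ-nonNeg : 0ℚ ≤ u → ∀ k → 0ℚ ≤ geomℚ u k
  geomℚ-nonNeg 0≤u zero    = ≤-refl
  geomℚ-nonNeg {u} 0≤u (suc k) =
    +-nonNeg (geomℚ-nonNeg 0≤u k) (^-nonNeg 0≤u k)

  geomℚ-mono : 0ℚ ≤ u → u ≤ v → ∀ k → geomℚ u k ≤ geomℚ v k
  geomℚ-mono 0≤u u≤v zero    = ≤-refl
  geomℚ-mono 0≤u u≤v (suc k) = +-mono-≤ (geomℚ-mono 0≤u u≤v k) (^-monoˡ-≤ k 0≤u u≤v)

  1≤geomℚ : 0ℚ ≤ u → ∀ k → 1ℚ ≤ geomℚ u (suc k)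
  1≤geomℚ {u} 0≤u k = subst₂ _≤_ (+-identityʳ 1ℚ) (sym (geomℚ-suc u k))
    (+-monoʳ-≤ 1ℚ (*-nonNeg 0≤u (geomℚ-nonNeg 0≤u k)))

  1-^-nonNeg : 0ℚ ≤ u → u ≤ 1ℚ → ∀ k → 0ℚ ≤ 1ℚ - u ^ k
  1-^-nonNeg 0≤u u≤1 k = ≤⇒0≤- (^≤1 0≤u u≤1 k)

  -- AM-GM for k copies of u^(k + 1) and a single 1. The step from k multiplies by u and adds (1 -
  -- u) (1 - u^(k + 1)).
  weighted-AMGM : 0ℚ ≤ u → u ≤ 1ℚ → ∀ k → 0ℚ ≤ ι k * u ^ suc k + 1ℚ - (1ℚ + ι k) * u ^ k
  weighted-AMGM {u} 0≤u u≤1 zero = subst (0ℚ ≤_) (base u) ≤-refl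
    where
    base : ∀ u → 0ℚ ≡ 0ℚ * (u * 1ℚ) + 1ℚ - (1ℚ + 0ℚ) * 1ℚ
    base = solve-∀ ℚ-ring
  weighted-AMGM {u} 0≤u u≤1 (suc k) = subst (0ℚ ≤_)
    (trans (collect u (ι k) (u ^ k)) (cong (λ t → t * u ^ suc (suc k) + 1ℚ - (1ℚ + t) * u ^ suc k) (sym (ι-+ 1 k))))
    (+-nonNeg
      (*-nonNeg 0≤u (weighted-AMGM 0≤u u≤1 k))
      (*-nonNeg (≤⇒0≤- u≤1) (1-^-nonNeg 0≤u u≤1 (suc k))))
    where
    collect : ∀ u i p → u * (i * (u * p) + 1ℚ - (1ℚ + i) * p) + (1ℚ - u) * (1ℚ - u * p)
      ≡ (1ℚ + i) * (u * (u * p)) + 1ℚ - (1ℚ + (1ℚ + i)) * (u * p)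
    collect = solve-∀ ℚ-ring

  -- By convexity of i ↦ u^i the sum stays below the trapezoid on its end terms. The gain from k to
  -- k + 1 is exactly `weighted-AMGM`.
  geomℚ-trapezoid : 0ℚ ≤ u → u ≤ 1ℚ → ∀ k →
    geomℚ u (suc k) + geomℚ u (suc k) ≤ ι (suc k) * (1ℚ + u ^ k)
  geomℚ-trapezoid {u} 0≤u u≤1 zero = ≤-reflexive refl
  geomℚ-trapezoid {u} 0≤u u≤1 (suc k) = 0≤-⇒≤ (subst (0ℚ ≤_)
    (trans (collect u (ι k) (u ^ k) (geomℚ u (suc k)))
      (cong (λ t → t * (1ℚ + u ^ suc k) - (geomℚ u (suc (suc k)) + geomℚ u (suc (suc k)))) (sym (trans (ι-+ 1 (suc k)) (cong (1ℚ +_) (ι-+ 1 k))))))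
    (+-nonNeg
      (≤⇒0≤- (subst (λ t → geomℚ u (suc k) + geomℚ u (suc k) ≤ t * (1ℚ + u ^ k)) (ι-+ 1 k) (geomℚ-trapezoid 0≤u u≤1 k)))
      (weighted-AMGM 0≤u u≤1 k)))
    where
    collect : ∀ u i p g → (1ℚ + i) * (1ℚ + p) - (g + g) + (i * (u * p) + 1ℚ - (1ℚ + i) * p)
      ≡ (1ℚ + (1ℚ + i)) * (1ℚ + u * p) - (g + u * p + (g + u * p))
    collect = solve-∀ ℚ-ring

  record Point : Set where
    field
      x x⁻¹   : ℚ
      0<x     : 0ℚ < x
      x<1     : x < 1ℚ
      xx⁻¹≡1  : x * x⁻¹ ≡ 1ℚ

    1<x⁻¹ : 1ℚ < x⁻¹
    1<x⁻¹ = 1<inverse 0<x x<1 xx⁻¹≡1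

    0<x⁻¹ : 0ℚ < x⁻¹
    0<x⁻¹ = <-trans 0<1 1<x⁻¹

  open Point

  x⁻¹-antitone : ∀ p {y y⁻¹} → 0ℚ ≤ y⁻¹ → x p ≤ y → y * y⁻¹ ≡ 1ℚ → y⁻¹ ≤ x⁻¹ p
  x⁻¹-antitone p {y} {y⁻¹} 0≤y⁻¹ x≤y yy⁻¹≡1 = *-cancelˡ-≤ (0<x p)
    (subst (x p * y⁻¹ ≤_) (trans yy⁻¹≡1 (sym (xx⁻¹≡1 p))) (*-monoʳ-≤ 0≤y⁻¹ x≤y))

  module _ {m : ℕ} (1≤m : 1 ℕ.≤ m) where

    q : ℕ
    q = suc m

    Q Q³ : ℚ
    Q  = ι q
    Q³ = Q ^ 3

    1≤Q : 1ℚ ≤ Q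
    1≤Q = ι-mono-≤ {1} {q} (ℕ.s≤s ℕ.z≤n)

    0<Q : 0ℚ < Q
    0<Q = <-≤-trans 0<1 1≤Q

    1≤Q³ : 1ℚ ≤ Q³
    1≤Q³ = 1≤^ 1≤Q 3

    0<Q³ : 0ℚ < Q³
    0<Q³ = ^-pos 0<Q 3

    1<Q³ : 1ℚ < Q³
    1<Q³ = subst (_< Q³) (1^ 3) (^-monoˡ-< {k = 3} (ℕ.s≤s ℕ.z≤n) (<⇒≤ 0<1) (ι-mono-< {1} {q} (ℕ.s≤s 1≤m)))

    -- The cube of the objective function.
    Φ : Point → ℚ
    Φ p = geomℚ (x p) q ^ 3 * x⁻¹ p ^ m

    0<geomℚ : ∀ p → 0ℚ < geomℚ (x p) q
    0<geomℚ p = <-≤-trans 0<1 (1≤geomℚ (<⇒≤ (0<x p)) m)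

    0<Φ : ∀ p → 0ℚ < Φ p
    0<Φ p = *-pos (^-pos (0<geomℚ p) 3) (^-pos (0<x⁻¹ p) m)

    -- Φ blows up at 0, so only points away from 0 have to be searched.
    x⁻¹≤Φ : ∀ p → x⁻¹ p ≤ Φ p
    x⁻¹≤Φ p = subst₂ _≤_ (trans (*-identityˡ _) (*-identityʳ _)) refl
      (*-mono-≤ (<⇒≤ 0<1) (*-nonNeg (<⇒≤ (0<x⁻¹ p)) (<⇒≤ 0<1)) (1≤^ (1≤geomℚ (<⇒≤ (0<x p)) m) 3)
        (^-monoʳ-≤ (<⇒≤ (1<x⁻¹ p)) 1≤m))

    1<Φ : ∀ p → 1ℚ < Φ p
    1<Φ p = <-≤-trans (1<x⁻¹ p) (x⁻¹≤Φ p)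

    -- (1 + X)³ < 8 X for X slightly below 1: at X = 1 there is equality and the
    -- slopes are 12 and 8.
    ∃Φ<Q³ : ∃ λ p → Φ p < Q³
    ∃Φ<Q³ = p , Φ<Q³
      where
      open ≤-Reasoning
      2ℚ = 1ℚ + 1ℚ
      0<2 : 0ℚ < 2ℚ
      0<2 = +-pos 0<1 0<1
      1<2 : 1ℚ < 2ℚ
      1<2 = subst (_< 2ℚ) (+-identityʳ 1ℚ) (+-monoʳ-< 1ℚ 0<1)
      -- It suffices that X = t^m lies between 1/2 and 1: then 8 X - (1 + X)³ = (1 - X) (X² + 2 X +
      -- (2 X - 1)) is positive, and the trapezoid bound 2 G ≤ q (1 + X) reduces the claim to this.
      sh : Shrink 1ℚ 2ℚ m
      sh = shrink 1<2 0<2 m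
      module S = Shrink sh
      p : Point
      p = record { x = S.t ; x⁻¹ = S.t⁻¹ ; 0<x = S.0<t ; x<1 = S.t<1 ; xx⁻¹≡1 = S.tt⁻¹≡1 }
      estimate : ∀ t t⁻¹ → 0ℚ < t → t < 1ℚ → t * t⁻¹ ≡ 1ℚ → 1ℚ < t ^ m * 2ℚ → geomℚ t q ^ 3 * t⁻¹ ^ m < Q³
      estimate t t⁻¹ 0<t t<1 tt⁻¹≡1 1<2X = *-cancelʳ-< (<⇒≤ (^-pos 0<t m)) (*-cancelˡ-< (<⇒≤ (^-pos 0<2 3)) (begin-strict
        2ℚ ^ 3 * (G ^ 3 * t⁻¹ ^ m * X)      ≡⟨ cong (2ℚ ^ 3 *_) (trans (*-assoc (G ^ 3) (t⁻¹ ^ m) X) (trans (cong (G ^ 3 *_) (^-inverse m (trans (*-comm t⁻¹ t) tt⁻¹≡1))) (*-identityʳ (G ^ 3)))) ⟩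
        2ℚ ^ 3 * G ^ 3                      ≡⟨ ^-distrib-* 2ℚ G 3 ⟨
        (2ℚ * G) ^ 3                        ≤⟨ ^-monoˡ-≤ 3 (*-nonNeg (<⇒≤ 0<2) (geomℚ-nonNeg (<⇒≤ 0<t) q)) (subst (_≤ Q * (1ℚ + X)) (double G) (geomℚ-trapezoid (<⇒≤ 0<t) (<⇒≤ t<1) m)) ⟩
        (Q * (1ℚ + X)) ^ 3                  ≡⟨ ^-distrib-* Q (1ℚ + X) 3 ⟩
        Q³ * (1ℚ + X) ^ 3                   <⟨ *-monoˡ-< 0<Q³ cubic ⟩
        Q³ * (2ℚ ^ 3 * X)                   ≡⟨ swap Q³ (2ℚ ^ 3) X ⟩
        2ℚ ^ 3 * (Q³ * X)                   ∎))
        where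
        G = geomℚ t q
        X = t ^ m
        0<X = ^-pos 0<t m
        X<1 : X < 1ℚ
        X<1 = subst (X <_) (1^ m) (^-monoˡ-< 1≤m (<⇒≤ 0<t) t<1)
        double : ∀ g → g + g ≡ (1ℚ + 1ℚ) * g
        double = solve-∀ ℚ-ring
        swap : ∀ x y z → x * (y * z) ≡ y * (x * z)
        swap = solve-∀ ℚ-ring
        difference : ∀ X → (1ℚ - X) * (X * X + X + X + (X * (1ℚ + 1ℚ) - 1ℚ))
          ≡ (1ℚ + 1ℚ) * ((1ℚ + 1ℚ) * ((1ℚ + 1ℚ) * 1ℚ)) * X - (1ℚ + X) * ((1ℚ + X) * ((1ℚ + X) * 1ℚ))
        difference = solve-∀ ℚ-ring
        cubic : (1ℚ + X) ^ 3 < 2ℚ ^ 3 * X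
        cubic = 0<-⇒< (subst (0ℚ <_) (difference X)
          (*-pos (<⇒0<- X<1) (+-pos (+-pos (+-pos (*-pos 0<X 0<X) 0<X) 0<X) (<⇒0<- 1<2X))))
      Φ<Q³ : Φ p < Q³
      Φ<Q³ = estimate S.t S.t⁻¹ S.0<t S.t<1 S.tt⁻¹≡1 S.a<t^k*b

    -- Replacing a point by the next grid point costs a factor of at most r ^ (m k),
    -- which the gap s < s′ absorbs.
    module Search {s s′ t k : ℕ} (1≤k : 1 ℕ.≤ k) (s<s′ : s ℕ.< s′) (sh : Shrink 1ℚ Q³ (m ℕ.* k)) where

      open Shrink sh using () renaming (t to r; t⁻¹ to r⁻¹; 0<t to 0<r; t<1 to r<1; tt⁻¹≡1 to rr⁻¹≡1; a<t^k*b to 1<r^mk*Q³; 1<t⁻¹ to 1<r⁻¹)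

      gridPoint : ℕ → Point
      gridPoint j = record
        { x = r ^ suc j ; x⁻¹ = r⁻¹ ^ suc j ; 0<x = ^-pos 0<r (suc j)
        ; x<1 = ≤-<-trans (subst (r * r ^ j ≤_) (*-identityʳ r) (*-monoˡ-≤ (<⇒≤ 0<r) (^≤1 (<⇒≤ 0<r) (<⇒≤ r<1) j))) r<1
        ; xx⁻¹≡1 = ^-inverse {r} {r⁻¹} (suc j) rr⁻¹≡1 }

      -- Let a be the grid point r^(j + 1). From a ≤ x ≤ a / r follows Φ(x) ≥ r^m Φ(a), and r^(m k)
      -- q³ > 1 makes up for the loss because s + 1 ≤ s′.
      above : ∀ j p → r ^ suc j ≤ x p → x p ≤ r ^ j →
        ¬ Φ (gridPoint j) < Q³ ^[ s′ - t / k ] → ¬ Φ p < Q³ ^[ s - t / k ]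
      above j p lo hi ≮ Φp< = <-irrefl refl (begin-strict
        Φ p ^ k * Q³ ^ t                         <⟨ Φp< ⟩
        Q³ ^ s                                   ≡⟨ *-identityˡ (Q³ ^ s) ⟨
        1ℚ * Q³ ^ s                              <⟨ *-monoʳ-< (^-pos 0<Q³ s) 1<r^mk*Q³ ⟩
        r ^ (m ℕ.* k) * Q³ * Q³ ^ s              ≡⟨ *-assoc (r ^ (m ℕ.* k)) Q³ (Q³ ^ s) ⟩
        r ^ (m ℕ.* k) * Q³ ^ suc s               ≤⟨ *-monoˡ-≤ (^-nonNeg 0≤r (m ℕ.* k)) (^-monoʳ-≤ 1≤Q³ s<s′) ⟩
        r ^ (m ℕ.* k) * Q³ ^ s′                  ≤⟨ *-monoˡ-≤ (^-nonNeg 0≤r (m ℕ.* k)) (≮⇒≥ ≮) ⟩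
        r ^ (m ℕ.* k) * (Φ a ^ k * Q³ ^ t)       ≡⟨ cong (_* (Φ a ^ k * Q³ ^ t)) (^-assocʳ r m k) ⟨
        (r ^ m) ^ k * (Φ a ^ k * Q³ ^ t)         ≡⟨ *-assoc ((r ^ m) ^ k) (Φ a ^ k) (Q³ ^ t) ⟨
        (r ^ m) ^ k * Φ a ^ k * Q³ ^ t           ≡⟨ cong (_* Q³ ^ t) (^-distrib-* (r ^ m) (Φ a) k) ⟨
        (r ^ m * Φ a) ^ k * Q³ ^ t               ≤⟨ *-monoʳ-≤ (^-nonNeg (<⇒≤ 0<Q³) t) (^-monoˡ-≤ k (*-nonNeg (^-nonNeg 0≤r m) (<⇒≤ (0<Φ a))) step) ⟩
        Φ p ^ k * Q³ ^ t                         ∎)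
        where
        open ≤-Reasoning
        a = gridPoint j
        0≤r = <⇒≤ 0<r
        0≤r⁻¹ = <⇒≤ (<-trans 0<1 1<r⁻¹)
        swap : ∀ u v w → u * (v * w) ≡ v * (u * w)
        swap = solve-∀ ℚ-ring
        cancel-r : r * r⁻¹ ^ suc j ≡ r⁻¹ ^ j
        cancel-r = trans (sym (*-assoc r r⁻¹ (r⁻¹ ^ j))) (trans (cong (_* r⁻¹ ^ j) rr⁻¹≡1) (*-identityˡ _))
        step : r ^ m * Φ a ≤ Φ p
        step = begin
          r ^ m * (geomℚ (x a) q ^ 3 * (r⁻¹ ^ suc j) ^ m)   ≡⟨ swap (r ^ m) (geomℚ (x a) q ^ 3) ((r⁻¹ ^ suc j) ^ m) ⟩
          geomℚ (x a) q ^ 3 * (r ^ m * (r⁻¹ ^ suc j) ^ m)   ≡⟨ cong (geomℚ (x a) q ^ 3 *_) (^-distrib-* r (r⁻¹ ^ suc j) m) ⟨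
          geomℚ (x a) q ^ 3 * (r * r⁻¹ ^ suc j) ^ m         ≡⟨ cong (λ w → geomℚ (x a) q ^ 3 * w ^ m) cancel-r ⟩
          geomℚ (x a) q ^ 3 * (r⁻¹ ^ j) ^ m                 ≤⟨ *-mono-≤ (^-nonNeg (<⇒≤ (0<geomℚ a)) 3) (^-nonNeg (^-nonNeg 0≤r⁻¹ j) m)
                                                                 (^-monoˡ-≤ 3 (<⇒≤ (0<geomℚ a)) (geomℚ-mono (<⇒≤ (0<x a)) lo q))
                                                                 (^-monoˡ-≤ m (^-nonNeg 0≤r⁻¹ j) (x⁻¹-antitone p (^-nonNeg 0≤r⁻¹ j) hi (^-inverse {r} {r⁻¹} j rr⁻¹≡1))) ⟩
          geomℚ (x p) q ^ 3 * x⁻¹ p ^ m                     ∎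

      Found Above : Set
      Found = ∃ λ p → Φ p < Q³ ^[ s′ - t / k ]
      Above = ∀ p → ¬ Φ p < Q³ ^[ s - t / k ]

      AboveFrom : ℕ → Set
      AboveFrom j = ∀ p → r ^ j ≤ x p → ¬ Φ p < Q³ ^[ s - t / k ]

      -- The grid is traversed from 1 downwards, and each cell costs one decidable comparison at its
      -- lower end.
      search : ∀ j → Found ⊎ AboveFrom j
      search zero    = inj₂ (λ p 1≤x _ → <-irrefl refl (≤-<-trans 1≤x (x<1 p)))
      search (suc j) = at-gridPoint (_ <? _) (search j)
        where
        at-gridPoint : Dec (Φ (gridPoint j) < Q³ ^[ s′ - t / k ]) → Found ⊎ AboveFrom j → Found ⊎ AboveFrom (suc j)
        at-gridPoint _           (inj₁ found) = inj₁ found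
        at-gridPoint (yes found) (inj₂ _)     = inj₁ (gridPoint j , found)
        at-gridPoint (no ≮)      (inj₂ rest)  = inj₂ λ p lo → Sum.[ rest p , (λ hi → above j p lo hi ≮) ]′ (≤-total (r ^ j) (x p))

      near-zero : ∃ λ j → ∀ p → x p ≤ r ^ j → ¬ Φ p < Q³ ^[ s - t / k ]
      near-zero = from (^-archimedean {d = 1ℚ} {c = Q³ ^ s} 0<1 1<r⁻¹ 0<1)
        where
        from : (∃ λ j → 1 ℕ.≤ j × 1ℚ ^ j * Q³ ^ s < r⁻¹ ^ j * 1ℚ) → ∃ λ j → ∀ p → x p ≤ r ^ j → ¬ Φ p < Q³ ^[ s - t / k ]
        from (j , _ , Q³^s<) = j , λ p x≤r^j Φp< → <-irrefl refl (begin-strict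
          Φ p ^ k * Q³ ^ t     <⟨ Φp< ⟩
          Q³ ^ s               ≡⟨ trans (cong (_* Q³ ^ s) (1^ j)) (*-identityˡ _) ⟨
          1ℚ ^ j * Q³ ^ s      <⟨ Q³^s< ⟩
          r⁻¹ ^ j * 1ℚ         ≡⟨ *-identityʳ _ ⟩
          r⁻¹ ^ j              ≤⟨ x⁻¹-antitone p (^-nonNeg (<⇒≤ (<-trans 0<1 1<r⁻¹)) j) x≤r^j (^-inverse {r} {r⁻¹} j rr⁻¹≡1) ⟩
          x⁻¹ p                ≤⟨ x⁻¹≤Φ p ⟩
          Φ p                  ≡⟨ trans (*-identityʳ _) (*-identityʳ _) ⟨
          Φ p ^ 1 * 1ℚ         ≤⟨ *-mono-≤ (^-nonNeg (<⇒≤ (0<Φ p)) 1) (<⇒≤ 0<1) (^-monoʳ-≤ (<⇒≤ (1<Φ p)) 1≤k) (1≤^ 1≤Q³ t) ⟩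
          Φ p ^ k * Q³ ^ t     ∎)
          where open ≤-Reasoning

      search-all : Found ⊎ Above
      search-all = from near-zero
        where
        from : (∃ λ j → ∀ p → x p ≤ r ^ j → ¬ Φ p < Q³ ^[ s - t / k ]) → Found ⊎ Above
        from (j , small) = Sum.map₂ (λ large p → Sum.[ large p , small p ]′ (≤-total (r ^ j) (x p))) (search j)

    -- This is the locatedness of c: the alternatives overlap between e and f, so a finite search
    -- can decide for one of them.
    dichotomy : ∀ {e f} → e < f → (∃ λ p → (Φ p <Pow) Q³ f) ⊎ (∀ p → ¬ (Φ p <Pow) Q³ e)
    dichotomy {e} {f} e<f = from (commonFraction e f)
      where
      from : (∃ λ s → ∃ λ s′ → ∃ λ t → ∃ λ k → IsFraction e s t k × IsFraction f s′ t k) →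
        (∃ λ p → (Φ p <Pow) Q³ f) ⊎ (∀ p → ¬ (Φ p <Pow) Q³ e)
      from (s , s′ , t , k , fe , ff) = Sum.map
        (λ (p , Φp<) → p , <^⇒<Pow (<⇒≤ (0<Φ p)) 0<Q³ ff Φp<)
        (λ none p Φp< → none p (<Pow⇒<^ (<⇒≤ (0<Φ p)) 0<Q³ fe Φp<))
        (Search.search-all {s} {s′} {t} {k} (IsFraction.1≤k fe) (commonFraction-< fe ff e<f) (shrink 1<Q³ 0<Q³ (m ℕ.* k)))

    1-1- : ∀ e → 1ℚ - (1ℚ - e) ≡ e
    1-1- = solve-∀ ℚ-ring

    1--anti : ∀ {a b} → a < b → 1ℚ - b < 1ℚ - a
    1--anti a<b = +-monoʳ-< 1ℚ (neg-antimono-< a<b)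

    -- c = 1 - log_q inf f, where f³ = Φ.
    c-cut : Cut
    c-cut = record
      { L = λ r → ∃ λ p → (Φ p <Pow) Q³ (1ℚ - r)
      -- The margin s′ < s makes the upper set open, as the condition alone holds also at s = c.
      ; U = λ s → ∃ λ s′ → s′ < s × ∀ p → ¬ (Φ p <Pow) Q³ (1ℚ - s′)
      }

    L-mono : ∀ {r s} p → r ≤ s → (Φ p <Pow) Q³ (1ℚ - s) → (Φ p <Pow) Q³ (1ℚ - r)
    L-mono p r≤s = <Pow-monoʳ (<⇒≤ (0<Φ p)) 1≤Q³ (+-monoʳ-≤ 1ℚ (neg-antimono-≤ r≤s))

    open⇒L : ∀ {r} p → (Φ p <Pow) Q³ (1ℚ - r) → ∃ λ s → r < s × ∃ λ p → (Φ p <Pow) Q³ (1ℚ - s)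
    open⇒L {r} p Φp< = from (<Pow-open (0<Φ p) 0<Q³ Φp<)
      where
      from : (∃ λ e → e < 1ℚ - r × (Φ p <Pow) Q³ e) → _
      from (e , e<1-r , Φp<′) = 1ℚ - e , subst (_< 1ℚ - e) (1-1- r) (1--anti e<1-r) ,
        p , subst ((Φ p <Pow) Q³) (sym (1-1- e)) Φp<′

    -- The exponent is 1, so `∃Φ<Q³` provides the point. Openness of the lower set then gives c > 0.
    0∈L : ∃ λ p → (Φ p <Pow) Q³ (1ℚ - 0ℚ)
    0∈L = from ∃Φ<Q³
      where
      from : (∃ λ p → Φ p < Q³) → ∃ λ p → (Φ p <Pow) Q³ (1ℚ - 0ℚ)
      from (p , Φ<) = p , subst₂ _<_ (sym (*-identityʳ (Φ p))) (sym (*-identityʳ Q³)) Φ<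

    1∈U : ∀ p → ¬ (Φ p <Pow) Q³ (1ℚ - 1ℚ)
    1∈U p Φp< = <-irrefl refl (<-trans (1<Φ p) (subst (_< 1ℚ) (*-identityʳ (Φ p)) Φp<))

    c : ℝ
    c = record
      { cut = c-cut
      ; L-inhabited = 0ℚ , 0∈L
      ; U-inhabited = 1ℚ + 1ℚ , 1ℚ , subst (_< 1ℚ + 1ℚ) (+-identityʳ 1ℚ) (+-monoʳ-< 1ℚ 0<1) , 1∈U
      ; L-lower = λ r<s (p , Φp<) → p , L-mono p (<⇒≤ r<s) Φp<
      ; U-upper = λ r<s (s′ , s′<r , none) → s′ , <-trans s′<r r<s , none
      ; L-open = λ (p , Φp<) → open⇒L p Φp<
      ; U-open = λ (s′ , s′<s , none) → let t , s′<t , t<s = <-dense s′<s in t , t<s , s′ , s′<t , none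
      ; disjoint = λ ((p , Φp<) , s′ , s′<r , none) → none p (L-mono p (<⇒≤ s′<r) Φp<)
      ; located = located
      }
      where
      located : ∀ {r s} → r < s → (∃ λ p → (Φ p <Pow) Q³ (1ℚ - r)) ⊎ (∃ λ s′ → s′ < s × ∀ p → ¬ (Φ p <Pow) Q³ (1ℚ - s′))
      located r<s = let s′ , r<s′ , s′<s = <-dense r<s in
        Sum.map₂ (λ none → s′ , s′<s , none) (dichotomy (1--anti r<s′))

-- Counting light exponents by a generating function.

module Entropy where
  open import Data.Nat.Base as ℕ using (ℕ; zero; suc)
  import Data.Nat.Properties as ℕ
  import Data.Nat.DivMod as ℕ
  open import Data.Rational.Base
  open import Data.Rational.Properties
  open import Data.List.Base using ([]; _∷_; length; filter; map)
  open import Data.Vec.Base as Vec using (replicate)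
  open import Data.Product.Base using (_,_)
  open import Relation.Nullary using (Dec; yes; no)
  open import Relation.Binary.PropositionalEquality
  open import Algebra.Bundles using (CommutativeRing)
  open import Tactic.RingSolver using (solve-∀)
  open OrderedField
  open Exponent
  open Binomials using (splits; splitsⁿ; cons₂)
  open Counting using (lows)
  open ListSum (CommutativeRing.commutativeSemiring +-*-commutativeRing)

  ∑-splits : ∀ x k → ∑ (splits k) (λ (i , _) → x ^ i) ≡ geomℚ x (suc k)
  ∑-splits x zero    = +-comm 1ℚ 0ℚ
  ∑-splits x (suc k) = begin
    1ℚ + ∑ (map (λ (i , j) → suc i , j) (splits k)) (λ (i , _) → x ^ i) ≡⟨ cong (1ℚ +_) (∑-map (λ (i , j) → suc i , j) (splits k) (λ (i , _) → x ^ i)) ⟩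
    1ℚ + ∑ (splits k) (λ (i , _) → x * x ^ i)                    ≡⟨ cong (1ℚ +_) (∑-*ˡ x (splits k) (λ (i , _) → x ^ i)) ⟩
    1ℚ + x * ∑ (splits k) (λ (i , _) → x ^ i)                    ≡⟨ cong (λ t → 1ℚ + x * t) (∑-splits x k) ⟩
    1ℚ + x * geomℚ x (suc k)                                     ≡⟨ geomℚ-suc x (suc k) ⟨
    geomℚ x (suc (suc k))                                        ∎
    where open ≡-Reasoning

  -- Weights add over the coordinates, so the generating function of the box is a product.
  ∑-splitsⁿ : ∀ x m n → ∑ (splitsⁿ (replicate n m)) (λ (I , _) → x ^ Vec.sum I) ≡ geomℚ x (suc m) ^ n
  ∑-splitsⁿ x m zero    = +-identityʳ 1ℚ
  ∑-splitsⁿ x m (suc n) = begin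
    ∑ (splitsⁿ (replicate (suc n) m)) (λ (I , _) → x ^ Vec.sum I)
      ≡⟨ ∑-product cons₂ (splits m) (splitsⁿ (replicate n m)) (λ (I , _) → x ^ Vec.sum I) ⟩
    ∑ (splits m) (λ (i , _) → ∑ (splitsⁿ (replicate n m)) (λ (I , _) → x ^ (i ℕ.+ Vec.sum I)))
      ≡⟨ ∑-cong (splits m) (λ (i , _) → ∑-cong (splitsⁿ (replicate n m)) (λ (I , _) → ^-homo-* x i (Vec.sum I))) ⟩
    ∑ (splits m) (λ (i , _) → ∑ (splitsⁿ (replicate n m)) (λ (I , _) → x ^ i * x ^ Vec.sum I))
      ≡⟨ ∑-*-∑ (splits m) (splitsⁿ (replicate n m)) (λ (i , _) → x ^ i) (λ (I , _) → x ^ Vec.sum I) ⟩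
    ∑ (splits m) (λ (i , _) → x ^ i) * ∑ (splitsⁿ (replicate n m)) (λ (I , _) → x ^ Vec.sum I)
      ≡⟨ cong₂ _*_ (∑-splits x m) (∑-splitsⁿ x m n) ⟩
    geomℚ x (suc m) * geomℚ x (suc m) ^ n ∎
    where open ≡-Reasoning

  count-≤-∑ : ∀ {A : Set} {P : A → Set} (P? : ∀ y → Dec (P y)) {c} (f : A → ℚ) → (∀ y → 0ℚ ≤ f y) →
    (∀ y → P y → c ≤ f y) → ∀ ys → ι (length (filter P? ys)) * c ≤ ∑ ys f
  count-≤-∑ P? {c} f 0≤f c≤f []       = ≤-reflexive (*-zeroˡ c)
  count-≤-∑ P? {c} f 0≤f c≤f (y ∷ ys) with P? y
  ... | yes Py = begin
    ι (suc (length (filter P? ys))) * c     ≡⟨ cong (_* c) (ι-+ 1 (length (filter P? ys))) ⟩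
    (1ℚ + ι (length (filter P? ys))) * c    ≡⟨ expand (ι (length (filter P? ys))) c ⟩
    c + ι (length (filter P? ys)) * c       ≤⟨ +-mono-≤ (c≤f y Py) (count-≤-∑ P? f 0≤f c≤f ys) ⟩
    f y + ∑ ys f                            ∎
    where
    open ≤-Reasoning
    expand : ∀ k c → (1ℚ + k) * c ≡ c + k * c
    expand = solve-∀ ℚ-ring
  ... | no _ = subst (_≤ f y + ∑ ys f) (+-identityˡ _) (+-mono-≤ (0≤f y) (count-≤-∑ P? f 0≤f c≤f ys))

  -- A light exponent contributes at least x^D to the generating function, where D is the integer
  -- part of n m / 3, so M x^D ≤ G^n. Cubing removes the fractional power, as x^(n m) ≤ x^(3 D).
  lows≤Φ^n : ∀ {m} (1≤m : 1 ℕ.≤ m) n p → ι (length (lows m n)) ^ 3 ≤ Φ 1≤m p ^ n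
  lows≤Φ^n {m} 1≤m n p = begin
    M ^ 3                                        ≡⟨ *-identityʳ (M ^ 3) ⟨
    M ^ 3 * 1ℚ                                   ≡⟨ cong (M ^ 3 *_) (^-inverse {x} {w} (n ℕ.* m) (Point.xx⁻¹≡1 p)) ⟨
    M ^ 3 * (x ^ (n ℕ.* m) * w ^ (n ℕ.* m))      ≤⟨ *-monoˡ-≤ (^-nonNeg 0≤M 3) (*-monoʳ-≤ (^-nonNeg (<⇒≤ (Point.0<x⁻¹ p)) (n ℕ.* m)) (^-antimonoʳ-≤ 0≤x (<⇒≤ (Point.x<1 p)) D*3≤)) ⟩
    M ^ 3 * (x ^ (D ℕ.* 3) * w ^ (n ℕ.* m))      ≡⟨ *-assoc (M ^ 3) (x ^ (D ℕ.* 3)) (w ^ (n ℕ.* m)) ⟨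
    M ^ 3 * x ^ (D ℕ.* 3) * w ^ (n ℕ.* m)        ≡⟨ cong (_* w ^ (n ℕ.* m)) (trans (cong (M ^ 3 *_) (sym (^-assocʳ x D 3))) (sym (^-distrib-* M (x ^ D) 3))) ⟩
    (M * x ^ D) ^ 3 * w ^ (n ℕ.* m)              ≤⟨ *-monoʳ-≤ (^-nonNeg (<⇒≤ (Point.0<x⁻¹ p)) (n ℕ.* m)) (^-monoˡ-≤ 3 (*-nonNeg 0≤M (^-nonNeg 0≤x D)) Mx^D≤) ⟩
    (G ^ n) ^ 3 * w ^ (n ℕ.* m)                  ≡⟨ cong₂ _*_ (^-comm G n 3) (trans (cong (w ^_) (ℕ.*-comm n m)) (sym (^-assocʳ w m n))) ⟩
    (G ^ 3) ^ n * (w ^ m) ^ n                    ≡⟨ ^-distrib-* (G ^ 3) (w ^ m) n ⟨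
    Φ 1≤m p ^ n                                  ∎
    where
    open ≤-Reasoning
    open Point p using (x) renaming (x⁻¹ to w)
    0≤x = <⇒≤ (Point.0<x p)
    M G : ℚ
    M = ι (length (lows m n))
    G = geomℚ x (suc m)
    0≤M = 0≤ι (length (lows m n))
    D = n ℕ.* m ℕ./ 3
    D*3≤ : D ℕ.* 3 ℕ.≤ n ℕ.* m
    D*3≤ = ℕ.m/n*n≤m (n ℕ.* m) 3
    low≤D : ∀ s → 3 ℕ.* s ℕ.≤ n ℕ.* m → s ℕ.≤ D
    low≤D s 3s≤ = subst (ℕ._≤ D) (trans (cong (ℕ._/ 3) (ℕ.*-comm 3 s)) (ℕ.m*n/n≡m s 3)) (ℕ./-monoˡ-≤ 3 3s≤)
    Mx^D≤ : M * x ^ D ≤ G ^ n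
    Mx^D≤ = subst (M * x ^ D ≤_) (∑-splitsⁿ x m n)
      (count-≤-∑ (λ (I , _) → 3 ℕ.* Vec.sum I ℕ.≤? n ℕ.* m) (λ (I , _) → x ^ Vec.sum I)
        (λ (I , _) → ^-nonNeg 0≤x (Vec.sum I))
        (λ (I , _) low → ^-antimonoʳ-≤ 0≤x (<⇒≤ (Point.x<1 p)) (low≤D (Vec.sum I) low))
        (splitsⁿ (replicate n m)))

-- Interval arithmetic: the objective compared with the rational function Φ.

module CutArithmetic where
  open import Data.Nat.Base as ℕ using (ℕ; zero; suc)
  open import Data.Integer.Base as ℤ using (+_; -[1+_])
  import Data.Integer.Properties as ℤ
  open import Data.Rational.Base
  open import Data.Rational.Properties
  open import Data.Rational.Unnormalised.Base as ℚᵘ using (mkℚᵘ; *≡*)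
  import Data.Rational.Unnormalised.Properties as ℚᵘ
  open import Data.Product.Base using (_×_; _,_; ∃)
  open import Data.Sum.Base as Sum using (_⊎_; inj₁; inj₂)
  open import Data.Empty using (⊥-elim)
  open import Relation.Binary.Definitions using (tri<; tri≈; tri>)
  open import Relation.Binary.PropositionalEquality
  open import Tactic.RingSolver using (solve-∀)
  open import Defs using (Cut; L; U; ℝ; cut; Box; fromℚ; geom; objective; InUnitInterval; Pow<_; _<Pow)
    renaming (_+_ to _+ᶜ_; _*_ to _*ᶜ_; _^ⁿ_ to _^ⁿᶜ_; _^_ to _^ᶜ_; -_ to -ᶜ_)
  open OrderedField
  open RationalPowers
  open Exponent

  private variable
    a b p s : ℚ

  L<U : ∀ (X : ℝ) → L (cut X) a → U (cut X) b → a < b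
  L<U {a} {b} X La Ub with <-cmp a b
  ... | tri< a<b _ _ = a<b
  ... | tri≈ _ refl _ = ⊥-elim (ℝ.disjoint X (La , Ub))
  ... | tri> _ _ b<a = ⊥-elim (ℝ.disjoint X (ℝ.L-lower X b<a La , Ub))

  -- An upper bound of an interval product exceeds every corner value, in particular the product of
  -- the two upper ends.
  ^ⁿ-U : ∀ (X : ℝ) → L (cut X) a → 0ℚ < a → ∀ k {r} → U (cut X ^ⁿᶜ k) r → a ^ k < r
  ^ⁿ-U X La 0<a zero    1<r = 1<r
  ^ⁿ-U X La 0<a (suc k) (B , _ , _ , _ , bd<r) = <-trans
    (*-mono-< (<⇒≤ 0<a) (^-nonNeg (<⇒≤ 0<a) k) (L<U X La (Box.x<b B)) (^ⁿ-U X La 0<a k (Box.y<d B))) bd<r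

  geom-U : ∀ (X : ℝ) → L (cut X) a → 0ℚ < a → ∀ k {r} → U (geom (cut X) k) r → geomℚ a k < r
  geom-U X La 0<a zero    0<r = 0<r
  geom-U X La 0<a (suc k) (_ , _ , Us , Ut , s+t<r) =
    <-trans (+-mono-< (geom-U X La 0<a k Us) (^ⁿ-U X La 0<a k Ut)) s+t<r

  record Represents (X : Cut) (p : ℚ) : Set where
    field
      lower : ∀ {r} → r < p → L X r
      upper : ∀ {r} → p < r → U X r
  open Represents

  fromℚ-represents : ∀ p → Represents (fromℚ p) p
  fromℚ-represents p = record { lower = λ r<p → r<p ; upper = λ p<r → p<r }

  -<⇒<+ : ∀ {r} → r - b < a → r < a + b
  -<⇒<+ {b} {a} {r} r-b<a = subst (_< a + b) (cancel r b) (+-monoˡ-< b r-b<a)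
    where
    cancel : ∀ r b → r - b + b ≡ r
    cancel = solve-∀ ℚ-ring

  <-⇒+< : ∀ {r} → a < r - b → a + b < r
  <-⇒+< {a} {b} {r} a<r-b = subst (a + b <_) (cancel r b) (+-monoˡ-< b a<r-b)
    where
    cancel : ∀ r b → r - b + b ≡ r
    cancel = solve-∀ ℚ-ring

  <+⇒-< : ∀ {r} → r < a + b → r - b < a
  <+⇒-< {a} {b} {r} r<a+b = subst (r - b <_) (cancel a b) (+-monoˡ-< (- b) r<a+b)
    where
    cancel : ∀ a b → a + b - b ≡ a
    cancel = solve-∀ ℚ-ring

  +<⇒<- : ∀ {r} → a + b < r → a < r - b
  +<⇒<- {a} {b} {r} a+b<r = subst (_< r - b) (cancel a b) (+-monoˡ-< (- b) a+b<r)
    where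
    cancel : ∀ a b → a + b - b ≡ a
    cancel = solve-∀ ℚ-ring

  +-represents : ∀ {X Y} → Represents X p → Represents Y s → Represents (X +ᶜ Y) (p + s)
  +-represents {p} {s} {X} {Y} repX repY = record
    { lower = λ {r} r<p+s →
        let a , r-s<a , a<p = <-dense (<+⇒-< {p} {s} r<p+s)
            r-a<s = <+⇒-< {s} {a} (subst (r <_) (+-comm a s) (-<⇒<+ {s} {a} r-s<a))
            b , r-a<b , b<s = <-dense r-a<s
        in a , b , lower repX a<p , lower repY b<s , subst (r <_) (+-comm b a) (-<⇒<+ {a} {b} r-a<b)
    ; upper = λ {r} p+s<r →
        let a , p<a , a<r-s = <-dense (+<⇒<- {p} {s} p+s<r)
            s<r-a = +<⇒<- {s} {a} (subst (_< r) (+-comm a s) (<-⇒+< {a} {s} a<r-s))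
            b , s<b , b<r-a = <-dense s<r-a
        in a , b , upper repX p<a , upper repY s<b , subst (_< r) (+-comm b a) (<-⇒+< {b} {a} b<r-a)
    }

  shrinks : ∀ {t} → t < 1ℚ → 0ℚ < p → t * p < p
  shrinks {p} {t} t<1 0<p = subst (t * p <_) (*-identityˡ p) (*-monoʳ-< 0<p t<1)

  expands : ∀ {t} → 1ℚ < t → 0ℚ < p → p < t * p
  expands {p} {t} 1<t 0<p = subst (_< t * p) (*-identityˡ p) (*-monoʳ-< 0<p 1<t)

  -- The box from t p to p / t and from t s to s / t has extreme corner values t² p s and p s / t²,
  -- hence two copies of t.
  *-represents : ∀ {X Y} → 0ℚ < p → 0ℚ < s → Represents X p → Represents Y s → Represents (X *ᶜ Y) (p * s)
  *-represents {p} {s} {X} {Y} 0<p 0<s repX repY = record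
    { lower = λ r<ps → lower′ (shrink r<ps (*-pos 0<p 0<s) 2)
    ; upper = λ ps<r → upper′ (shrink ps<r (<-trans (*-pos 0<p 0<s) ps<r) 2) }
    where
    box : ∀ {t t⁻¹} → 0ℚ < t → t < 1ℚ → 1ℚ < t⁻¹ → Box X Y
    box {t} {t⁻¹} 0<t t<1 1<t⁻¹ = record
      { a = t * p ; b = t⁻¹ * p ; c = t * s ; d = t⁻¹ * s
      ; a<x = lower repX (shrinks t<1 0<p) ; x<b = upper repX (expands 1<t⁻¹ 0<p)
      ; c<y = lower repY (shrinks t<1 0<s) ; y<d = upper repY (expands 1<t⁻¹ 0<s) }
    lower′ : ∀ {r} → Shrink r (p * s) 2 → L (X *ᶜ Y) r
    lower′ {r} sh = box 0<t t<1 1<t⁻¹ , r<ac , <-≤-trans r<ac (*-monoˡ-≤ 0≤a c≤d)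
      , <-≤-trans r<ac (*-monoʳ-≤ 0≤c a≤b) , <-≤-trans r<ac (*-mono-≤ 0≤a 0≤c a≤b c≤d)
      where
      open Shrink sh
      0≤a = <⇒≤ (*-pos 0<t 0<p)
      0≤c = <⇒≤ (*-pos 0<t 0<s)
      a≤b = <⇒≤ (<-trans (shrinks t<1 0<p) (expands 1<t⁻¹ 0<p))
      c≤d = <⇒≤ (<-trans (shrinks t<1 0<s) (expands 1<t⁻¹ 0<s))
      regroup : ∀ t p s → t * (t * 1ℚ) * (p * s) ≡ t * p * (t * s)
      regroup = solve-∀ ℚ-ring
      r<ac = subst (r <_) (regroup t p s) a<t^k*b
    upper′ : ∀ {r} → Shrink (p * s) r 2 → U (X *ᶜ Y) r
    upper′ {r} sh = box 0<t t<1 1<t⁻¹ , ≤-<-trans (*-mono-≤ 0≤a 0≤c a≤b c≤d) bd<r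
      , ≤-<-trans (*-monoʳ-≤ (≤-trans 0≤c c≤d) a≤b) bd<r , ≤-<-trans (*-monoˡ-≤ (≤-trans 0≤a a≤b) c≤d) bd<r , bd<r
      where
      open Shrink sh
      0≤a = <⇒≤ (*-pos 0<t 0<p)
      0≤c = <⇒≤ (*-pos 0<t 0<s)
      a≤b = <⇒≤ (<-trans (shrinks t<1 0<p) (expands 1<t⁻¹ 0<p))
      c≤d = <⇒≤ (<-trans (shrinks t<1 0<s) (expands 1<t⁻¹ 0<s))
      regroup : ∀ t w p s → t * (t * 1ℚ) * (w * p * (w * s)) ≡ t * w * (t * w) * (p * s)
      regroup = solve-∀ ℚ-ring
      bd<r : t⁻¹ * p * (t⁻¹ * s) < r
      bd<r = *-cancelˡ-< (^-nonNeg (<⇒≤ 0<t) 2) (subst (_< t ^ 2 * r)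
        (sym (trans (regroup t t⁻¹ p s) (trans (cong (λ z → z * z * (p * s)) tt⁻¹≡1) (*-identityˡ (p * s))))) a<t^k*b)

  ^ⁿ-represents : 0ℚ < p → ∀ k → Represents (fromℚ p ^ⁿᶜ k) (p ^ k)
  ^ⁿ-represents 0<p zero    = fromℚ-represents 1ℚ
  ^ⁿ-represents {p} 0<p (suc k) =
    *-represents 0<p (^-pos 0<p k) (fromℚ-represents p) (^ⁿ-represents 0<p k)

  geom-represents : 0ℚ < p → ∀ k → Represents (geom (fromℚ p) k) (geomℚ p k)
  geom-represents 0<p zero    = fromℚ-represents 0ℚ
  geom-represents 0<p (suc k) = +-represents (geom-represents 0<p k) (^ⁿ-represents 0<p k)

  fromℚ-real : ℚ → ℝ
  fromℚ-real p = record
    { cut = fromℚ p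
    ; L-inhabited = p - 1ℚ , subst (p - 1ℚ <_) (+-identityʳ p) (+-monoʳ-< p (neg-antimono-< 0<1))
    ; U-inhabited = p + 1ℚ , subst (_< p + 1ℚ) (+-identityʳ p) (+-monoʳ-< p 0<1)
    ; L-lower = <-trans
    ; U-upper = λ r<s p<r → <-trans p<r r<s
    ; L-open = λ r<p → let s , r<s , s<p = <-dense r<p in s , r<s , s<p
    ; U-open = λ p<s → let r , p<r , r<s = <-dense p<s in r , r<s , p<r
    ; disjoint = λ (r<p , p<r) → <-asym r<p p<r
    ; located = λ {r} {s} r<s → Sum.map₂ (λ p≤r → ≤-<-trans p≤r r<s) (compare r)
    }
    where
    compare : ∀ r → r < p ⊎ p ≤ r
    compare r with <-cmp r p
    ... | tri< r<p _ _ = inj₁ r<p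
    ... | tri≈ _ refl _ = inj₂ ≤-refl
    ... | tri> _ _ p<r = inj₂ (<⇒≤ p<r)

  <Pow-nonPos : ∀ {u} e → e ≤ 0ℚ → 0ℚ ≤ u → u < 1ℚ → 0ℚ < a → a ≤ 1ℚ → (u <Pow) a e
  <Pow-nonPos {a} {u} (mkℚ (+ zero) d-1 _) e≤0 0≤u u<1 0<a a≤1 =
    subst (u ^ suc d-1 <_) (1^ (suc d-1)) (^-monoˡ-< {k = suc d-1} (ℕ.s≤s ℕ.z≤n) 0≤u u<1)
  <Pow-nonPos e@(mkℚ (+ suc _) _ _) e≤0 0≤u u<1 0<a a≤1 =
    ⊥-elim (<-irrefl refl (<-≤-trans (positive⁻¹ e) e≤0))
  <Pow-nonPos {a} {u} (mkℚ -[1+ n ] d-1 _) e≤0 0≤u u<1 0<a a≤1 = ≤-<-trans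
    (subst (u ^ suc d-1 * a ^ suc n ≤_) (*-identityʳ (u ^ suc d-1)) (*-monoˡ-≤ (^-nonNeg 0≤u (suc d-1)) (^≤1 (<⇒≤ 0<a) a≤1 (suc n))))
    (subst (u ^ suc d-1 <_) (1^ (suc d-1)) (^-monoˡ-< {k = suc d-1} (ℕ.s≤s ℕ.z≤n) 0≤u u<1))

  Pow<-negMonoˡ : ∀ {u} e → e < 0ℚ → 0ℚ ≤ u → 0ℚ < a → a ≤ b → (Pow< u) a e → (Pow< u) b e
  Pow<-negMonoˡ e@(mkℚ (+ _) _ _) e<0 0≤u 0<a a≤b p = ⊥-elim (<-irrefl refl (≤-<-trans (nonNegative⁻¹ e) e<0))
  Pow<-negMonoˡ (mkℚ -[1+ n ] d-1 _) e<0 0≤u 0<a a≤b p = <-≤-trans p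
    (*-monoˡ-≤ (^-nonNeg 0≤u (suc d-1)) (^-monoˡ-≤ (suc n) (<⇒≤ 0<a) a≤b))

  /3*3 : ∀ m → (+ m / 3) * ι 3 ≡ ι m
  /3*3 m = toℚᵘ-injective (ℚᵘ.≃-trans (toℚᵘ-homo-* (+ m / 3) (ι 3))
    (ℚᵘ.≃-trans (ℚᵘ.*-cong (toℚᵘ-fromℚᵘ (mkℚᵘ (+ m) 2)) (toℚᵘ-ι 3))
    (ℚᵘ.≃-trans (*≡* (ℤ.*-identityʳ (+ m ℤ.* + 3))) (ℚᵘ.≃-sym (toℚᵘ-ι m)))))

  <⇒<- : ∀ {e f} → e < - f → f < - e
  <⇒<- {e} {f} e<-f = subst (_< - e) (neg-involutive f) (neg-antimono-< e<-f)
    where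
    neg-involutive : ∀ f → - - f ≡ f
    neg-involutive = solve-∀ ℚ-ring

  module _ {m : ℕ} (1≤m : 1 ℕ.≤ m) where

    e₀ : ℚ
    e₀ = + m / 3

    -e₀-fraction : IsFraction (- e₀) 0 m 3
    -e₀-fraction = fraction (ℕ.s≤s ℕ.z≤n) (begin
      - e₀ * ι 3 + ι m      ≡⟨ cong (_+ ι m) (neg-distribˡ-* e₀ (ι 3)) ⟨
      - (e₀ * ι 3) + ι m    ≡⟨ cong (λ z → - z + ι m) (/3*3 m) ⟩
      - ι m + ι m           ≡⟨ +-inverseˡ (ι m) ⟩
      0ℚ                    ∎)
      where open ≡-Reasoning

    0<e₀ : 0ℚ < e₀
    0<e₀ = *-cancelʳ-< (0≤ι 3) (subst₂ _<_ (sym (*-zeroˡ (ι 3))) (sym (/3*3 m)) (0<ι 1≤m))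

    Pow<⇒1< : 0ℚ < a → 0ℚ ≤ b → (Pow< b) a (- e₀) → 1ℚ < b ^ 3 * a ^ m
    Pow<⇒1< 0<a 0≤b = Pow<⇒^< 0≤b 0<a -e₀-fraction

    1<⇒Pow< : 0ℚ < a → 0ℚ ≤ b → 1ℚ < b ^ 3 * a ^ m → (Pow< b) a (- e₀)
    1<⇒Pow< 0<a 0≤b = ^<⇒Pow< 0≤b 0<a -e₀-fraction

    -- The bounds hold also at the rational lower end a₁ of the base: β exceeds a₁^(-m / 3) and γ
    -- the geometric sum at a₁, so Φ(a₁) < (β γ)³ < r³.
    objective⇒Φ : ∀ (X : ℝ) → InUnitInterval X → ∀ {r} → U (objective (suc m) X) r →
      0ℚ < r × ∃ λ p → Φ 1≤m p < r ^ 3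
    objective⇒Φ X (_ , (x₁ , X<x₁ , x₁<1)) {r} (B , _ , _ , _ , βγ<r) = from (Box.x<b B)
      where
      β γ : ℚ
      β = Box.b B
      γ = Box.d B
      from : U (cut X ^ᶜ (-ᶜ fromℚ e₀)) β → 0ℚ < r × ∃ λ p → Φ 1≤m p < r ^ 3
      from (B′ , 0<a , 0<β , a^c<β , _) = <-trans (*-pos 0<β 0<γ) βγ<r , from′ (inverse 0<a)
        where
        a₁ = Box.a B′
        c₁ = Box.c B′
        a<1 = <-trans (L<U X (Box.a<x B′) X<x₁) x₁<1
        G<γ = geom-U X (Box.a<x B′) 0<a (suc m) (Box.y<d B)
        0<G : 0ℚ < geomℚ a₁ (suc m)
        0<G = <-≤-trans 0<1 (1≤geomℚ (<⇒≤ 0<a) m)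
        0<γ = <-trans 0<G G<γ
        1<β³a^m : 1ℚ < β ^ 3 * a₁ ^ m
        1<β³a^m = Pow<⇒1< 0<a (<⇒≤ 0<β) (Pow<-antimonoʳ (<⇒≤ 0<β) 0<a (<⇒≤ a<1) (<⇒≤ (<⇒<- {e₀} {c₁} (Box.c<y B′))) a^c<β)
        from′ : (∃ λ w → 0ℚ < w × a₁ * w ≡ 1ℚ) → ∃ λ p → Φ 1≤m p < r ^ 3
        from′ (w , 0<w , aw≡1) = record { x = a₁ ; x⁻¹ = w ; 0<x = 0<a ; x<1 = a<1 ; xx⁻¹≡1 = aw≡1 } , (begin-strict
          geomℚ a₁ (suc m) ^ 3 * w ^ m        <⟨ *-mono-< (^-nonNeg (<⇒≤ 0<G) 3) (^-nonNeg (<⇒≤ 0<w) m) (^-monoˡ-< {k = 3} (ℕ.s≤s ℕ.z≤n) (<⇒≤ 0<G) G<γ) w^m<β³ ⟩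
          γ ^ 3 * β ^ 3                       ≡⟨ trans (*-comm (γ ^ 3) (β ^ 3)) (sym (^-distrib-* β γ 3)) ⟩
          (β * γ) ^ 3                         <⟨ ^-monoˡ-< {k = 3} (ℕ.s≤s ℕ.z≤n) (<⇒≤ (*-pos 0<β 0<γ)) βγ<r ⟩
          r ^ 3                               ∎)
          where
          open ≤-Reasoning
          w^m<β³ : w ^ m < β ^ 3
          w^m<β³ = *-cancelʳ-< (^-nonNeg (<⇒≤ 0<a) m) (subst (_< β ^ 3 * a₁ ^ m)
            (sym (^-inverse {w} {a₁} m (trans (*-comm w a₁) aw≡1))) 1<β³a^m)

    Φ⇒objective : ∀ p {r} → 0ℚ < r → Φ 1≤m p < r ^ 3 → U (objective (suc m) (fromℚ-real (Point.x p))) r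
    -- Take γ = G / t slightly above the geometric sum G, and β = t² r / G. Then β γ = t r < r, and
    -- β³ x^m > 1 amounts to Φ < t⁶ r³, whence the 6 copies of t.
    Φ⇒objective p {r} 0<r Φ<r³ = from (shrink Φ<r³ (^-pos 0<r 3) 6) (inverse 0<G)
      where
      open Point p using (x; 0<x; x<1; xx⁻¹≡1) renaming (x⁻¹ to w)
      G : ℚ
      G = geomℚ x (suc m)
      0<G : 0ℚ < G
      0<G = 0<geomℚ 1≤m p
      from : Shrink (Φ 1≤m p) (r ^ 3) 6 → (∃ λ g → 0ℚ < g × G * g ≡ 1ℚ) → U (objective (suc m) (fromℚ-real x)) r
      from sh (g , 0<g , Gg≡1) = from′ (shrink 1<β³x^m (<-trans 0<1 1<β³x^m) m)
        where
        open Shrink sh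
        β γ : ℚ
        β = t ^ 2 * (r * g)
        γ = t⁻¹ * G
        0<β : 0ℚ < β
        0<β = *-pos (^-pos 0<t 2) (*-pos 0<r 0<g)
        βγ<r : β * γ < r
        βγ<r = subst (_< r) (sym (begin
          t ^ 2 * (r * g) * (t⁻¹ * G)      ≡⟨ regroup t t⁻¹ r g G ⟩
          t * r * (t * t⁻¹ * (G * g))      ≡⟨ cong₂ (λ y z → t * r * (y * z)) tt⁻¹≡1 Gg≡1 ⟩
          t * r * 1ℚ                       ≡⟨ *-identityʳ (t * r) ⟩
          t * r                            ∎)) (shrinks t<1 0<r)
          where
          open ≡-Reasoning
          regroup : ∀ t w r g G → t * (t * 1ℚ) * (r * g) * (w * G) ≡ t * r * (t * w * (G * g))
          regroup = solve-∀ ℚ-ring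
        1<β³x^m : 1ℚ < β ^ 3 * x ^ m
        1<β³x^m = subst₂ _<_ left right (*-monoʳ-< (*-pos (^-pos 0<g 3) (^-pos 0<x m)) a<t^k*b)
          where
          open ≡-Reasoning
          left : geomℚ x (suc m) ^ 3 * w ^ m * (g ^ 3 * x ^ m) ≡ 1ℚ
          left = begin
            G ^ 3 * w ^ m * (g ^ 3 * x ^ m)       ≡⟨ regroup (G ^ 3) (w ^ m) (g ^ 3) (x ^ m) ⟩
            G ^ 3 * g ^ 3 * (x ^ m * w ^ m)       ≡⟨ cong₂ _*_ (^-inverse {G} {g} 3 Gg≡1) (^-inverse {x} {w} m xx⁻¹≡1) ⟩
            1ℚ * 1ℚ                               ≡⟨ *-identityʳ 1ℚ ⟩
            1ℚ                                    ∎
            where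
            regroup : ∀ a b c d → a * b * (c * d) ≡ a * c * (d * b)
            regroup = solve-∀ ℚ-ring
          right : t ^ 6 * r ^ 3 * (g ^ 3 * x ^ m) ≡ β ^ 3 * x ^ m
          right = begin
            t ^ 6 * r ^ 3 * (g ^ 3 * x ^ m)       ≡⟨ regroup (t ^ 6) (r ^ 3) (g ^ 3) (x ^ m) ⟩
            t ^ 6 * (r ^ 3 * g ^ 3) * x ^ m       ≡⟨ cong₂ (λ y z → y * z * x ^ m) (^-assocʳ t 2 3) (^-distrib-* r g 3) ⟨
            (t ^ 2) ^ 3 * (r * g) ^ 3 * x ^ m     ≡⟨ cong (_* x ^ m) (^-distrib-* (t ^ 2) (r * g) 3) ⟨
            β ^ 3 * x ^ m                         ∎
            where
            regroup : ∀ a b c d → a * b * (c * d) ≡ a * (b * c) * d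
            regroup = solve-∀ ℚ-ring
        1<β : 1ℚ < β
        1<β = ^-cancel-< 3 (<⇒≤ 0<β) (subst₂ _<_ (sym (1^ 3)) (*-identityʳ (β ^ 3))
          (<-≤-trans 1<β³x^m (*-monoˡ-≤ (^-nonNeg (<⇒≤ 0<β) 3) (^≤1 (<⇒≤ 0<x) (<⇒≤ x<1) m))))
        from′ : Shrink 1ℚ (β ^ 3 * x ^ m) m → U (objective (suc m) (fromℚ-real x)) r
        -- The box needs room to the left of x and of -m / 3: `sh′` moves the base to a₁ < x, then
        -- `Pow<-open` moves the exponent to c < -m / 3, both keeping the power below β.
        from′ sh′ = from″ (Pow<-open (<⇒≤ 0<β) 0<a (1<⇒Pow< 0<a (<⇒≤ 0<β) (subst (1ℚ <_) regroup S.a<t^k*b)))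
          where
          module S = Shrink sh′
          a₁ : ℚ
          a₁ = S.t * x
          0<a : 0ℚ < a₁
          0<a = *-pos S.0<t 0<x
          a<x : a₁ < x
          a<x = shrinks S.t<1 0<x
          a≤1 = <⇒≤ (<-trans a<x x<1)
          regroup : S.t ^ m * (β ^ 3 * x ^ m) ≡ β ^ 3 * a₁ ^ m
          regroup = trans (swap (S.t ^ m) (β ^ 3) (x ^ m)) (cong (β ^ 3 *_) (sym (^-distrib-* S.t x m)))
            where
            swap : ∀ u v w → u * (v * w) ≡ v * (u * w)
            swap = solve-∀ ℚ-ring
          from″ : (∃ λ c → c < - e₀ × (Pow< β) a₁ c) → U (objective (suc m) (fromℚ-real x)) r
          from″ (c , c<-e₀ , a^c<β) = record
            { a = S.t ; b = β ; c = t * G ; d = γ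
            ; a<x = powerBox , 0<a , S.t , S.0<t , ≤-refl
                  , below a₁ c c≤0 0<a a≤1 , below a₁ 0ℚ ≤-refl 0<a a≤1 , below 1ℚ c c≤0 0<1 ≤-refl , below 1ℚ 0ℚ ≤-refl 0<1 ≤-refl
            ; x<b = powerBox , 0<a , 0<β
                  , a^c<β , subst (1ℚ <_) (sym (*-identityʳ β)) 1<β
                  , Pow<-negMonoˡ c c<0 (<⇒≤ 0<β) 0<a a≤1 a^c<β , subst (1ℚ <_) (sym (*-identityʳ β)) 1<β
            ; c<y = lower (geom-represents 0<x (suc m)) (shrinks t<1 0<G)
            ; y<d = upper (geom-represents 0<x (suc m)) (expands 1<t⁻¹ 0<G)
            } , ≤-<-trans (*-mono-≤ (<⇒≤ S.0<t) 0≤tG t≤β tG≤γ) βγ<r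
              , ≤-<-trans (*-monoʳ-≤ (≤-trans 0≤tG tG≤γ) t≤β) βγ<r
              , ≤-<-trans (*-monoˡ-≤ (<⇒≤ 0<β) tG≤γ) βγ<r
              , βγ<r
            where
            c<0 : c < 0ℚ
            c<0 = <-trans c<-e₀ (neg-antimono-< 0<e₀)
            c≤0 = <⇒≤ c<0
            -- With base from a₁ to 1 and exponent from c to 0, all corner values lie between 1 and
            -- a₁^c. So β is an upper bound, and `S.t`, being below 1, a lower one.
            powerBox : Box (fromℚ x) (-ᶜ fromℚ e₀)
            powerBox = record
              { a = a₁ ; b = 1ℚ ; c = c ; d = 0ℚ
              ; a<x = a<x ; x<b = x<1 ; c<y = <⇒<- {c} {e₀} c<-e₀ ; y<d = 0<e₀ }
            below : ∀ y e → e ≤ 0ℚ → 0ℚ < y → y ≤ 1ℚ → (S.t <Pow) y e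
            below y e e≤0 0<y y≤1 = <Pow-nonPos e e≤0 (<⇒≤ S.0<t) S.t<1 0<y y≤1
            0≤tG = <⇒≤ (*-pos 0<t 0<G)
            t≤β = <⇒≤ (<-trans S.t<1 1<β)
            tG≤γ = <⇒≤ (<-trans (shrinks t<1 0<G) (expands 1<t⁻¹ 0<G))

-- The infimum property of c and the bound on the size of S.

module Bounds where
  open import Data.Nat.Base as ℕ using (ℕ; suc)
  open import Data.Nat.Primality using (Prime)
  open import Data.Rational.Base
  open import Data.Rational.Properties
  open import Data.List.Base using (List; length)
  open import Data.List.Relation.Unary.Unique.Propositional using (Unique)
  open import Data.Product.Base using (_×_; _,_; ∃)
  open import Data.Sum.Base as Sum using ()
  open import Relation.Nullary using (¬_)
  open import Relation.Binary.PropositionalEquality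
  open import Tactic.RingSolver using (solve-∀)
  open import Defs using (Cut; L; U; ℝ; cut; Box; fromℕ; objective; InUnitInterval; IsInfimum; Pow<_; _<Pow; 𝔽^; CornerFree)
    renaming (_*_ to _*ᶜ_; _^_ to _^ᶜ_; _-_ to _-ᶜ_; _<_ to _<ᶜ_; _≤_ to _≤ᶜ_)
  open OrderedField
  open RationalPowers
  open Exponent hiding (q)
  open Counting
  open Entropy
  open CutArithmetic

  <Pow-cube : ∀ {u v a e} → 0ℚ ≤ u → 0ℚ ≤ v → 0ℚ < a → v ≤ u ^ 3 → (u <Pow) a e → (v <Pow) (a ^ 3) e
  <Pow-cube {u} {v} {a} {e} 0≤u 0≤v 0<a v≤u³ u< = <Pow-antimonoˡ {e = e} 0≤v (^-pos 0<a 3) v≤u³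
    (<Pow-raise {e = e} 3 (ℕ.s≤s ℕ.z≤n) 0≤u 0<a u<)

  n∈box⇒ : ∀ {b c d e n} → c ≤ n → n ≤ d → b * c < e → b * d < e → b * n < e
  n∈box⇒ {b} {c} {d} {e} {n} c≤n n≤d bc<e bd<e = Sum.[ 0≤⇒ , ≤0⇒ ]′ (≤-total 0ℚ b)
    where
    0≤⇒ : 0ℚ ≤ b → b * n < e
    0≤⇒ 0≤b = ≤-<-trans (*-monoˡ-≤ 0≤b n≤d) bd<e
    ≤0⇒ : b ≤ 0ℚ → b * n < e
    ≤0⇒ b≤0 = ≤-<-trans (*-monoˡ-≤-nonPos b {{nonPositive b≤0}} c≤n) bc<e

  module _ {m : ℕ} (1≤m : 1 ℕ.≤ m) where

    cᶜ : Cut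
    cᶜ = cut (c 1≤m)

    q : ℕ
    q = suc m

    0<c : fromℕ 0 <ᶜ cᶜ
    0<c = let p , Φp< = 0∈L 1≤m in open⇒L 1≤m p Φp<

    L[1-c]⇒ : ∀ {e} → L (fromℕ 1 -ᶜ cᶜ) e → ∃ λ f → e ≤ f × ∀ p → ¬ (Φ 1≤m p <Pow) (Q³ 1≤m) f
    L[1-c]⇒ {e} (a , b , a<1 , (s , s<-b , none) , e<a+b) = 1ℚ - s , <⇒≤ (<-trans e<a+b
      (+-mono-< a<1 (<⇒<- {s} {b} s<-b))) , none

    U[1-c]⇒ : ∀ {e} → U (fromℕ 1 -ᶜ cᶜ) e → ∃ λ p → (Φ 1≤m p <Pow) (Q³ 1≤m) e
    U[1-c]⇒ {e} (a , b , 1<a , (p , Φp<) , a+b<e) = p , <Pow-monoʳ (<⇒≤ (0<Φ 1≤m p)) (1≤Q³ 1≤m)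
      (<⇒≤ (<-trans (+-mono-<-≤ 1<a (≤-reflexive (neg-involutive b))) a+b<e)) Φp<
      where
      neg-involutive : ∀ b → - - b ≡ b
      neg-involutive = solve-∀ ℚ-ring

    -- The base q lies inside the interval for the base, so `<Pow-between` merges the two corner
    -- bounds at the lower exponent into one at q.
    L[q^]⇒ : ∀ {Y r} → L (fromℕ q ^ᶜ Y) r → ∃ λ u → ∃ λ e → 0ℚ < u × r ≤ u × L Y e × (u <Pow) (Q 1≤m) e
    L[q^]⇒ (B , 0<a , u , 0<u , r≤u , a^c , _ , b^c , _) =
      u , Box.c B , 0<u , r≤u , Box.c<y B ,
      <Pow-between (Box.c B) 0<a (<⇒≤ 0<u) (<⇒≤ (Box.a<x B)) (<⇒≤ (Box.x<b B)) a^c b^c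

    U[q^]⇒ : ∀ {Y r} → U (fromℕ q ^ᶜ Y) r → 0ℚ < r × ∃ λ e → U Y e × (Pow< r) (Q 1≤m) e
    U[q^]⇒ (B , 0<a , 0<r , _ , a^d , _ , b^d) =
      0<r , Box.d B , Box.y<d B ,
      Pow<-between (Box.d B) 0<a (<⇒≤ 0<r) (<⇒≤ (Box.a<x B)) (<⇒≤ (Box.x<b B)) a^d b^d

    -- Both halves pass through Φ at rational points. An upper bound r of the objective gives Φ < r³
    -- somewhere, which a lower bound of q^(1 - c) above r forbids. An upper bound r of q^(1 - c)
    -- gives a rational point where the objective is below r.
    isInfimum : IsInfimum (fromℕ q ^ᶜ (fromℕ 1 -ᶜ cᶜ)) InUnitInterval (objective q)
    isInfimum = lowerBound , greatest
      where
      lowerBound : ∀ X → InUnitInterval X → fromℕ q ^ᶜ (fromℕ 1 -ᶜ cᶜ) ≤ᶜ objective q X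
      lowerBound X X∈ (r , Ur , Lr) =
        let 0<r , p , Φp<r³ = objective⇒Φ 1≤m X X∈ Ur
            u , e , 0<u , r≤u , Le , u<Q^e = L[q^]⇒ Lr
            f , e≤f , none = L[1-c]⇒ Le
        in none p (<Pow-cube {e = f} (<⇒≤ 0<u) (<⇒≤ (0<Φ 1≤m p)) (0<Q 1≤m)
             (≤-trans (<⇒≤ Φp<r³) (^-monoˡ-≤ 3 (<⇒≤ 0<r) r≤u))
             (<Pow-monoʳ (<⇒≤ 0<u) (1≤Q 1≤m) e≤f u<Q^e))
      greatest : ∀ (z : ℝ) → (∀ X → InUnitInterval X → cut z ≤ᶜ objective q X) → cut z ≤ᶜ fromℕ q ^ᶜ (fromℕ 1 -ᶜ cᶜ)
      greatest z z≤ (r , Ur , Lr) =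
        let 0<r , e , Ue , Q^e<r = U[q^]⇒ Ur
            p , Φp< = U[1-c]⇒ Ue
            Φp<r³ = <Pow<⇒< {e = e} (0<Q³ 1≤m) (^-nonNeg (<⇒≤ 0<r) 3) Φp<
                      (Pow<-raise {e = e} 3 (ℕ.s≤s ℕ.z≤n) (0<Q 1≤m) Q^e<r)
        in z≤ (fromℚ-real (Point.x p)) (<-dense (Point.0<x p) , <-dense (Point.x<1 p))
             (r , Φ⇒objective 1≤m p 0<r Φp<r³ , Lr)

    -- Cubed, this is q^(3 n) M³ ≤ q^(3 n) Φ^n < q^(3 n) q^(3 n f). The last step raises a strict
    -- inequality to the n-th power, which uses n ≥ 1.
    lows<Pow : ∀ {f} n → 1 ℕ.≤ n → ∀ p → (Φ 1≤m p <Pow) (Q³ 1≤m) f →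
      (ι (q ℕ.^ n ℕ.* length (lows m n)) <Pow) (Q 1≤m) ((1ℚ + f) * ι n)
    lows<Pow {f} n 1≤n p Φp< = <^⇒<Pow (0≤ι (q ℕ.^ n ℕ.* length (lows m n))) (0<Q 1≤m) frac
      (^-cancel-< 3 (^-nonNeg 0≤Q′ ((F.den ℕ.+ F.num) ℕ.* n)) (begin-strict
        (N ^ F.den * Q′ ^ (F.off ℕ.* n)) ^ 3                ≡⟨ cong (λ z → (z ^ F.den * Q′ ^ (F.off ℕ.* n)) ^ 3) (trans (ι-* (q ℕ.^ n) (length (lows m n))) (cong (_* M) (ι-^ q n))) ⟩
        ((Q′ ^ n * M) ^ F.den * Q′ ^ (F.off ℕ.* n)) ^ 3     ≡⟨ regroup Q′ M F.den F.off ⟩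
        (Q′ ^ F.den) ^ (n ℕ.* 3) * ((M ^ 3) ^ F.den * ((Q′ ^ 3) ^ F.off) ^ n) ≤⟨ *-monoˡ-≤ (^-nonNeg (^-nonNeg 0≤Q′ F.den) (n ℕ.* 3)) (*-monoʳ-≤ (^-nonNeg (^-nonNeg (^-nonNeg 0≤Q′ 3) F.off) n)
                                                               (^-monoˡ-≤ F.den (^-nonNeg (0≤ι (length (lows m n))) 3) (lows≤Φ^n 1≤m n p))) ⟩
        (Q′ ^ F.den) ^ (n ℕ.* 3) * ((Φ 1≤m p ^ n) ^ F.den * ((Q′ ^ 3) ^ F.off) ^ n)
                                                            ≡⟨ cong ((Q′ ^ F.den) ^ (n ℕ.* 3) *_) (trans (cong (_* ((Q′ ^ 3) ^ F.off) ^ n) (^-comm (Φ 1≤m p) n F.den)) (sym (^-distrib-* (Φ 1≤m p ^ F.den) ((Q′ ^ 3) ^ F.off) n))) ⟩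
        (Q′ ^ F.den) ^ (n ℕ.* 3) * (Φ 1≤m p ^ F.den * (Q′ ^ 3) ^ F.off) ^ n
                                                            <⟨ *-monoˡ-< (^-pos (^-pos (0<Q 1≤m) F.den) (n ℕ.* 3)) (^-monoˡ-< 1≤n
                                                                 (*-nonNeg (^-nonNeg (<⇒≤ (0<Φ 1≤m p)) F.den) (^-nonNeg (^-nonNeg 0≤Q′ 3) F.off)) (F.<Pow⇒ Φp<)) ⟩
        (Q′ ^ F.den) ^ (n ℕ.* 3) * ((Q′ ^ 3) ^ F.num) ^ n   ≡⟨ collect Q′ F.den F.num ⟩
        (Q′ ^ ((F.den ℕ.+ F.num) ℕ.* n)) ^ 3                ∎))
      where
      open ≤-Reasoning
      module F = Canonical (canonical f)
      Q′ M N : ℚ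
      Q′ = Q 1≤m
      M = ι (length (lows m n))
      N = ι (q ℕ.^ n ℕ.* length (lows m n))
      0≤Q′ = <⇒≤ (0<Q 1≤m)
      frac : IsFraction ((1ℚ + f) * ι n) ((F.den ℕ.+ F.num) ℕ.* n) (F.off ℕ.* n) F.den
      frac = fraction F.1≤k (begin-equality
        (1ℚ + f) * ι n * ι F.den + ι (F.off ℕ.* n)     ≡⟨ cong ((1ℚ + f) * ι n * ι F.den +_) (ι-* F.off n) ⟩
        (1ℚ + f) * ι n * ι F.den + ι F.off * ι n       ≡⟨ expand f (ι n) (ι F.den) (ι F.off) ⟩
        (ι F.den + (f * ι F.den + ι F.off)) * ι n      ≡⟨ cong (λ z → (ι F.den + z) * ι n) F.e*k+t≡s ⟩
        (ι F.den + ι F.num) * ι n                      ≡⟨ trans (ι-* (F.den ℕ.+ F.num) n) (cong (_* ι n) (ι-+ F.den F.num)) ⟨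
        ι ((F.den ℕ.+ F.num) ℕ.* n)                    ∎)
        where
        expand : ∀ f n k t → (1ℚ + f) * n * k + t * n ≡ (k + (f * k + t)) * n
        expand = solve-∀ ℚ-ring
      regroup : ∀ a b k t → ((a ^ n * b) ^ k * a ^ (t ℕ.* n)) ^ 3 ≡ (a ^ k) ^ (n ℕ.* 3) * ((b ^ 3) ^ k * ((a ^ 3) ^ t) ^ n)
      regroup a b k t = begin-equality
        ((a ^ n * b) ^ k * a ^ (t ℕ.* n)) ^ 3              ≡⟨ ^-distrib-* ((a ^ n * b) ^ k) (a ^ (t ℕ.* n)) 3 ⟩
        ((a ^ n * b) ^ k) ^ 3 * (a ^ (t ℕ.* n)) ^ 3        ≡⟨ cong₂ _*_ (trans (cong (_^ 3) (^-distrib-* (a ^ n) b k)) (^-distrib-* ((a ^ n) ^ k) (b ^ k) 3))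
                                                                (trans (cong (_^ 3) (sym (^-assocʳ a t n))) (trans (^-comm (a ^ t) n 3) (cong (_^ n) (^-comm a t 3)))) ⟩
        ((a ^ n) ^ k) ^ 3 * (b ^ k) ^ 3 * ((a ^ 3) ^ t) ^ n ≡⟨ cong₂ (λ y z → y * z * ((a ^ 3) ^ t) ^ n) (trans (cong (_^ 3) (^-comm a n k)) (^-assocʳ (a ^ k) n 3)) (^-comm b k 3) ⟩
        (a ^ k) ^ (n ℕ.* 3) * (b ^ 3) ^ k * ((a ^ 3) ^ t) ^ n ≡⟨ *-assoc ((a ^ k) ^ (n ℕ.* 3)) ((b ^ 3) ^ k) (((a ^ 3) ^ t) ^ n) ⟩
        (a ^ k) ^ (n ℕ.* 3) * ((b ^ 3) ^ k * ((a ^ 3) ^ t) ^ n) ∎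
      collect : ∀ a k s → (a ^ k) ^ (n ℕ.* 3) * ((a ^ 3) ^ s) ^ n ≡ (a ^ ((k ℕ.+ s) ℕ.* n)) ^ 3
      collect a k s = begin-equality
        (a ^ k) ^ (n ℕ.* 3) * ((a ^ 3) ^ s) ^ n            ≡⟨ cong₂ _*_ (sym (^-assocʳ (a ^ k) n 3)) (trans (cong (_^ n) (^-comm a 3 s)) (^-comm (a ^ s) 3 n)) ⟩
        ((a ^ k) ^ n) ^ 3 * ((a ^ s) ^ n) ^ 3              ≡⟨ ^-distrib-* ((a ^ k) ^ n) ((a ^ s) ^ n) 3 ⟨
        ((a ^ k) ^ n * (a ^ s) ^ n) ^ 3                    ≡⟨ cong (_^ 3) (^-distrib-* (a ^ k) (a ^ s) n) ⟨
        ((a ^ k * a ^ s) ^ n) ^ 3                          ≡⟨ cong (λ z → (z ^ n) ^ 3) (^-homo-* a k s) ⟨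
        ((a ^ (k ℕ.+ s)) ^ n) ^ 3                          ≡⟨ cong (_^ 3) (^-assocʳ a (k ℕ.+ s) n) ⟩
        (a ^ ((k ℕ.+ s) ℕ.* n)) ^ 3                        ∎

    exponent⇒ : ∀ n {e} → U ((fromℕ 2 -ᶜ cᶜ) *ᶜ fromℕ n) e →
      ∃ λ p → ∃ λ f → (Φ 1≤m p <Pow) (Q³ 1≤m) f × (1ℚ + f) * ι n ≤ e
    exponent⇒ n {e} (B , _ , _ , bc<e , bd<e) = from (Box.x<b B)
      where
      from : U (fromℕ 2 -ᶜ cᶜ) (Box.b B) → ∃ λ p → ∃ λ f → (Φ 1≤m p <Pow) (Q³ 1≤m) f × (1ℚ + f) * ι n ≤ e
      -- -b lies in the lower set of c, which supplies p with exponent f = 1 + b. Then 1 + f = 2 + b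
      -- lies below β.
      from (a , b , 2<a , (p , Φp<) , a+b<β) = p , 1ℚ - (- b) , Φp< , ≤-trans
        (*-monoʳ-≤ (0≤ι n) (≤-trans (≤-reflexive (regroup b)) (<⇒≤ (<-trans (+-monoˡ-< b 2<a) a+b<β))))
        (<⇒≤ (n∈box⇒ {Box.b B} {Box.c B} {Box.d B} {e} (<⇒≤ (Box.c<y B)) (<⇒≤ (Box.y<d B)) bc<e bd<e))
        where
        regroup : ∀ b → 1ℚ + (1ℚ - (- b)) ≡ 1ℚ + 1ℚ + b
        regroup = solve-∀ ℚ-ring

    -- A rational r separating the two sides the wrong way exceeds a corner product b d with b > 3
    -- and d > q^n M, against `cornerFree-bound`.
    size-bound : Prime q → ∀ n → 1 ℕ.≤ n → (S : List (𝔽^ q n × 𝔽^ q n)) → Unique S → CornerFree S →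
      fromℕ (length S) ≤ᶜ fromℕ 3 *ᶜ fromℕ q ^ᶜ ((fromℕ 2 -ᶜ cᶜ) *ᶜ fromℕ n)
    size-bound q-prime n 1≤n S uS free (r , (B , _ , _ , _ , bd<r) , r<|S|) =
      let 0<d , e , Ue , Q^e<d = U[q^]⇒ (Box.y<d B)
          p , f , Φp< , [1+f]n≤e = exponent⇒ n Ue
          N<d = <Pow<⇒< {e = e} (0<Q 1≤m) (<⇒≤ 0<d) (<Pow-monoʳ (0≤ι N) (1≤Q 1≤m) [1+f]n≤e (lows<Pow {f} n 1≤n p Φp<)) Q^e<d
      in <-irrefl refl (begin-strict
        ι (length S)         ≤⟨ ι-mono-≤ (SkewCorners.cornerFree-bound q-prime S uS free) ⟩
        ι (3 ℕ.* N)          ≡⟨ ι-* 3 N ⟩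
        ι 3 * ι N            <⟨ *-mono-< (0≤ι 3) (0≤ι N) (Box.x<b B) N<d ⟩
        Box.b B * Box.d B    <⟨ bd<r ⟩
        r                    <⟨ r<|S| ⟩
        ι (length S)         ∎)
      where
      open ≤-Reasoning
      N = q ℕ.^ n ℕ.* length (lows m n)

open import Defs
open import Data.Nat.Base as ℕ using (ℕ; zero; suc; s≤s; z≤n; NonZero)
open import Data.Nat.Primality using (Prime; ¬prime[0]; ¬prime[1])
open import Data.List.Base using (List; length)
open import Data.List.Relation.Unary.Unique.Propositional using (Unique)
open import Data.Product.Base using (_×_; _,_; ∃)
open import Data.Empty using (⊥-elim)

theorem1p2 : ∀ (q : ℕ) .{{_ : NonZero q}} → Prime q →
    ∃ λ (c : ℝ) →
    fromℕ 0 < cut c ×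
    IsInfimum (fromℕ q ^ (fromℕ 1 - cut c)) InUnitInterval (objective q) ×
    (∀ (n : ℕ) → 1 ℕ.≤ n → (S : List (𝔽^ q n × 𝔽^ q n)) → Unique S → CornerFree S →
    fromℕ (length S) ≤ fromℕ 3 * fromℕ q ^ ((fromℕ 2 - cut c) * fromℕ n))
theorem1p2 zero          q-prime = ⊥-elim (¬prime[0] q-prime)
theorem1p2 (suc zero)    q-prime = ⊥-elim (¬prime[1] q-prime)
theorem1p2 (suc (suc k)) q-prime = Exponent.c 1≤m , Bounds.0<c 1≤m , Bounds.isInfimum 1≤m , Bounds.size-bound 1≤m q-prime
  where
  1≤m : 1 ℕ.≤ suc k
  1≤m = s≤s z≤n
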